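{- For $h\ge1$ let $\Delta_h=\sum_{W}p_h^U(W)\,\|W\|$ be the expected displacement of a growing self-avoiding walk on $\mathcal G_h$ starting at $(0,h-1)$ under the uniform model, the sum being over all GSAWs on $\mathcal G_h$ starting at $(0,h-1)$. Then $$\Delta_3=\frac{3013}{389},\qquad \Delta_4=\frac{163501511557499670817}{20874575314535639327},$$ and $\Delta_5$ is a rational number whose value rounded to 10 decimal places is $8.0835861225$.
   Context: $\mathcal G_h$ is the half-infinite grid graph with vertex set $\mathbb N\times\{0,\dots,h-1\}$ ($0\in\mathbb N$), with an edge between two points exactly when they are at Euclidean distance $1$. A growing self-avoiding walk (GSAW) is a finite directed walk that visits no vertex twice and whose final vertex is trapped, i.e. all of its neighbors are visited by the walk. $\|W\|$ is the displacement of $W$: the difference between the largest and smallest $x$-coordinates of its vertices. Uniform model: at each step the next vertex is chosen uniformly at random among the not-yet-visited neighbors of the current endpoint; $p_h^U(W)$ is the product over the steps of $W$ of $1/m$, where $m$ is the number of unvisited neighbors of the current endpoint just before that step. -}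

module Defs where

open import Data.Fin.Base using (Fin; toℕ; fromℕ)
open import Data.Fin.Properties using () renaming (_≟_ to _≟ᶠ_)
open import Data.Integer.Base using (+_)
open import Data.List.Base using (List; []; _∷_; map; foldr; filter; length; upTo; allFin; cartesianProduct)
open import Data.List.Extrema.Nat using (max; min)
import Data.List.Membership.DecPropositional as DecMembership
open import Data.List.Membership.Propositional using (_∈_; _∉_)
open import Data.List.Membership.Propositional.Properties using (∈-filter⁺; ∈-filter⁻; ∈-cartesianProduct⁺; ∈-upTo⁺; ∈-allFin)
open import Data.List.NonEmpty.Base using (List⁺; _∷_)
open import Data.List.Relation.Binary.Subset.Propositional using (_⊆_)
open import Data.List.Relation.Unary.All using (All)
open import Data.List.Relation.Unary.Unique.Propositional using (Unique)
import Data.List.Relation.Unary.Unique.Propositional.Properties as Unique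
open import Data.Nat.Base using (ℕ; zero; suc; _+_; _∸_; _^_; _≤_; _<_; z≤n; s≤s; NonZero; ∣_-_∣)
open import Data.Nat.Properties
open import Data.Product.Base using (_×_; _,_; proj₁; proj₂; ∃-syntax)
open import Data.Product.Properties using (≡-dec)
open import Data.Rational.Base as ℚ using (ℚ; 0ℚ; 1ℚ)
open import Relation.Binary.Definitions using (DecidableEquality)
open import Relation.Binary.PropositionalEquality using (_≡_)
open import Relation.Nullary.Decidable using (Dec; ¬?)

Vertex : ℕ → Set
Vertex h = ℕ × Fin h

infix 4 _≟ᵛ_
_≟ᵛ_ : ∀ {h} → DecidableEquality (Vertex h)
_≟ᵛ_ = ≡-dec _≟_ _≟ᶠ_

-- The square of the Euclidean distance.
dist² : ∀ {h} → Vertex h → Vertex h → ℕ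
dist² (x , y) (x′ , y′) = ∣ x - x′ ∣ ^ 2 + ∣ toℕ y - toℕ y′ ∣ ^ 2

Adjacent : ∀ {h} → Vertex h → Vertex h → Set
Adjacent v w = dist² v w ≡ 1

adjacent? : ∀ {h} (v w : Vertex h) → Dec (Adjacent v w)
adjacent? v w = dist² v w ≟ 1

-- Searching the columns 0, …, x + 1 suffices; see ∈-neighbours⁺.
neighbours : ∀ {h} → Vertex h → List (Vertex h)
neighbours {h} v@(x , _) = filter (adjacent? v) (cartesianProduct (upTo (2 + x)) (allFin h))

∈-neighbours⁺ : ∀ {h} {v w : Vertex h} → Adjacent v w → w ∈ neighbours v
∈-neighbours⁺ {v = v@(x , y)} {w = x′ , y′} adj =
  ∈-filter⁺ (adjacent? v) (∈-cartesianProduct⁺ (∈-upTo⁺ x′<2+x) (∈-allFin y′)) adj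
  where
  ^2≤1⇒≤1 : ∀ n → n ^ 2 ≤ 1 → n ≤ 1
  ^2≤1⇒≤1 zero          _       = z≤n
  ^2≤1⇒≤1 (suc zero)    _       = s≤s z≤n
  ^2≤1⇒≤1 (suc (suc n)) (s≤s ())

  d≤1 : ∣ x - x′ ∣ ≤ 1
  d≤1 = ^2≤1⇒≤1 _ (≤-trans (m≤m+n (∣ x - x′ ∣ ^ 2) _) (≤-reflexive adj))

  x′<2+x : x′ < 2 + x
  x′<2+x = s≤s (≤-trans (m≤n+∣n-m∣ x′ x) (≤-trans (+-monoʳ-≤ x d≤1) (≤-reflexive (+-comm x 1))))

∈-neighbours⁻ : ∀ {h} {v w : Vertex h} → w ∈ neighbours v → Adjacent v w
∈-neighbours⁻ {h} {v@(x , _)} w∈ =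
  proj₂ (∈-filter⁻ (adjacent? v) {xs = cartesianProduct (upTo (2 + x)) (allFin h)} w∈)

neighbours-unique : ∀ {h} (v : Vertex h) → Unique (neighbours v)
neighbours-unique {h} v@(x , _) =
  Unique.filter⁺ (adjacent? v) (Unique.cartesianProduct⁺ (Unique.upTo⁺ (2 + x)) (Unique.allFin⁺ h))

-- A walk is stored as the list of its vertices, most recent vertex first.
Walk : ℕ → Set
Walk h = List⁺ (Vertex h)

data SelfAvoiding {h} (s : Vertex h) : Walk h → Set where
  start : SelfAvoiding s (s ∷ [])
  step  : ∀ {v vs w} → SelfAvoiding s (v ∷ vs) → Adjacent v w → w ∉ v ∷ vs →
          SelfAvoiding s (w ∷ v ∷ vs)

Trapped : ∀ {h} → Walk h → Set
Trapped (v ∷ vs) = ∀ w → Adjacent v w → w ∈ v ∷ vs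

GSAW : ∀ {h} → Vertex h → Walk h → Set
GSAW s W = SelfAvoiding s W × Trapped W

displacement : ∀ {h} → Walk h → ℕ
displacement ((x , _) ∷ vs) = max x (map proj₁ vs) ∸ min x (map proj₁ vs)

unvisitedCount : ∀ {h} → Walk h → ℕ
unvisitedCount {h} (v ∷ vs) = length (filter (λ w → ¬? (w ∈? v ∷ vs)) (neighbours v))
  where open DecMembership (_≟ᵛ_ {h}) using (_∈?_)

-- The value at zero is never used on a self-avoiding walk: whenever a step is
-- taken, the endpoint has at least one unvisited neighbour.
1/ₙ_ : ℕ → ℚ
1/ₙ zero  = 0ℚ
1/ₙ suc n = + 1 ℚ./ suc n

-- The argument lists, most recent first, the vertices from which a step was
-- taken; v ∷ vs is the walk just before the step from v.
stepProbabilities : ∀ {h} → List (Vertex h) → ℚ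
stepProbabilities []       = 1ℚ
stepProbabilities (v ∷ vs) = 1/ₙ (unvisitedCount (v ∷ vs)) ℚ.* stepProbabilities vs

uniformProbability : ∀ {h} → Walk h → ℚ
uniformProbability (_ ∷ vs) = stepProbabilities vs

sumℚ : List ℚ → ℚ
sumℚ = foldr ℚ._+_ 0ℚ

-- HasSum P f s: the unordered sum of f over all elements of A satisfying P
-- converges to s, i.e. the net of sums over finite subsets (duplicate-free
-- lists, ordered by inclusion) converges to s.
HasSum : {A : Set} (P : A → Set) (f : A → ℚ) (s : ℚ) → Set
HasSum {A} P f s =
  ∀ ε → 0ℚ ℚ.< ε →
  ∃[ F₀ ] (Unique F₀ × All P F₀ ×
           (∀ (F : List A) → Unique F → All P F → F₀ ⊆ F →
            ℚ.∣ sumℚ (map f F) ℚ.- s ∣ ℚ.< ε))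

topLeft : ∀ h → .{{NonZero h}} → Vertex h
topLeft (suc k) = 0 , fromℕ k

-- Δ h ≔ q says that the series defining Δ_h converges and that its value is q.
Δ_≔_ : ∀ h → .{{NonZero h}} → ℚ → Set
Δ h ≔ q = HasSum (GSAW (topLeft h))
                 (λ W → uniformProbability W ℚ.* (+ displacement W ℚ./ 1))
                 q

{-# OPTIONS --safe #-}

-- Cut the strip between the columns c and c + 1. The part right of the cut sees the
-- walk as an alternating sequence of exits and re-entries, together with the occupancy
-- of the sites next to the cut. Step weights only depend on neighbouring columns, so
-- moving the cut by one column acts linearly on the probabilities of such prescribed
-- sequences ("tests"), and the probability R n of ever reaching column n + 1 is a
-- coordinate sum of Tⁿ w for a matrix T on the finitely many tests that occur.
-- Contracting all columns of a given walk yields its own probability of reaching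
-- column n + 1, which is harmonic along the walk. Hence every partial sum of the
-- expected displacement is at most ∑ R n, and a long enough one is at least
-- ∑ (n < D) R n − D R D. The sum ∑ R n is read off the exact solution z of z = w + T z,
-- and a vector u ≥ z with T u ≤ (19/20)² u gives n² Tⁿ z = O(u), whence D R D → 0.

module Submission where

open import Defs
open import Data.Integer.Base using (+_)
open import Data.Nat.Base using (_^_)
open import Data.Product.Base using (_×_; ∃-syntax)
open import Data.Rational.Base using (_/_; _*_; round)
open import Relation.Binary.PropositionalEquality using (_≡_)

open import Data.Bool.Base using (Bool; true; false; not; _∧_; if_then_else_; T)
open import Data.Bool.ListAction using (all)
import Data.Bool.Properties as Bool
open import Data.Fin.Base using (Fin; zero; suc; toℕ; fromℕ)
open import Data.Empty using (⊥-elim)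
import Data.Fin.Properties as Fin
open import Data.Integer.Base as ℤ using (-[1+_])
import Data.Integer.Properties as ℤ
open import Data.List.Base using (List; []; _∷_; _++_; map; concatMap; filter; allFin; length; [_]; upTo; cartesianProduct; reverse)
open import Data.List.Extrema.Nat using (max; min; max≤v⁺; v≤max⁺; min≤⊤; min≤xs; xs≤max)
import Data.List.Membership.DecPropositional as DecMembership
open import Data.List.Membership.Propositional using (_∈_; _∉_; find; lose)
open import Data.List.Membership.Propositional.Properties using
  (∈-filter⁺; ∈-filter⁻; ∈-allFin; ∈-++⁻; ∈-++⁺ˡ; ∈-++⁺ʳ; ∈-map⁺; ∈-map⁻; ∈-∃++; ∈-concatMap⁺; ∈-concatMap⁻; ∈-cartesianProduct⁺; ∈-upTo⁺)
open import Data.List.Membership.Propositional.Properties.WithK using (unique∧set⇒bag)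
open import Data.List.NonEmpty.Base using (_∷_; toList)
import Data.List.Properties as List
open import Data.List.Relation.Binary.BagAndSetEquality using (∼bag⇒↭)
open import Data.List.Relation.Binary.Disjoint.Propositional using (Disjoint)
open import Data.List.Relation.Binary.Permutation.Propositional as ↭ using (_↭_)
open import Data.List.Relation.Binary.Permutation.Propositional.Properties using (↭-length; shift)
open import Data.List.Relation.Binary.Subset.Propositional using (_⊆_)
open import Data.List.Relation.Unary.All as All using (All; []; _∷_)
import Data.List.Relation.Unary.All.Properties as All
open import Data.List.Relation.Unary.AllPairs as AllPairs using ([]; _∷_)
import Data.List.Relation.Unary.AllPairs.Properties as AllPairs
open import Data.List.Relation.Unary.Any using (here; there)
open import Data.List.Relation.Unary.Unique.Propositional using (Unique)
import Data.List.Relation.Unary.Unique.Propositional.Properties as Unique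
open import Data.Maybe.Base using (Maybe; just; nothing; maybe′; is-nothing)
open import Data.Nat.Base as ℕ using (ℕ; zero; suc; _∸_; _⊔_; ∣_-_∣)
import Data.Nat.DivMod as ℕ
open import Data.Nat.ListAction using (sum)
import Data.Nat.Properties as ℕ
open import Data.Product.Base using (_,_; proj₁; proj₂; map₂)
open import Data.Product.Properties using (≡-dec)
open import Data.Rational.Base as ℚ using
  (ℚ; mkℚ; 0ℚ; 1ℚ; ½; _+_; _-_; -_; _≤_; _<_; _≤ᵇ_; 1/_; ↥_; ↧ₙ_; toℚᵘ; fromℚᵘ; floor)
import Data.Rational.Properties as ℚ
open import Data.Rational.Solver using (module +-*-Solver)
import Data.Rational.Unnormalised.Base as ℚᵘ
import Data.Rational.Unnormalised.Properties as ℚᵘ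
open import Data.Sum.Base using (_⊎_; inj₁; inj₂)
open import Data.Vec.Base using (Vec; []; _∷_; lookup; replicate; tabulate; _[_]≔_; _[_]%=_)
import Data.Vec.Properties as Vec
open import Function.Base using (_∘_)
open import Function.Bundles using (mk⇔)
open import Relation.Binary.Definitions using (DecidableEquality)
open import Relation.Binary.PropositionalEquality hiding ([_])
open import Relation.Nullary.Decidable using (Dec; does; yes; no; ¬?; dec-true; dec-false; map′; _×-dec_)
open import Relation.Nullary.Negation using (¬_; contradiction)

open +-*-Solver using (solve; _:=_; _:+_; _:*_; _:-_; :-_; con)

-- The obstacle is that a walk may return to earlier columns, where its step weights depend on what
-- it left there, so the columns do not form a Markov chain. Pushing distributions forward would
-- mean splitting each walk into its traces on the columns and reassembling the weights. Tests avoid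
-- this: they are pulled back from the target column, any occupancy can be inserted, and the
-- contraction is tied to walks only by the one-step averaging identity `V-harmonic`. All
-- comparisons with sums over GSAWs are then inductions along the extensions of a walk. Only
-- finitely many tests occur because a walk crosses each of the h edges of a cut at most once. A
-- nonnegative solution of z = w + T z by itself only bounds the sum of the Tⁿ w from above; the
-- vector u excludes a leftover limit of Tⁿ z. The rate is a square so that it can be compared with
-- ((n + 19) / (n + 20))², which gives quadratic decay by a plain induction. One factor n is then
-- spent on D R D.

private variable
  A B : Set

-- Natural numbers and their reciprocals as rationals

fromℚᵘ-mono-≤ : ∀ {p q} → p ℚᵘ.≤ q → fromℚᵘ p ≤ fromℚᵘ q
fromℚᵘ-mono-≤ {p} {q} p≤q = ℚ.toℚᵘ-cancel-≤
  (ℚᵘ.≤-respˡ-≃ (ℚᵘ.≃-sym (ℚ.toℚᵘ-fromℚᵘ p)) (ℚᵘ.≤-respʳ-≃ (ℚᵘ.≃-sym (ℚ.toℚᵘ-fromℚᵘ q)) p≤q))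

-- Opaque, so that no fraction of large literals is ever normalised by a gcd computation.
opaque
  ι : ℕ → ℚ
  ι n = + n ℚ./ 1

  ιᵘ : ℕ → ℚᵘ.ℚᵘ
  ιᵘ n = ℚᵘ.mkℚᵘ (+ n) 0

  ι≡ : ∀ n → ι n ≡ + n ℚ./ 1
  ι≡ n = refl

  ι-0 : ι 0 ≡ 0ℚ
  ι-0 = refl

  ι-1 : ι 1 ≡ 1ℚ
  ι-1 = refl

  ι-+ : ∀ m n → ι (m ℕ.+ n) ≡ ι m + ι n
  ι-+ m n = ℚ.toℚᵘ-injective (begin
    toℚᵘ (ι (m ℕ.+ n))          ≈⟨ ℚ.toℚᵘ-fromℚᵘ (ιᵘ (m ℕ.+ n)) ⟩
    ιᵘ (m ℕ.+ n)                ≈⟨ ℚᵘ.*≡* (cong (ℤ._* + 1) (sym (cong₂ ℤ._+_ (ℤ.*-identityʳ (+ m)) (ℤ.*-identityʳ (+ n))))) ⟩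
    ιᵘ m ℚᵘ.+ ιᵘ n              ≈⟨ ℚᵘ.+-cong (ℚ.toℚᵘ-fromℚᵘ (ιᵘ m)) (ℚ.toℚᵘ-fromℚᵘ (ιᵘ n)) ⟨
    toℚᵘ (ι m) ℚᵘ.+ toℚᵘ (ι n)  ≈⟨ ℚ.toℚᵘ-homo-+ (ι m) (ι n) ⟨
    toℚᵘ (ι m + ι n)            ∎)
    where open import Relation.Binary.Reasoning.Setoid ℚᵘ.≃-setoid

  ι-* : ∀ m n → ι (m ℕ.* n) ≡ ι m * ι n
  ι-* m n = ℚ.toℚᵘ-injective (begin
    toℚᵘ (ι (m ℕ.* n))          ≈⟨ ℚ.toℚᵘ-fromℚᵘ (ιᵘ (m ℕ.* n)) ⟩
    ιᵘ (m ℕ.* n)                ≈⟨ ℚᵘ.*≡* (cong (ℤ._* + 1) (ℤ.pos-* m n)) ⟩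
    ιᵘ m ℚᵘ.* ιᵘ n              ≈⟨ ℚᵘ.*-cong (ℚ.toℚᵘ-fromℚᵘ (ιᵘ m)) (ℚ.toℚᵘ-fromℚᵘ (ιᵘ n)) ⟨
    toℚᵘ (ι m) ℚᵘ.* toℚᵘ (ι n)  ≈⟨ ℚ.toℚᵘ-homo-* (ι m) (ι n) ⟨
    toℚᵘ (ι m * ι n)            ∎)
    where open import Relation.Binary.Reasoning.Setoid ℚᵘ.≃-setoid

  ι-mono-≤ : ∀ {m n} → m ℕ.≤ n → ι m ≤ ι n
  ι-mono-≤ {m} {n} m≤n = fromℚᵘ-mono-≤ {ιᵘ m} {ιᵘ n} (ℚᵘ.*≤* (ℤ.*-monoʳ-≤-nonNeg (+ 1) (ℤ.+≤+ m≤n)))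

  1/ₙ-inverse : ∀ n → ι (suc n) * 1/ₙ (suc n) ≡ 1ℚ
  1/ₙ-inverse n = ℚ.toℚᵘ-injective (begin
    toℚᵘ (ι (suc n) * 1/ₙ (suc n))                    ≈⟨ ℚ.toℚᵘ-homo-* (ι (suc n)) (1/ₙ (suc n)) ⟩
    toℚᵘ (ι (suc n)) ℚᵘ.* toℚᵘ (1/ₙ (suc n))          ≈⟨ ℚᵘ.*-cong (ℚ.toℚᵘ-fromℚᵘ (ιᵘ (suc n))) (ℚ.toℚᵘ-fromℚᵘ (ℚᵘ.mkℚᵘ (+ 1) n)) ⟩
    ιᵘ (suc n) ℚᵘ.* ℚᵘ.mkℚᵘ (+ 1) n                   ≈⟨ ℚᵘ.*≡* (trans (trans (ℤ.*-identityʳ _) (ℤ.*-identityʳ _)) (sym (trans (ℤ.*-identityˡ _) (ℤ.*-identityˡ (+ suc n))))) ⟩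
    toℚᵘ 1ℚ                                           ∎)
    where open import Relation.Binary.Reasoning.Setoid ℚᵘ.≃-setoid

0≤ι : ∀ n → 0ℚ ≤ ι n
0≤ι n = ℚ.≤-trans (ℚ.≤-reflexive (sym ι-0)) (ι-mono-≤ {0} {n} ℕ.z≤n)

0≤1/ₙ : ∀ n → 0ℚ ≤ 1/ₙ n
0≤1/ₙ zero    = ℚ.≤-refl
0≤1/ₙ (suc n) = fromℚᵘ-mono-≤ {ℚᵘ.0ℚᵘ} {ℚᵘ.mkℚᵘ (+ 1) n} (ℚᵘ.*≤* (ℤ.≤-trans (ℤ.≤-reflexive (ℤ.*-zeroˡ (+ suc n))) (ℤ.+≤+ ℕ.z≤n)))

-- The value 0 at 0 is compatible with products, so weights multiply without side conditions on the
-- denominators.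
1/ₙ-* : ∀ m n → 1/ₙ (m ℕ.* n) ≡ 1/ₙ m * 1/ₙ n
1/ₙ-* zero    n    = sym (ℚ.*-zeroˡ (1/ₙ n))
1/ₙ-* (suc m) zero = trans (cong 1/ₙ_ (ℕ.*-zeroʳ m)) (sym (ℚ.*-zeroʳ (1/ₙ suc m)))
1/ₙ-* (suc m) (suc n) = begin
  u                      ≡⟨ ℚ.*-identityʳ u ⟨
  u * 1ℚ                 ≡⟨ cong (u *_) (sym (ℚ.*-identityʳ 1ℚ)) ⟩
  u * (1ℚ * 1ℚ)          ≡⟨ cong (u *_) (cong₂ _*_ (1/ₙ-inverse m) (1/ₙ-inverse n)) ⟨
  u * ((a * p) * (b * q)) ≡⟨ solve 5 (λ u a p b q → u :* ((a :* p) :* (b :* q)) := ((a :* b) :* u) :* (p :* q)) refl u a p b q ⟩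
  ((a * b) * u) * (p * q) ≡⟨ cong (λ x → (x * u) * (p * q)) (ι-* (suc m) (suc n)) ⟨
  (ι (suc m ℕ.* suc n) * u) * (p * q) ≡⟨ cong (_* (p * q)) (1/ₙ-inverse (n ℕ.+ m ℕ.* suc n)) ⟩
  1ℚ * (p * q)           ≡⟨ ℚ.*-identityˡ _ ⟩
  p * q                  ∎
  where
  open ≡-Reasoning
  a = ι (suc m)
  b = ι (suc n)
  p = 1/ₙ (suc m)
  q = 1/ₙ (suc n)
  u = 1/ₙ (suc m ℕ.* suc n)

+-congˡ : ∀ p {q r} → q ≡ r → p + q ≡ p + r
+-congˡ p = cong (λ q → p + q)

0≤-+ : ∀ {p q} → 0ℚ ≤ p → 0ℚ ≤ q → 0ℚ ≤ p + q
0≤-+ = ℚ.+-mono-≤ {0ℚ} {_} {0ℚ}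

*-monoˡ-0≤ : ∀ {r p q} → 0ℚ ≤ r → p ≤ q → r * p ≤ r * q
*-monoˡ-0≤ {r} 0≤r = ℚ.*-monoˡ-≤-nonNeg r {{ℚ.nonNegative 0≤r}}

0≤-* : ∀ {p q} → 0ℚ ≤ p → 0ℚ ≤ q → 0ℚ ≤ p * q
0≤-* {p} 0≤p 0≤q = ℚ.≤-trans (ℚ.≤-reflexive (sym (ℚ.*-zeroʳ p))) (*-monoˡ-0≤ 0≤p 0≤q)

-- Finite sums of rationals

∑ : (A → ℚ) → List A → ℚ
∑ f []       = 0ℚ
∑ f (x ∷ xs) = f x + ∑ f xs

∑-sumℚ : ∀ (f : A → ℚ) xs → sumℚ (map f xs) ≡ ∑ f xs
∑-sumℚ f []       = refl
∑-sumℚ f (x ∷ xs) = +-congˡ (f x) (∑-sumℚ f xs)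

∑-cong-∈ : ∀ {f g : A → ℚ} xs → (∀ {x} → x ∈ xs → f x ≡ g x) → ∑ f xs ≡ ∑ g xs
∑-cong-∈ []       eq = refl
∑-cong-∈ (x ∷ xs) eq = cong₂ _+_ (eq (here refl)) (∑-cong-∈ xs (eq ∘ there))

∑-cong : ∀ {f g : A → ℚ} → (∀ x → f x ≡ g x) → ∀ xs → ∑ f xs ≡ ∑ g xs
∑-cong eq xs = ∑-cong-∈ xs (λ {x} _ → eq x)

∑-mono-∈ : ∀ {f g : A → ℚ} xs → (∀ {x} → x ∈ xs → f x ≤ g x) → ∑ f xs ≤ ∑ g xs
∑-mono-∈ []       le = ℚ.≤-refl
∑-mono-∈ (x ∷ xs) le = ℚ.+-mono-≤ (le (here refl)) (∑-mono-∈ xs (le ∘ there))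

∑-0 : ∀ (xs : List A) → ∑ (λ _ → 0ℚ) xs ≡ 0ℚ
∑-0 []       = refl
∑-0 (x ∷ xs) = trans (ℚ.+-identityˡ _) (∑-0 xs)

0≤-∑ : ∀ {f : A → ℚ} → (∀ x → 0ℚ ≤ f x) → ∀ xs → 0ℚ ≤ ∑ f xs
0≤-∑ 0≤f []       = ℚ.≤-refl
0≤-∑ 0≤f (x ∷ xs) = 0≤-+ (0≤f x) (0≤-∑ 0≤f xs)

∑-++ : ∀ (f : A → ℚ) xs ys → ∑ f (xs ++ ys) ≡ ∑ f xs + ∑ f ys
∑-++ f []       ys = sym (ℚ.+-identityˡ _)
∑-++ f (x ∷ xs) ys = trans (+-congˡ (f x) (∑-++ f xs ys)) (sym (ℚ.+-assoc (f x) _ _))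

∑-map : ∀ (f : B → ℚ) (g : A → B) xs → ∑ f (map g xs) ≡ ∑ (f ∘ g) xs
∑-map f g []       = refl
∑-map f g (x ∷ xs) = +-congˡ (f (g x)) (∑-map f g xs)

∑-concatMap : ∀ (f : B → ℚ) (g : A → List B) xs → ∑ f (concatMap g xs) ≡ ∑ (λ x → ∑ f (g x)) xs
∑-concatMap f g []       = refl
∑-concatMap f g (x ∷ xs) = trans (∑-++ f (g x) (concatMap g xs)) (+-congˡ (∑ f (g x)) (∑-concatMap f g xs))

∑-+ : ∀ (f g : A → ℚ) xs → ∑ (λ x → f x + g x) xs ≡ ∑ f xs + ∑ g xs
∑-+ f g []       = refl
∑-+ f g (x ∷ xs) = trans (+-congˡ (f x + g x) (∑-+ f g xs))
  (solve 4 (λ a b c d → (a :+ b) :+ (c :+ d) := (a :+ c) :+ (b :+ d)) refl (f x) (g x) (∑ f xs) (∑ g xs))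

∑-*ˡ : ∀ c (f : A → ℚ) xs → ∑ (λ x → c * f x) xs ≡ c * ∑ f xs
∑-*ˡ c f []       = sym (ℚ.*-zeroʳ c)
∑-*ˡ c f (x ∷ xs) = trans (+-congˡ (c * f x) (∑-*ˡ c f xs)) (sym (ℚ.*-distribˡ-+ c (f x) (∑ f xs)))

∑-swap : ∀ (f : A → B → ℚ) xs ys → ∑ (λ x → ∑ (f x) ys) xs ≡ ∑ (λ y → ∑ (λ x → f x y) xs) ys
∑-swap f []       ys = sym (∑-0 ys)
∑-swap f (x ∷ xs) ys = trans (+-congˡ (∑ (f x) ys) (∑-swap f xs ys)) (sym (∑-+ (f x) _ ys))

∑-const : ∀ c (xs : List A) → ∑ (λ _ → c) xs ≡ ι (length xs) * c
∑-const c []       = sym (trans (cong (_* c) ι-0) (ℚ.*-zeroˡ c))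
∑-const c (x ∷ xs) = begin
  c + ∑ (λ _ → c) xs            ≡⟨ +-congˡ (c) (∑-const c xs) ⟩
  c + ι (length xs) * c         ≡⟨ solve 2 (λ c n → c :+ n :* c := (con 1ℚ :+ n) :* c) refl c (ι (length xs)) ⟩
  (1ℚ + ι (length xs)) * c      ≡⟨ cong (_* c) (trans (ι-+ 1 (length xs)) (cong (λ u → u + ι (length xs)) ι-1)) ⟨
  ι (suc (length xs)) * c       ∎
  where open ≡-Reasoning

∑-↭ : ∀ {A : Set} (f : A → ℚ) {xs ys} → xs ↭ ys → ∑ f xs ≡ ∑ f ys
∑-↭ f ↭.refl              = refl
∑-↭ f (↭.prep x p)        = +-congˡ (f x) (∑-↭ f p)
∑-↭ f (↭.swap {xs} {ys} x y p) = trans (+-congˡ (f x) (+-congˡ (f y) (∑-↭ f p)))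
  (solve 3 (λ a b c → a :+ (b :+ c) := b :+ (a :+ c)) refl (f x) (f y) (∑ f ys))
∑-↭ f (↭.trans p q)       = trans (∑-↭ f p) (∑-↭ f q)

unique-↭ : ∀ {A : Set} {xs ys : List A} → Unique xs → Unique ys → (∀ {x} → x ∈ xs → x ∈ ys) →
           (∀ {x} → x ∈ ys → x ∈ xs) → xs ↭ ys
unique-↭ xs! ys! to from = ∼bag⇒↭ (unique∧set⇒bag xs! ys! (mk⇔ to from))

∈-++-∷⁻ : ∀ {A : Set} {x z : A} as {bs} → z ≢ x → z ∈ as ++ x ∷ bs → z ∈ as ++ bs
∈-++-∷⁻ as z≢x z∈ with ∈-++⁻ as z∈
... | inj₁ z∈as         = ∈-++⁺ˡ z∈as
... | inj₂ (here z≡x)   = ⊥-elim (z≢x z≡x)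
... | inj₂ (there z∈bs) = ∈-++⁺ʳ as z∈bs

unique-⊆-↭ : ∀ {A : Set} {xs ys : List A} → Unique xs → xs ⊆ ys → ∃[ zs ] ys ↭ xs ++ zs
unique-⊆-↭ {xs = []}     {ys} _ _ = ys , ↭.↭-refl
unique-⊆-↭ {xs = x ∷ xs} (x∉xs ∷ xs!) xs⊆ys
  with as , bs , refl ← ∈-∃++ (xs⊆ys (here refl))
  with zs , p ← unique-⊆-↭ {ys = as ++ bs} xs! (λ z∈xs → ∈-++-∷⁻ as (λ z≡x → All.lookup x∉xs z∈xs (sym z≡x)) (xs⊆ys (there z∈xs)))
  = zs , ↭.↭-trans (shift x as bs) (↭.prep x p)

unique-⊆-length : ∀ {A : Set} {xs ys : List A} → Unique xs → xs ⊆ ys → length xs ℕ.≤ length ys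
unique-⊆-length {xs = xs} xs! xs⊆ys with zs , p ← unique-⊆-↭ xs! xs⊆ys =
  ℕ.≤-trans (ℕ.m≤m+n (length xs) (length zs)) (ℕ.≤-reflexive (sym (trans (↭-length p) (List.length-++ xs))))

∑-⊆ : ∀ {f : A → ℚ} → (∀ x → 0ℚ ≤ f x) → ∀ {xs ys} → Unique xs → xs ⊆ ys → ∑ f xs ≤ ∑ f ys
∑-⊆ {f = f} 0≤f {xs} {ys} xs! xs⊆ys with zs , p ← unique-⊆-↭ xs! xs⊆ys = begin
  ∑ f xs              ≡⟨ ℚ.+-identityʳ _ ⟨
  ∑ f xs + 0ℚ         ≤⟨ ℚ.+-monoʳ-≤ (∑ f xs) (0≤-∑ 0≤f zs) ⟩
  ∑ f xs + ∑ f zs     ≡⟨ ∑-++ f xs zs ⟨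
  ∑ f (xs ++ zs)      ≡⟨ ∑-↭ f p ⟨
  ∑ f ys              ∎
  where open ℚ.≤-Reasoning

-- Formal sums: an entry (d , a) stands for a weighted by 1 / d.

Formal : Set → Set
Formal A = List (ℕ × A)

E : (A → ℚ) → Formal A → ℚ
E f = ∑ (λ (d , a) → 1/ₙ d * f a)

E-cong : ∀ {f g : A → ℚ} → (∀ a → f a ≡ g a) → ∀ ts → E f ts ≡ E g ts
E-cong eq = ∑-cong (λ (d , a) → cong (1/ₙ d *_) (eq a))

E-0 : ∀ (ts : Formal A) → E (λ _ → 0ℚ) ts ≡ 0ℚ
E-0 ts = trans (∑-cong (λ (d , _) → ℚ.*-zeroʳ (1/ₙ d)) ts) (∑-0 ts)

0≤-E : ∀ {f : A → ℚ} → (∀ a → 0ℚ ≤ f a) → ∀ ts → 0ℚ ≤ E f ts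
0≤-E 0≤f = 0≤-∑ (λ (d , a) → 0≤-* (0≤1/ₙ d) (0≤f a))

E-+ : ∀ (f g : A → ℚ) ts → E (λ a → f a + g a) ts ≡ E f ts + E g ts
E-+ f g ts = trans (∑-cong (λ (d , a) → ℚ.*-distribˡ-+ (1/ₙ d) (f a) (g a)) ts) (∑-+ _ _ ts)

E-*ˡ : ∀ c (f : A → ℚ) ts → E (λ a → c * f a) ts ≡ c * E f ts
E-*ˡ c f ts = trans
  (∑-cong (λ (d , a) → solve 3 (λ d c x → d :* (c :* x) := c :* (d :* x)) refl (1/ₙ d) c (f a)) ts)
  (∑-*ˡ c _ ts)

E-∑ : ∀ (f : B → A → ℚ) xs ts → E (λ a → ∑ (λ x → f x a) xs) ts ≡ ∑ (λ x → E (f x) ts) xs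
E-∑ f xs ts = trans
  (∑-cong (λ (d , a) → sym (∑-*ˡ (1/ₙ d) (λ x → f x a) xs)) ts)
  (∑-swap (λ (d , a) x → 1/ₙ d * f x a) ts xs)

E-map : ∀ (f : B → ℚ) (g : A → B) ts → E f (map (map₂ g) ts) ≡ E (f ∘ g) ts
E-map f g ts = ∑-map _ (map₂ g) ts

scale : ℕ → (A → B) → Formal A → Formal B
scale n g = map (λ (d , a) → n ℕ.* d , g a)

E-scale : ∀ (f : B → ℚ) n (g : A → B) ts → E f (scale n g ts) ≡ 1/ₙ n * E (f ∘ g) ts
E-scale f n g ts = begin
  E f (scale n g ts)                                      ≡⟨ ∑-map _ _ ts ⟩
  ∑ (λ (d , a) → 1/ₙ (n ℕ.* d) * f (g a)) ts              ≡⟨ ∑-cong (λ (d , a) → trans (cong (_* f (g a)) (1/ₙ-* n d)) (ℚ.*-assoc (1/ₙ n) (1/ₙ d) (f (g a)))) ts ⟩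
  ∑ (λ (d , a) → 1/ₙ n * (1/ₙ d * f (g a))) ts            ≡⟨ ∑-*ˡ (1/ₙ n) _ ts ⟩
  1/ₙ n * E (f ∘ g) ts                                    ∎
  where open ≡-Reasoning

-- Composition of linear maps given on basis elements, with denominators multiplied. Equal terms are
-- not collected, since a formal sum matters only through its values under `E`.
_>>=ᶠ_ : Formal A → (A → Formal B) → Formal B
ts >>=ᶠ k = concatMap (λ (d , a) → scale d (λ b → b) (k a)) ts

E->>= : ∀ (f : B → ℚ) (k : A → Formal B) ts → E f (ts >>=ᶠ k) ≡ E (λ a → E f (k a)) ts
E->>= f k ts = trans (∑-concatMap _ _ ts) (∑-cong (λ (d , a) → E-scale f d (λ b → b) (k a)) ts)

-- Tests at a cut and their transport across one column

Column : ℕ → Set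
Column h = Vec Bool h

-- What a test demands of one site of the column to the left of the cut.
data Condition : Set where
  any visited unvisited never : Condition

holds : Condition → Bool → Bool
holds any       _ = true
holds visited   b = b
holds unvisited b = not b
holds never     _ = false

meet : Bool → Condition → Condition
meet true  any       = visited
meet true  visited   = visited
meet false any       = unvisited
meet false unvisited = unvisited
meet _     _         = never

matches : ∀ {n} → Vec Condition n → Column n → Bool
matches []       []      = true
matches (q ∷ qs) (b ∷ C) = holds q b ∧ matches qs C

-- The continuation of a test after the walk has left the left part L of the strip:
-- done qs: the column next to the cut satisfies qs, and nothing more is asked;
-- enter qs s m r P: it satisfies qs, its row s is unvisited, the walk re-enters L there
-- while the rows m of the column right of the cut are visited, and it next leaves L at
-- row r, after which P is asked.
data Script (h : ℕ) : Set where
  done  : Vec Condition h → Script h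
  enter : Vec Condition h → Fin h → Column h → Fin h → Script h → Script h

-- The walk first leaves L at the given row.
Test : ℕ → Set
Test h = Fin h × Script h

[_]ᵇ : Bool → ℕ
[ b ]ᵇ = if b then 1 else 0

size : ∀ {n} → Column n → ℕ
size []      = 0
size (b ∷ C) = [ not b ]ᵇ ℕ.+ size C

touching : ∀ {n} → Fin n → Fin n → Bool
touching zero          (suc zero)    = true
touching (suc zero)    zero          = true
touching (suc y)       (suc z)       = touching y z
touching _             _             = false

both : List Bool
both = true ∷ false ∷ []

module _ {h : ℕ} where

  ∅ full : Column h
  ∅    = replicate h false
  full = replicate h true

  anything : Vec Condition h
  anything = replicate h any

  -- All conditions in the outermost constructor refer to the left column at the moment when the
  -- script begins. That column is frozen until the next re-entry, so the demand belongs there and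
  -- not deeper in the script.
  require : Fin h → Bool → Script h → Script h
  require y b (done qs)          = done (qs [ y ]%= meet b)
  require y b (enter qs s m r P) = enter (qs [ y ]%= meet b) s m r P

  free : Column h → List (Fin h)
  free C = filter (λ z → lookup C z Bool.≟ false) (allFin h)

  exits : Column h → Fin h → List (Fin h)
  exits C y = filter (λ z → touching y z Bool.≟ true) (free C)

  degree : Bool → Column h → Fin h → Column h → ℕ
  degree b C y m = length (exits C y) ℕ.+ ([ not b ]ᵇ ℕ.+ [ not (lookup m y) ]ᵇ)

  -- The weight of the step depends on the site to the left of row y, which lies in a column not yet
  -- contracted. Its state is guessed, the term is weighted according to the guess, and `require`
  -- lets a wrong guess contribute 0 when that column is contracted.
  outcomes : List Bool → Column h → Fin h → Column h → (Bool → Formal (Script h)) → Formal (Script h)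
  outcomes bs C y m ts = concatMap (λ b → scale (degree b C y m) (require y b) (ts b)) bs

  -- A step to the left exists only under the guess that the left site is free; the other
  -- continuations are common to both guesses.
  unless : Formal (Script h) → Formal (Script h) → Bool → Formal (Script h)
  unless ts us true  = us
  unless ts us false = ts ++ us

  -- The scripts for the part left of column C that realise a given demand on the part
  -- including C, when the walk stands at row y of C, has to leave to the right at row r and
  -- then follow P. Here m is the column to the right, the natural number bounds the
  -- number of free sites of C, and the Booleans are the possible states of the site to
  -- the left of row y: only true if the walk has just come from there.
  walk     : ℕ → List Bool → Column h → Fin h → Column h → Fin h → Script h → Formal (Script h)
  branches : ℕ → Column h → Fin h → Column h → Fin h → Script h → Bool → Formal (Script h)
  resume   : ℕ → List Bool → Column h → Fin h → Column h → Fin h → Script h → Formal (Script h)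
  vertical : ℕ → Column h → Fin h → Column h → Fin h → Script h → Formal (Script h)
  left     : ℕ → Column h → Fin h → Column h → Fin h → Script h → Formal (Script h)
  right    : ℕ → Column h → Bool → Script h → Formal (Script h)
  follow   : ℕ → Column h → Script h → Formal (Script h)

  walk f bs C y m r P = outcomes bs C y m (branches f C y m r P)

  branches f C y m r P = unless (left f C y m r P)
    (vertical f C y m r P ++ right f C (not (lookup m y) ∧ does (y Fin.≟ r)) P)

  -- In every use the fuel equals the number of free sites of `C` and z is one of them, so it cannot
  -- run out: each visit lowers both by one.
  resume zero    bs C z m r P = []
  resume (suc f) bs C z m r P = walk f bs (C [ z ]≔ true) z m r P

  vertical f C y m r P = concatMap (λ z → resume f both C z m r P) (exits C y)

  -- An excursion to the left is recorded only by its first row y and the row z at which it comes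
  -- back. Meanwhile `C` does not change, so it can serve in `enter` as the occupancy seen from the
  -- left. At z the left neighbour has just been visited.
  left f C y m r P = concatMap (λ z → map (map₂ (enter anything y C z)) (resume f (true ∷ []) C z m r P)) (free C)

  right f C false P = []
  right f C true  P = follow f C P

  follow f C (done qs)          = if matches qs C then (1 , done anything) ∷ [] else []
  follow f C (enter qs s m r P) =
    if matches qs C ∧ not (lookup C s) then resume f both C s m r P else []

  -- The transfer across `C`: passing the test on the columns up to `C` requires a first entrance
  -- into `C` at some free row z, which is where the walk first leaves the columns before it. The
  -- entrance comes from the left, so only the guess `true` is kept for the left neighbour of z.
  compile : Column h → Column h → Test h → Formal (Test h)
  compile C m (r , P) = concatMap (λ z → map (map₂ (z ,_)) (resume (size C) (true ∷ []) C z m r P)) (free C)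

  initial : Formal (Test h)
  initial = map (λ r → 1 , r , done anything) (allFin h)

  -- Left of column 0 there are no sites, which is the same as having only visited ones.
  base : Script h → ℕ
  base (done qs)         = [ matches qs full ]ᵇ
  base (enter _ _ _ _ _) = 0

  -- The probability that the columns below c, occupied as in occ, behave as the script demands.
  val : (ℕ → Column h) → ℕ → Script h → ℚ
  val occ zero    P = ι (base P)
  val occ (suc c) P = E (val occ c) (follow (size (occ c)) (occ c) P)

  -- The tests on the columns up to c that amount to reaching column c + j + 1.
  tests : (ℕ → Column h) → ℕ → ℕ → Formal (Test h)
  tests occ c zero    = initial
  tests occ c (suc j) = tests occ (suc c) j >>=ᶠ compile (occ (suc c)) (occ (suc (suc c)))

  answer : (ℕ → Column h) → ℕ → Fin h → Test h → ℚ
  answer occ c y (r , P) = E (val occ c) (walk (size (occ c)) both (occ c) y (occ (suc c)) r P)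

  -- The probability of reaching column c + j + 1 from row y of column c.
  V : (ℕ → Column h) → ℕ → ℕ → Fin h → ℚ
  V occ c j y = E (answer occ c y) (tests occ c j)

  leftColumn : (ℕ → Column h) → ℕ → Column h
  leftColumn occ zero    = full
  leftColumn occ (suc c) = occ c

  0≤-val : ∀ occ c P → 0ℚ ≤ val occ c P
  0≤-val occ zero    P = 0≤ι (base P)
  0≤-val occ (suc c) P = 0≤-E (0≤-val occ c) (follow (size (occ c)) (occ c) P)

  0≤-V : ∀ occ c j y → 0ℚ ≤ V occ c j y
  0≤-V occ c j y = 0≤-E (λ (r , P) → 0≤-E (0≤-val occ c) (walk (size (occ c)) both (occ c) y (occ (suc c)) r P)) (tests occ c j)

  -- Contraction from the left up to column c reads only the columns below c, and `tests occ c j`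
  -- only those above c. A visit in column c thus changes neither, which is what lets the values
  -- before and after a step be compared.
  val-cong : ∀ {occ occ′} c → (∀ {x} → x ℕ.< c → occ x ≡ occ′ x) → ∀ P → val occ c P ≡ val occ′ c P
  val-cong zero    eq P = refl
  val-cong {occ} {occ′} (suc c) eq P rewrite eq {c} ℕ.≤-refl =
    E-cong (val-cong c (eq ∘ ℕ.m≤n⇒m≤1+n)) (follow (size (occ′ c)) (occ′ c) P)

  tests-cong : ∀ {occ occ′} c j → (∀ {x} → c ℕ.< x → occ x ≡ occ′ x) → tests occ c j ≡ tests occ′ c j
  tests-cong c zero    eq = refl
  tests-cong c (suc j) eq
    rewrite eq {suc c} ℕ.≤-refl | eq {suc (suc c)} (ℕ.m<n⇒m<1+n (ℕ.n<1+n c))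
    = cong (_>>=ᶠ _) (tests-cong (suc c) j (λ c<x → eq (ℕ.<-trans (ℕ.n<1+n c) c<x)))

-- Values of scripts, and harmonicity of the contraction

agrees : Bool → Bool → Bool
agrees true  x = x
agrees false x = not x

holds-meet : ∀ b q x → holds (meet b q) x ≡ agrees b x ∧ holds q x
holds-meet true  any       true  = refl
holds-meet true  any       false = refl
holds-meet true  visited   true  = refl
holds-meet true  visited   false = refl
holds-meet true  unvisited true  = refl
holds-meet true  unvisited false = refl
holds-meet true  never     true  = refl
holds-meet true  never     false = refl
holds-meet false any       true  = refl
holds-meet false any       false = refl
holds-meet false visited   true  = refl
holds-meet false visited   false = refl
holds-meet false unvisited true  = refl
holds-meet false unvisited false = refl
holds-meet false never     true  = refl
holds-meet false never     false = refl


matches-meet : ∀ {n} b (qs : Vec Condition n) C y →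
               matches (qs [ y ]%= meet b) C ≡ agrees b (lookup C y) ∧ matches qs C
matches-meet b (q ∷ qs) (x ∷ C) zero    = trans (cong (_∧ matches qs C) (holds-meet b q x)) (Bool.∧-assoc (agrees b x) _ _)
matches-meet b (q ∷ qs) (x ∷ C) (suc y) = begin
  holds q x ∧ matches (qs [ y ]%= meet b) C             ≡⟨ cong (holds q x ∧_) (matches-meet b qs C y) ⟩
  holds q x ∧ (agrees b (lookup C y) ∧ matches qs C)    ≡⟨ Bool.∧-assoc (holds q x) _ _ ⟨
  (holds q x ∧ agrees b (lookup C y)) ∧ matches qs C    ≡⟨ cong (_∧ matches qs C) (Bool.∧-comm (holds q x) _) ⟩
  (agrees b (lookup C y) ∧ holds q x) ∧ matches qs C    ≡⟨ Bool.∧-assoc (agrees b (lookup C y)) _ _ ⟩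
  agrees b (lookup C y) ∧ (holds q x ∧ matches qs C)    ∎
  where open ≡-Reasoning

E-[] : ∀ {A : Set} (f : A → ℚ) a → E f ((1 , a) ∷ []) ≡ f a
E-[] f a = trans (ℚ.+-identityʳ _) (ℚ.*-identityˡ (f a))

lookup-full : ∀ {n} (y : Fin n) → lookup (replicate n true) y ≡ true
lookup-full y = Vec.lookup-replicate y true

matches-anything : ∀ {n} (C : Column n) → matches (replicate n any) C ≡ true
matches-anything []      = refl
matches-anything (b ∷ C) = matches-anything C

-- Matches the fuel of `resume` before a visit exactly with the fuel of `walk` after it, so that no
-- monotonicity in the fuel is involved.
size-visit : ∀ {n} (C : Column n) z → lookup C z ≡ false → size C ≡ suc (size (C [ z ]≔ true))
size-visit (false ∷ C) zero    refl = refl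
size-visit (b ∷ C)     (suc z) eq   = trans (cong ([ not b ]ᵇ ℕ.+_) (size-visit C z eq)) (ℕ.+-suc [ not b ]ᵇ _)

∑-indicator : ∀ {n} (g : Fin n → ℚ) y {zs} → Unique zs → y ∈ zs →
              ∑ (λ z → if does (y Fin.≟ z) then g z else 0ℚ) zs ≡ g y
∑-indicator g y {z ∷ zs} (z∉zs ∷ zs!) y∈ with y Fin.≟ z | y∈
... | yes refl | _         = trans (+-congˡ (g y) (trans (∑-cong-∈ zs no-more) (∑-0 zs))) (ℚ.+-identityʳ (g y))
  where
  no-more : ∀ {z′} → z′ ∈ zs → (if does (y Fin.≟ z′) then g z′ else 0ℚ) ≡ 0ℚ
  no-more {z′} z′∈ with y Fin.≟ z′
  ... | yes refl = contradiction refl (All.lookup z∉zs z′∈)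
  ... | no _     = refl
... | no y≢z   | here y≡z  = contradiction y≡z y≢z
... | no _     | there y∈′ = trans (ℚ.+-identityˡ _) (∑-indicator g y zs! y∈′)

-- All that the contraction has to know about a step of the walk. Stating it for occupancies keeps
-- the linear algebra apart from lists of vertices.
record Visits {h} (occ occ′ : ℕ → Column h) (c : ℕ) (z : Fin h) : Set where
  field
    here-visited : occ′ c ≡ occ c [ z ]≔ true
    elsewhere    : ∀ {x} → x ≢ c → occ x ≡ occ′ x
open Visits

module _ {h : ℕ} where

  free⁻ : ∀ (C : Column h) {z} → z ∈ free C → lookup C z ≡ false
  free⁻ C z∈ = proj₂ (∈-filter⁻ (λ z → lookup C z Bool.≟ false) {xs = allFin h} z∈)

  free⁺ : ∀ (C : Column h) {z} → lookup C z ≡ false → z ∈ free C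
  free⁺ C {z} eq = ∈-filter⁺ (λ z → lookup C z Bool.≟ false) (∈-allFin z) eq

  free! : ∀ (C : Column h) → Unique (free C)
  free! C = Unique.filter⁺ (λ z → lookup C z Bool.≟ false) (Unique.allFin⁺ h)

  val-done : ∀ occ c → val occ c (done {h} anything) ≡ 1ℚ
  val-done occ zero    rewrite matches-anything (full {h}) = ι-1
  val-done occ (suc c) rewrite matches-anything (occ c) = trans (E-[] (val occ c) _) (val-done occ c)

  -- A demand on a site acts as an indicator because `follow` tests the conditions before anything
  -- else. At c = 0 the same holds with the fictitious column `full`, and for `enter` both sides are
  -- 0.
  val-require : ∀ occ c y b (P : Script h) →
                val occ c (require y b P) ≡ (if agrees b (lookup (leftColumn occ c) y) then val occ c P else 0ℚ)
  val-require occ zero y b (done qs)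
    rewrite matches-meet b qs full y with agrees b (lookup (full {h}) y)
  ... | true  = refl
  ... | false = ι-0
  val-require occ zero y b (enter _ _ _ _ _) with agrees b (lookup (full {h}) y)
  ... | true  = refl
  ... | false = ι-0
  val-require occ (suc c) y b (done qs)
    rewrite matches-meet b qs (occ c) y with agrees b (lookup (occ c) y)
  ... | true  = refl
  ... | false = refl
  val-require occ (suc c) y b (enter qs s m r P)
    rewrite matches-meet b qs (occ c) y with agrees b (lookup (occ c) y)
  ... | true  = refl
  ... | false = refl

  E-require : ∀ occ c y b n (ts : Formal (Script h)) →
              E (val occ c) (scale n (require y b) ts) ≡
              (if agrees b (lookup (leftColumn occ c) y) then 1/ₙ n * E (val occ c) ts else 0ℚ)
  E-require occ c y b n ts = begin
    E (val occ c) (scale n (require y b) ts)                   ≡⟨ E-scale (val occ c) n (require y b) ts ⟩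
    1/ₙ n * E (val occ c ∘ require y b) ts                     ≡⟨ cong (1/ₙ n *_) (E-cong (val-require occ c y b) ts) ⟩
    1/ₙ n * E (λ P → if agr then val occ c P else 0ℚ) ts       ≡⟨ pull agr ⟩
    (if agr then 1/ₙ n * E (val occ c) ts else 0ℚ)             ∎
    where
    open ≡-Reasoning
    agr = agrees b (lookup (leftColumn occ c) y)
    pull : ∀ a → 1/ₙ n * E (λ P → if a then val occ c P else 0ℚ) ts ≡
                 (if a then 1/ₙ n * E (val occ c) ts else 0ℚ)
    pull true  = refl
    pull false = trans (cong (1/ₙ n *_) (E-0 ts)) (ℚ.*-zeroʳ (1/ₙ n))

  -- Of the two guesses only the actual state of the left site survives, so the divisor turns into
  -- the true number of free neighbours.
  E-outcomes : ∀ occ c C y m (ts : Bool → Formal (Script h)) {b} → lookup (leftColumn occ c) y ≡ b →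
               E (val occ c) (outcomes both C y m ts) ≡ 1/ₙ (degree b C y m) * E (val occ c) (ts b)
  E-outcomes occ c C y m ts {b} eq = begin
    E (val occ c) (outcomes both C y m ts)
      ≡⟨ ∑-concatMap _ (λ b → scale (degree b C y m) (require y b) (ts b)) both ⟩
    E (val occ c) (branch true) + (E (val occ c) (branch false) + 0ℚ)
      ≡⟨ cong₂ (λ p q → p + (q + 0ℚ)) (E-require occ c y true (degree true C y m) (ts true)) (E-require occ c y false (degree false C y m) (ts false)) ⟩
    (if lookup (leftColumn occ c) y then goal true else 0ℚ) + ((if not (lookup (leftColumn occ c) y) then goal false else 0ℚ) + 0ℚ)
      ≡⟨ choose eq ⟩
    goal b ∎
    where
    open ≡-Reasoning
    branch = λ b → scale (degree b C y m) (require y b) (ts b)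
    goal   = λ b → 1/ₙ (degree b C y m) * E (val occ c) (ts b)
    choose : ∀ {x b} → x ≡ b → (if x then goal true else 0ℚ) + ((if not x then goal false else 0ℚ) + 0ℚ) ≡ goal b
    choose {true}  refl = trans (+-congˡ (goal true) (ℚ.+-identityˡ 0ℚ)) (ℚ.+-identityʳ _)
    choose {false} refl = trans (ℚ.+-identityˡ _) (ℚ.+-identityʳ _)

  -- Justifies the pruning to the single guess `true` after an entrance from the left: the other
  -- guess would have value 0.
  E-outcomes-visited : ∀ occ c C y m (ts : Bool → Formal (Script h)) → lookup (leftColumn occ c) y ≡ true →
                       E (val occ c) (outcomes (true ∷ []) C y m ts) ≡ E (val occ c) (outcomes both C y m ts)
  E-outcomes-visited occ c C y m ts eq = begin
    E (val occ c) (outcomes (true ∷ []) C y m ts)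
      ≡⟨ ∑-concatMap _ (λ b → scale (degree b C y m) (require y b) (ts b)) (true ∷ []) ⟩
    E (val occ c) (scale (degree true C y m) (require y true) (ts true)) + 0ℚ
      ≡⟨ ℚ.+-identityʳ _ ⟩
    E (val occ c) (scale (degree true C y m) (require y true) (ts true))
      ≡⟨ E-require occ c y true (degree true C y m) (ts true) ⟩
    (if lookup (leftColumn occ c) y then 1/ₙ (degree true C y m) * E (val occ c) (ts true) else 0ℚ)
      ≡⟨ cong (λ x → if x then 1/ₙ (degree true C y m) * E (val occ c) (ts true) else 0ℚ) eq ⟩
    1/ₙ (degree true C y m) * E (val occ c) (ts true)
      ≡⟨ E-outcomes occ c C y m ts {true} eq ⟨
    E (val occ c) (outcomes both C y m ts) ∎
    where open ≡-Reasoning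

  resume-answer : ∀ {occ occ′ c} {z : Fin h} → Visits occ occ′ c z → lookup (occ c) z ≡ false → ∀ r P →
                  E (val occ c) (resume (size (occ c)) both (occ c) z (occ (suc c)) r P) ≡ answer occ′ c z (r , P)
  resume-answer {occ} {occ′} {c} {z} vis fr r P
    rewrite size-visit (occ c) z fr | here-visited vis | elsewhere vis {suc c} (ℕ.<⇒≢ (ℕ.n<1+n c) ∘ sym)
    = E-cong (val-cong c (elsewhere vis ∘ ℕ.<⇒≢)) (walk (size (occ c [ z ]≔ true)) both (occ c [ z ]≔ true) z (occ′ (suc c)) r P)

module _ {h : ℕ} (occ : ℕ → Column h) (next : ℕ → Fin h → ℕ → Column h)
         (visits : ∀ c z → Visits occ (next c z) c z) where

  open ≡-Reasoning

  -- The target column c + j + 1 stays fixed: a step to the left raises j, a step to the right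
  -- lowers it, and with j = 0 the step to the right arrives.
  V-left : ℕ → ℕ → Fin h → ℚ
  V-left zero    j y = 0ℚ
  V-left (suc c) j y = if lookup (occ c) y then 0ℚ else V (next c y) c (suc j) y

  V-right : ℕ → ℕ → Fin h → ℚ
  V-right c zero    y = 1ℚ
  V-right c (suc j) y = V (next (suc c) y) (suc c) j y

  V-vertical : ℕ → ℕ → Fin h → ℚ
  V-vertical c j y = ∑ (λ z → V (next c z) c j z) (exits (occ c) y)

  vertical-step : ∀ c j y →
    E (λ (r , P) → E (val occ c) (vertical (size (occ c)) (occ c) y (occ (suc c)) r P)) (tests occ c j) ≡ V-vertical c j y
  vertical-step c j y = begin
    E (λ (r , P) → E (val occ c) (vertical (size (occ c)) (occ c) y (occ (suc c)) r P)) (tests occ c j)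
      ≡⟨ E-cong (λ (r , P) → ∑-concatMap _ (λ z → resume (size (occ c)) both (occ c) z (occ (suc c)) r P) (exits (occ c) y)) (tests occ c j) ⟩
    E (λ (r , P) → ∑ (λ z → E (val occ c) (resume (size (occ c)) both (occ c) z (occ (suc c)) r P)) (exits (occ c) y)) (tests occ c j)
      ≡⟨ E-cong (λ (r , P) → ∑-cong-∈ (exits (occ c) y) (λ {z} z∈ → resume-answer (visits c z) (exit-free z∈) r P)) (tests occ c j) ⟩
    E (λ t → ∑ (λ z → answer (next c z) c z t) (exits (occ c) y)) (tests occ c j)
      ≡⟨ E-∑ (λ z → answer (next c z) c z) (exits (occ c) y) (tests occ c j) ⟩
    ∑ (λ z → E (answer (next c z) c z) (tests occ c j)) (exits (occ c) y)
      ≡⟨ ∑-cong (λ z → cong (E (answer (next c z) c z)) (tests-cong c j (λ c<x → elsewhere (visits c z) (ℕ.<⇒≢ c<x ∘ sym)))) (exits (occ c) y) ⟩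
    V-vertical c j y ∎
    where
    open Visits
    exit-free : ∀ {z} → z ∈ exits (occ c) y → lookup (occ c) z ≡ false
    exit-free z∈ = free⁻ (occ c) (proj₁ (∈-filter⁻ (λ z → touching y z Bool.≟ true) {xs = free (occ c)} z∈))

  -- `left` and `compile` run over the same pairs of a row z and a resumption at z. What remains is
  -- that `val` reads the script `enter anything y C z Q` as the answer of a walk standing at row y
  -- of column c to the test `(z , Q)`.
  V-left-free : ∀ c j y → lookup (occ c) y ≡ false →
    E (λ (r , P) → E (val occ (suc c)) (left (size (occ (suc c))) (occ (suc c)) y (occ (suc (suc c))) r P)) (tests occ (suc c) j)
    ≡ V (next c y) c (suc j) y
  V-left-free c j y fr = begin
    E (λ (r , P) → E (val occ (suc c)) (left f C y m r P)) ts
      ≡⟨ E-cong (λ (r , P) → trans (∑-concatMap _ (λ z → map (map₂ (enter anything y C z)) (resume f (true ∷ []) C z m r P)) (free C))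
                                   (∑-cong (λ z → E-map (val occ (suc c)) (enter anything y C z) (resume f (true ∷ []) C z m r P)) (free C))) ts ⟩
    E (λ (r , P) → ∑ (λ z → E (λ Q → val occ (suc c) (enter anything y C z Q)) (resume f (true ∷ []) C z m r P)) (free C)) ts
      ≡⟨ E-cong (λ (r , P) → ∑-cong (λ z → E-cong (enter-answer z) (resume f (true ∷ []) C z m r P)) (free C)) ts ⟩
    E (λ (r , P) → ∑ (λ z → E (λ Q → answer (next c y) c y (z , Q)) (resume f (true ∷ []) C z m r P)) (free C)) ts
      ≡⟨ E-cong (λ (r , P) → trans (∑-concatMap _ (λ z → map (map₂ (z ,_)) (resume f (true ∷ []) C z m r P)) (free C))
                                   (∑-cong (λ z → E-map (answer (next c y) c y) (z ,_) (resume f (true ∷ []) C z m r P)) (free C))) ts ⟨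
    E (λ t → E (answer (next c y) c y) (compile C m t)) ts
      ≡⟨ E->>= (answer (next c y) c y) (compile C m) ts ⟨
    E (answer (next c y) c y) (tests occ c (suc j))
      ≡⟨ cong (E (answer (next c y) c y)) (tests-cong c (suc j) (λ c<x → Visits.elsewhere (visits c y) (ℕ.<⇒≢ c<x ∘ sym))) ⟩
    V (next c y) c (suc j) y ∎
    where
    C = occ (suc c)
    f = size C
    m = occ (suc (suc c))
    ts = tests occ (suc c) j
    enter-answer : ∀ z Q → val occ (suc c) (enter anything y C z Q) ≡ answer (next c y) c y (z , Q)
    enter-answer z Q rewrite matches-anything (occ c) | fr = resume-answer (visits c y) fr z Q

  indicator-follow : ∀ c (y : Fin h) b (r : Fin h) (P : Script h) →
    E (val occ c) (right (size (occ c)) (occ c) (not b ∧ does (y Fin.≟ r)) P) ≡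
    (if b then 0ℚ else (if does (y Fin.≟ r) then val occ (suc c) P else 0ℚ))
  indicator-follow c y true  r P = refl
  indicator-follow c y false r P with does (y Fin.≟ r)
  ... | true  = refl
  ... | false = refl

  -- Only tests whose exit row is y accept this step. Among the tests produced by `compile`, summing
  -- this indicator over the entrance rows singles out the resumption at row y of column c + 1; for
  -- j = 0 only `done anything` is left, of value 1.
  right-step : ∀ c j y → lookup (occ c) y ≡ true →
    E (λ (r , P) → E (val occ c) (right (size (occ c)) (occ c) (not (lookup (occ (suc c)) y) ∧ does (y Fin.≟ r)) P)) (tests occ c j)
    ≡ (if lookup (occ (suc c)) y then 0ℚ else V-right c j y)
  right-step c j y vis = trans (E-cong (λ (r , P) → indicator-follow c y (lookup (occ (suc c)) y) r P) (tests occ c j)) (by-mask (lookup (occ (suc c)) y) refl)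
    where
    arrival : Test h → ℚ
    arrival (r , P) = if does (y Fin.≟ r) then val occ (suc c) P else 0ℚ

    arrivals : ∀ j → lookup (occ (suc c)) y ≡ false → E arrival (tests occ c j) ≡ V-right c j y
    arrivals zero _ = begin
      E arrival initial
        ≡⟨ ∑-map _ (λ r → 1 , r , done anything) (allFin h) ⟩
      ∑ (λ r → 1ℚ * (if does (y Fin.≟ r) then val occ (suc c) (done anything) else 0ℚ)) (allFin h)
        ≡⟨ ∑-cong (λ r → ℚ.*-identityˡ _) (allFin h) ⟩
      ∑ (λ r → if does (y Fin.≟ r) then val occ (suc c) (done anything) else 0ℚ) (allFin h)
        ≡⟨ ∑-indicator (λ _ → val occ (suc c) (done anything)) y (Unique.allFin⁺ h) (∈-allFin y) ⟩
      val occ (suc c) (done anything)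
        ≡⟨ val-done occ (suc c) ⟩
      1ℚ ∎
    arrivals (suc j) fr = begin
      E arrival (tests occ (suc c) j >>=ᶠ compile D m)
        ≡⟨ E->>= arrival (compile D m) ts ⟩
      E (λ t → E arrival (compile D m t)) ts
        ≡⟨ E-cong (λ (r , P) → trans (∑-concatMap _ (λ z → map (map₂ (z ,_)) (resume f (true ∷ []) D z m r P)) (free D))
                                     (∑-cong (λ z → trans (E-map arrival (z ,_) (resume f (true ∷ []) D z m r P)) (split (does (y Fin.≟ z)) {val occ (suc c)} (resume f (true ∷ []) D z m r P))) (free D))) ts ⟩
      E (λ (r , P) → ∑ (λ z → if does (y Fin.≟ z) then E (val occ (suc c)) (resume f (true ∷ []) D z m r P) else 0ℚ) (free D)) ts
        ≡⟨ E-cong (λ (r , P) → ∑-indicator (λ z → E (val occ (suc c)) (resume f (true ∷ []) D z m r P)) y (free! D) (free⁺ D fr)) ts ⟩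
      E (λ (r , P) → E (val occ (suc c)) (resume f (true ∷ []) D y m r P)) ts
        ≡⟨ E-cong (λ (r , P) → trans (forget r P f) (resume-answer (visits (suc c) y) fr r P)) ts ⟩
      E (answer (next (suc c) y) (suc c) y) ts
        ≡⟨ cong (E (answer (next (suc c) y) (suc c) y)) (tests-cong (suc c) j (λ c<x → Visits.elsewhere (visits (suc c) y) (ℕ.<⇒≢ c<x ∘ sym))) ⟩
      V (next (suc c) y) (suc c) j y ∎
      where
      D = occ (suc c)
      f = size D
      m = occ (suc (suc c))
      ts = tests occ (suc c) j
      split : ∀ b {g : Script h → ℚ} (us : Formal (Script h)) → E (λ Q → if b then g Q else 0ℚ) us ≡ (if b then E g us else 0ℚ)
      split true  us = refl
      split false us = E-0 us
      forget : ∀ r P f → E (val occ (suc c)) (resume f (true ∷ []) D y m r P) ≡ E (val occ (suc c)) (resume f both D y m r P)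
      forget r P zero    = refl
      forget r P (suc f) = E-outcomes-visited occ (suc c) (D [ y ]≔ true) y m (branches f (D [ y ]≔ true) y m r P) vis

    by-mask : ∀ b → lookup (occ (suc c)) y ≡ b →
              E (λ (r , P) → if b then 0ℚ else (if does (y Fin.≟ r) then val occ (suc c) P else 0ℚ)) (tests occ c j)
              ≡ (if b then 0ℚ else V-right c j y)
    by-mask true  _  = E-0 (tests occ c j)
    by-mask false fr = arrivals j fr

  left-step : ∀ c j y {b} → lookup (leftColumn occ c) y ≡ b →
    E (λ (r , P) → if b then 0ℚ else E (val occ c) (left (size (occ c)) (occ c) y (occ (suc c)) r P)) (tests occ c j)
    ≡ V-left c j y
  left-step zero    j y {true}  eq = E-0 (tests occ zero j)
  left-step zero    j y {false} eq = contradiction (trans (sym eq) (lookup-full y)) λ ()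
  left-step (suc c) j y {true}  eq rewrite eq = E-0 (tests occ (suc c) j)
  left-step (suc c) j y {false} eq rewrite eq = V-left-free c j y eq

  -- One step of the walk is one unfolding of `walk`, and the summands of `branches` correspond to
  -- the possible directions. The divisor is the number of free neighbours, so this says that V is
  -- the average of its values after the next step.
  V-harmonic : ∀ c j y → lookup (occ c) y ≡ true →
    V occ c j y ≡ 1/ₙ (degree (lookup (leftColumn occ c) y) (occ c) y (occ (suc c))) *
      (V-left c j y + (V-vertical c j y + (if lookup (occ (suc c)) y then 0ℚ else V-right c j y)))
  V-harmonic c j y vis = begin
    E (answer occ c y) ts
      ≡⟨ E-cong (λ (r , P) → trans (E-outcomes occ c C y m (branches (size C) C y m r P) {b} refl) (cong (1/ₙ n *_) (split-unless b (L r P) (U r P) (R r P)))) ts ⟩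
    E (λ (r , P) → 1/ₙ n * (EL r P + (E (val occ c) (U r P) + E (val occ c) (R r P)))) ts
      ≡⟨ E-*ˡ (1/ₙ n) _ ts ⟩
    1/ₙ n * E (λ (r , P) → EL r P + (E (val occ c) (U r P) + E (val occ c) (R r P))) ts
      ≡⟨ cong (1/ₙ n *_) (trans (E-+ (λ (r , P) → EL r P) _ ts) (+-congˡ (E (λ (r , P) → EL r P) ts) (E-+ (λ (r , P) → E (val occ c) (U r P)) (λ (r , P) → E (val occ c) (R r P)) ts))) ⟩
    1/ₙ n * (E (λ (r , P) → EL r P) ts + (E (λ (r , P) → E (val occ c) (U r P)) ts + E (λ (r , P) → E (val occ c) (R r P)) ts))
      ≡⟨ cong (1/ₙ n *_) (cong₂ _+_ (left-step c j y refl) (cong₂ _+_ (vertical-step c j y) (right-step c j y vis))) ⟩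
    1/ₙ n * (V-left c j y + (V-vertical c j y + (if lookup m y then 0ℚ else V-right c j y))) ∎
    where
    C = occ c
    m = occ (suc c)
    ts = tests occ c j
    b = lookup (leftColumn occ c) y
    n = degree b C y m
    L U R : Fin h → Script h → Formal (Script h)
    L = left (size C) C y m
    U = vertical (size C) C y m
    R r = right (size C) C (not (lookup m y) ∧ does (y Fin.≟ r))
    EL : Fin h → Script h → ℚ
    EL r P = if b then 0ℚ else E (val occ c) (L r P)
    split-unless : ∀ b ts us vs → E (val occ c) (unless ts (us ++ vs) b) ≡
                   (if b then 0ℚ else E (val occ c) ts) + (E (val occ c) us + E (val occ c) vs)
    split-unless true  ts us vs = trans (∑-++ _ us vs) (sym (ℚ.+-identityˡ _))
    split-unless false ts us vs = trans (∑-++ _ ts (us ++ vs)) (+-congˡ (E (val occ c) ts) (∑-++ _ us vs))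

-- Occupancy and free neighbours of a given walk

lookup-ext : ∀ {A : Set} {n} {xs ys : Vec A n} → (∀ i → lookup xs i ≡ lookup ys i) → xs ≡ ys
lookup-ext {xs = xs} {ys} eq = trans (sym (Vec.tabulate∘lookup xs)) (trans (Vec.tabulate-cong eq) (Vec.tabulate∘lookup ys))

false≢true : ∀ {b} → b ≡ false → b ≢ true
false≢true refl ()

touching⇒dist : ∀ {n} (y z : Fin n) → touching y z ≡ true → ∣ toℕ y - toℕ z ∣ ≡ 1
touching⇒dist zero          (suc zero)    _  = refl
touching⇒dist (suc zero)    zero          _  = refl
touching⇒dist (suc y)       (suc z)       eq = touching⇒dist y z (touching-suc y z eq)
  where
  touching-suc : ∀ {n} (y z : Fin n) → touching (suc y) (suc z) ≡ true → touching y z ≡ true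
  touching-suc zero    z eq = eq
  touching-suc (suc y) z eq = eq
touching⇒dist zero          zero          ()
touching⇒dist zero          (suc (suc z)) ()
touching⇒dist (suc (suc y)) zero          ()

dist⇒touching : ∀ {n} (y z : Fin n) → ∣ toℕ y - toℕ z ∣ ≡ 1 → touching y z ≡ true
dist⇒touching zero          (suc zero)    _  = refl
dist⇒touching (suc zero)    zero          _  = refl
dist⇒touching (suc zero)    (suc z)       eq = dist⇒touching zero z eq
dist⇒touching (suc (suc y)) (suc z)       eq = dist⇒touching (suc y) z eq
dist⇒touching zero          zero          ()
dist⇒touching zero          (suc (suc z)) ()
dist⇒touching (suc (suc y)) zero          ()

squares≡1 : ∀ a b → a ℕ.^ 2 ℕ.+ b ℕ.^ 2 ≡ 1 → (a ≡ 0 × b ≡ 1) ⊎ (a ≡ 1 × b ≡ 0)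
squares≡1 zero          (suc zero)    _ = inj₁ (refl , refl)
squares≡1 (suc zero)    zero          _ = inj₂ (refl , refl)
squares≡1 zero          zero          ()
squares≡1 zero          (suc (suc b)) ()
squares≡1 (suc zero)    (suc b)       ()
squares≡1 (suc (suc a)) b             ()

∣-∣≡1 : ∀ m n → ∣ m - n ∣ ≡ 1 → (m ≡ suc n) ⊎ (n ≡ suc m)
∣-∣≡1 zero    n       eq = inj₂ eq
∣-∣≡1 (suc m) zero    eq = inj₁ eq
∣-∣≡1 (suc m) (suc n) eq with ∣-∣≡1 m n eq
... | inj₁ refl = inj₁ refl
... | inj₂ refl = inj₂ refl

∑< : ℕ → (ℕ → ℚ) → ℚ
∑< zero    g = 0ℚ
∑< (suc n) g = ∑< n g + g n

∑<-cong : ∀ n {f g} → (∀ i → f i ≡ g i) → ∑< n f ≡ ∑< n g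
∑<-cong zero    eq = refl
∑<-cong (suc n) eq = cong₂ _+_ (∑<-cong n eq) (eq n)

0≤-∑< : ∀ n {g} → (∀ i → 0ℚ ≤ g i) → 0ℚ ≤ ∑< n g
0≤-∑< zero    0≤g = ℚ.≤-refl
0≤-∑< (suc n) 0≤g = 0≤-+ (0≤-∑< n 0≤g) (0≤g n)

∑<-*-∑ : ∀ {A : Set} n c (g : ℕ → A → ℚ) xs →
         ∑< n (λ i → c * ∑ (g i) xs) ≡ c * ∑ (λ x → ∑< n (λ i → g i x)) xs
∑<-*-∑ zero    c g xs = sym (trans (cong (c *_) (∑-0 xs)) (ℚ.*-zeroʳ c))
∑<-*-∑ (suc n) c g xs = begin
  ∑< n (λ i → c * ∑ (g i) xs) + c * ∑ (g n) xs              ≡⟨ cong (λ p → p + c * ∑ (g n) xs) (∑<-*-∑ n c g xs) ⟩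
  c * ∑ (λ x → ∑< n (λ i → g i x)) xs + c * ∑ (g n) xs      ≡⟨ ℚ.*-distribˡ-+ c _ _ ⟨
  c * (∑ (λ x → ∑< n (λ i → g i x)) xs + ∑ (g n) xs)        ≡⟨ cong (c *_) (∑-+ _ (g n) xs) ⟨
  c * ∑ (λ x → ∑< n (λ i → g i x) + g n x) xs               ∎
  where open ≡-Reasoning

ι-suc : ∀ n → ι (suc n) ≡ ι n + 1ℚ
ι-suc n = trans (cong ι (ℕ.+-comm 1 n)) (trans (ι-+ n 1) (+-congˡ (ι n) ι-1))

∑<-ones : ∀ n {g} → (∀ {i} → i ℕ.< n → g i ≡ 1ℚ) → ∑< n g ≡ ι n
∑<-ones zero    eq = sym ι-0
∑<-ones (suc n) eq = trans (cong₂ _+_ (∑<-ones n (eq ∘ ℕ.m<n⇒m<1+n)) (eq ℕ.≤-refl)) (sym (ι-suc n))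

ones-≤-∑< : ∀ {m n g} → m ℕ.≤ n → (∀ {i} → i ℕ.< m → g i ≡ 1ℚ) → (∀ i → 0ℚ ≤ g i) → ι m ≤ ∑< n g
ones-≤-∑< {m} {n} {g} m≤n ones 0≤g with m ℕ.≟ n
... | yes refl = ℚ.≤-reflexive (sym (∑<-ones n ones))
ones-≤-∑< {m} {zero}  {g} m≤n ones 0≤g | no m≢n = contradiction (ℕ.n≤0⇒n≡0 m≤n) m≢n
ones-≤-∑< {m} {suc n} {g} m≤n ones 0≤g | no m≢n = begin
  ι m             ≡⟨ ℚ.+-identityʳ (ι m) ⟨
  ι m + 0ℚ        ≤⟨ ℚ.+-mono-≤ (ones-≤-∑< {m} {n} {g} (ℕ.≤-pred (ℕ.≤∧≢⇒< m≤n m≢n)) ones 0≤g) (0≤g n) ⟩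
  ∑< n g + g n    ∎
  where open ℚ.≤-Reasoning

∑<-≤-ones : ∀ {m} n {g} → (∀ {i} → i ℕ.< m → g i ≡ 1ℚ) → (∀ {i} → m ℕ.≤ i → g i ≡ 0ℚ) → ∑< n g ≤ ι m
∑<-≤-ones {m} zero    ones zeros = 0≤ι m
∑<-≤-ones {m} (suc n) {g} ones zeros with n ℕ.<? m
... | yes n<m = ℚ.≤-trans (ℚ.≤-reflexive (∑<-ones (suc n) (λ i≤n → ones (ℕ.<-≤-trans i≤n n<m)))) (ι-mono-≤ n<m)
... | no n≮m  = ℚ.≤-trans (ℚ.≤-reflexive (trans (+-congˡ (∑< n g) (zeros (ℕ.≮⇒≥ n≮m))) (ℚ.+-identityʳ _))) (∑<-≤-ones n ones zeros)

length-cartesianProduct : ∀ {A B : Set} (xs : List A) (ys : List B) →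
                          length (cartesianProduct xs ys) ≡ length xs ℕ.* length ys
length-cartesianProduct []       ys = refl
length-cartesianProduct (x ∷ xs) ys = trans (List.length-++ (map (x ,_) ys))
  (cong₂ ℕ._+_ (List.length-map (x ,_) ys) (length-cartesianProduct xs ys))

module _ {h : ℕ} where
  open DecMembership (_≟ᵛ_ {h}) using (_∈?_)

  occupied : List (Vertex h) → ℕ → Column h
  occupied L x = tabulate (λ y → does ((x , y) ∈? L))

  occupied-lookup : ∀ L x y → lookup (occupied L x) y ≡ does ((x , y) ∈? L)
  occupied-lookup L x y = Vec.lookup∘tabulate (λ y → does ((x , y) ∈? L)) y

  occupied-∈ : ∀ {L x y} → (x , y) ∈ L → lookup (occupied L x) y ≡ true
  occupied-∈ {L} {x} {y} v∈ = trans (occupied-lookup L x y) (dec-true ((x , y) ∈? L) v∈)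

  occupied-∉ : ∀ {L x y} → (x , y) ∉ L → lookup (occupied L x) y ≡ false
  occupied-∉ {L} {x} {y} v∉ = trans (occupied-lookup L x y) (dec-false ((x , y) ∈? L) v∉)

  unoccupied : ∀ {L x y} → lookup (occupied L x) y ≡ false → (x , y) ∉ L
  unoccupied eq v∈ = false≢true eq (occupied-∈ v∈)

  occupied-cong : ∀ {L L′ x y x′ y′} → ((x , y) ∈ L → (x′ , y′) ∈ L′) → ((x′ , y′) ∈ L′ → (x , y) ∈ L) →
                  lookup (occupied L x) y ≡ lookup (occupied L′ x′) y′
  occupied-cong {L} {x = x} {y} to from with (x , y) ∈? L
  ... | yes v∈ = trans (occupied-∈ v∈) (sym (occupied-∈ (to v∈)))
  ... | no v∉  = trans (occupied-∉ v∉) (sym (occupied-∉ (v∉ ∘ from)))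

  visits : ∀ L c z → Visits (occupied L) (occupied ((c , z) ∷ L)) c z
  visits L c z = record
    { here-visited = lookup-ext same-column
    ; elsewhere    = λ {x} x≢c → lookup-ext (λ y → occupied-cong {L} {(c , z) ∷ L} {x} {y} {x} {y} there (other x≢c))
    }
    where
    other : ∀ {x y} → x ≢ c → (x , y) ∈ (c , z) ∷ L → (x , y) ∈ L
    other x≢c (here eq)  = contradiction (cong proj₁ eq) x≢c
    other x≢c (there v∈) = v∈
    same-column : ∀ y → lookup (occupied ((c , z) ∷ L) c) y ≡ lookup (occupied L c [ z ]≔ true) y
    same-column y with y Fin.≟ z
    ... | yes refl = trans (occupied-∈ {(c , z) ∷ L} (here refl)) (sym (Vec.lookup∘update z (occupied L c) true))
    ... | no y≢z   = trans (occupied-cong {(c , z) ∷ L} {L} {c} {y} {c} {y} drop there) (sym (Vec.lookup∘update′ y≢z (occupied L c) true))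
      where
      drop : (c , y) ∈ (c , z) ∷ L → (c , y) ∈ L
      drop (here eq)  = contradiction (cong proj₂ eq) y≢z
      drop (there v∈) = v∈

  horizontal : Bool → ℕ → Fin h → List (Vertex h)
  horizontal true  x y = []
  horizontal false x y = (x , y) ∷ []

  -- The free neighbours enumerated in the grouping of `branches`. For c = 0 the left column is
  -- `full`, so the vertex formed with `ℕ.pred c` does not appear.
  steps : List (Vertex h) → Vertex h → List (Vertex h)
  steps L (c , y) = horizontal (lookup (leftColumn (occupied L) c) y) (ℕ.pred c) y
    ++ map (c ,_) (exits (occupied L c) y)
    ++ horizontal (lookup (occupied L (suc c)) y) (suc c) y

  ∈-horizontal⁻ : ∀ {b x y w} → w ∈ horizontal b x y → b ≡ false × w ≡ (x , y)
  ∈-horizontal⁻ {false} (here eq) = refl , eq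

  ∈-horizontal⁺ : ∀ {b x y} → b ≡ false → (x , y) ∈ horizontal b x y
  ∈-horizontal⁺ refl = here refl

  horizontal! : ∀ b x y → Unique (horizontal b x y)
  horizontal! true  x y = []
  horizontal! false x y = [] ∷ []

  opaque
    unvisitedNeighbours : List (Vertex h) → Vertex h → List (Vertex h)
    unvisitedNeighbours L v = filter (λ w → ¬? (w ∈? L)) (neighbours v)

    ∈-unvisited⁻ : ∀ {L v w} → w ∈ unvisitedNeighbours L v → Adjacent v w × w ∉ L
    ∈-unvisited⁻ {L} {v} {w} w∈ with w∈n , w∉ ← ∈-filter⁻ (λ w → ¬? (w ∈? L)) {xs = neighbours v} w∈ = ∈-neighbours⁻ {v = v} w∈n , w∉

    ∈-unvisited⁺ : ∀ {L v w} → Adjacent v w → w ∉ L → w ∈ unvisitedNeighbours L v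
    ∈-unvisited⁺ {L} {v} {w} adj w∉ = ∈-filter⁺ (λ w → ¬? (w ∈? L)) (∈-neighbours⁺ {v = v} {w} adj) w∉

    unvisited! : ∀ L v → Unique (unvisitedNeighbours L v)
    unvisited! L v = Unique.filter⁺ (λ w → ¬? (w ∈? L)) (neighbours-unique v)

    unvisitedCount-length : ∀ v vs → unvisitedCount (v ∷ vs) ≡ length (unvisitedNeighbours (v ∷ vs) v)
    unvisitedCount-length v vs = refl

    unvisited-trapped : ∀ v vs → Trapped (v ∷ vs) → unvisitedNeighbours (v ∷ vs) v ≡ []
    unvisited-trapped v vs trap = List.filter-none (λ w → ¬? (w ∈? v ∷ vs))
      (All.tabulate (λ {w} w∈ w∉ → w∉ (trap w (∈-neighbours⁻ {v = v} w∈))))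

  left-∈ : ∀ L c y {w} → w ∈ horizontal (lookup (leftColumn (occupied L) c) y) (ℕ.pred c) y →
           suc (proj₁ w) ≡ c × proj₂ w ≡ y × w ∉ L
  left-∈ L zero y w∈ = contradiction (lookup-full y) (false≢true (proj₁ (∈-horizontal⁻ w∈)))
  left-∈ L (suc c) y w∈ with eq , refl ← ∈-horizontal⁻ w∈ = refl , refl , unoccupied eq

  vertical-∈ : ∀ L c y {w} → w ∈ map (c ,_) (exits (occupied L c) y) →
               proj₁ w ≡ c × touching y (proj₂ w) ≡ true × w ∉ L
  vertical-∈ L c y w∈ with z , z∈ , refl ← ∈-map⁻ (c ,_) w∈
    with z∈free , t ← ∈-filter⁻ (λ z → touching y z Bool.≟ true) {xs = free (occupied L c)} z∈
    = refl , t , unoccupied (free⁻ (occupied L c) z∈free)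

  right-∈ : ∀ L c y {w} → w ∈ horizontal (lookup (occupied L (suc c)) y) (suc c) y →
            proj₁ w ≡ suc c × proj₂ w ≡ y × w ∉ L
  right-∈ L c y w∈ with eq , refl ← ∈-horizontal⁻ w∈ = refl , refl , unoccupied eq

  adjacent-row : ∀ {x x′} (y : Fin h) → ∣ x - x′ ∣ ≡ 1 → Adjacent (x , y) (x′ , y)
  adjacent-row y eq rewrite eq | ℕ.∣n-n∣≡0 (toℕ y) = refl

  adjacent-column : ∀ {x} {y y′ : Fin h} → touching y y′ ≡ true → Adjacent (x , y) (x , y′)
  adjacent-column {x} {y} {y′} t rewrite ℕ.∣n-n∣≡0 x | touching⇒dist y y′ t = refl

  ∣n-suc∣≡1 : ∀ n → ∣ n - suc n ∣ ≡ 1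
  ∣n-suc∣≡1 zero    = refl
  ∣n-suc∣≡1 (suc n) = ∣n-suc∣≡1 n

  steps-⊆ : ∀ L v {w} → w ∈ steps L v → w ∈ unvisitedNeighbours L v
  steps-⊆ L v@(c , y) {w} w∈ = ∈-unvisited⁺ {L} {v} {w} (proj₁ both-facts) (proj₂ both-facts)
    where
    both-facts : Adjacent v w × w ∉ L
    both-facts with ∈-++⁻ (horizontal (lookup (leftColumn (occupied L) c) y) (ℕ.pred c) y) w∈
    ... | inj₁ w∈ˡ with refl , refl , w∉ ← left-∈ L c y w∈ˡ =
      adjacent-row {suc (proj₁ w)} {proj₁ w} y (trans (ℕ.∣-∣-comm (suc (proj₁ w)) (proj₁ w)) (∣n-suc∣≡1 (proj₁ w))) , w∉
    ... | inj₂ w∈′ with ∈-++⁻ (map (c ,_) (exits (occupied L c) y)) w∈′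
    ...   | inj₁ w∈ᵛ with refl , t , w∉ ← vertical-∈ L c y w∈ᵛ = adjacent-column {c} {y} t , w∉
    ...   | inj₂ w∈ʳ with refl , refl , w∉ ← right-∈ L c y w∈ʳ = adjacent-row {c} {suc c} y (∣n-suc∣≡1 c) , w∉

  steps-⊇ : ∀ L v {w} → w ∈ unvisitedNeighbours L v → w ∈ steps L v
  steps-⊇ L v@(c , y) {x , z} w∈ with adj , w∉ ← ∈-unvisited⁻ {L} {v} {x , z} w∈ with squares≡1 ∣ c - x ∣ ∣ toℕ y - toℕ z ∣ adj
  ... | inj₁ (c≡x , y~z) rewrite sym (ℕ.∣m-n∣≡0⇒m≡n {c} {x} c≡x) =
    ∈-++⁺ʳ (horizontal (lookup (leftColumn (occupied L) c) y) (ℕ.pred c) y) (∈-++⁺ˡ (∈-map⁺ (c ,_)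
      (∈-filter⁺ (λ z → touching y z Bool.≟ true) (free⁺ (occupied L c) (occupied-∉ w∉)) (dist⇒touching y z y~z))))
  ... | inj₂ (c~x , y≡z) with refl ← Fin.toℕ-injective (ℕ.∣m-n∣≡0⇒m≡n {toℕ y} {toℕ z} y≡z) with ∣-∣≡1 c x c~x
  ...   | inj₁ refl = ∈-++⁺ˡ (∈-horizontal⁺ (occupied-∉ w∉))
  ...   | inj₂ refl = ∈-++⁺ʳ (horizontal (lookup (leftColumn (occupied L) c) y) (ℕ.pred c) y)
                        (∈-++⁺ʳ (map (c ,_) (exits (occupied L c) y)) (∈-horizontal⁺ (occupied-∉ w∉)))

  steps! : ∀ L v → Unique (steps L v)
  steps! L (c , y) = Unique.++⁺ (horizontal! _ (ℕ.pred c) y)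
    (Unique.++⁺ (Unique.map⁺ (cong proj₂) (Unique.filter⁺ (λ z → touching y z Bool.≟ true) (free! (occupied L c))))
      (horizontal! _ (suc c) y)
      (λ (v∈ , w∈) → ℕ.<⇒≢ (ℕ.n<1+n c) (trans (sym (proj₁ (vertical-∈ L c y v∈))) (proj₁ (right-∈ L c y w∈)))))
    (λ (v∈ , w∈) → disjoint v∈ (∈-++⁻ (map (c ,_) (exits (occupied L c) y)) w∈))
    where
    disjoint : ∀ {w} → w ∈ horizontal (lookup (leftColumn (occupied L) c) y) (ℕ.pred c) y →
               ¬ (w ∈ map (c ,_) (exits (occupied L c) y) ⊎ w ∈ horizontal (lookup (occupied L (suc c)) y) (suc c) y)
    disjoint v∈ (inj₁ w∈) = ℕ.<⇒≢ (ℕ.n<1+n _) (trans (proj₁ (vertical-∈ L c y w∈)) (sym (proj₁ (left-∈ L c y v∈))))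
    disjoint v∈ (inj₂ w∈) = ℕ.<⇒≢ (ℕ.m<n⇒m<1+n (ℕ.n<1+n _)) (trans (proj₁ (right-∈ L c y w∈)) (cong suc (sym (proj₁ (left-∈ L c y v∈)))))

  steps-↭ : ∀ L v → unvisitedNeighbours L v ↭ steps L v
  steps-↭ L v = unique-↭ (unvisited! L v) (steps! L v) (steps-⊇ L v) (steps-⊆ L v)

  -- The probability that a given walk reaches a column

  furthest : List (Vertex h) → ℕ
  furthest []       = 0
  furthest (v ∷ vs) = proj₁ v ⊔ furthest vs

  moves : Walk h → List (Vertex h)
  moves (v ∷ vs) = unvisitedNeighbours (v ∷ vs) v

  infixr 5 _▹_
  _▹_ : Vertex h → Walk h → Walk h
  w ▹ (v ∷ vs) = w ∷ v ∷ vs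

  opaque
    -- The contraction speaks of a future crossing from column n to column n + 1, so it is the right
    -- value only as long as the walk has stayed within the columns up to n. Afterwards the event is
    -- certain. The offset `n ∸ proj₁ v` puts the target at column n + 1.
    reach : ℕ → Walk h → ℚ
    reach n (v ∷ vs) with n ℕ.<? furthest (v ∷ vs)
    ... | yes _ = 1ℚ
    ... | no _  = V (occupied (v ∷ vs)) (proj₁ v) (n ∸ proj₁ v) (proj₂ v)

    reach-far : ∀ {n} W → n ℕ.< furthest (toList W) → reach n W ≡ 1ℚ
    reach-far {n} (v ∷ vs) far with n ℕ.<? furthest (v ∷ vs)
    ... | yes _   = refl
    ... | no near = contradiction far near

    reach-near : ∀ {n} v vs → furthest (v ∷ vs) ℕ.≤ n →
                 reach n (v ∷ vs) ≡ V (occupied (v ∷ vs)) (proj₁ v) (n ∸ proj₁ v) (proj₂ v)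
    reach-near {n} v vs near with n ℕ.<? furthest (v ∷ vs)
    ... | yes far = contradiction near (ℕ.<⇒≱ far)
    ... | no _    = refl

    0≤-reach : ∀ n W → 0ℚ ≤ reach n W
    0≤-reach n (v ∷ vs) with n ℕ.<? furthest (v ∷ vs)
    ... | yes _ = ℚ.≤-trans (0≤ι 1) (ℚ.≤-reflexive ι-1)
    ... | no _  = 0≤-V (occupied (v ∷ vs)) (proj₁ v) (n ∸ proj₁ v) (proj₂ v)

  -- For a trapped walk the empty average is 0, the correct probability of reaching a column not yet
  -- reached.
  average : (Vertex h → ℚ) → Walk h → ℚ
  average f W = 1/ₙ (length (moves W)) * ∑ f (moves W)

  ∑-horizontal : ∀ (f : Vertex h → ℚ) b x y → ∑ f (horizontal b x y) ≡ (if b then 0ℚ else f (x , y))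
  ∑-horizontal f true  x y = refl
  ∑-horizontal f false x y = ℚ.+-identityʳ _

  length-horizontal : ∀ b x (y : Fin h) → length (horizontal b x y) ≡ [ not b ]ᵇ
  length-horizontal true  x y = refl
  length-horizontal false x y = refl

  length-steps : ∀ L c (y : Fin h) → length (steps L (c , y)) ≡
    degree (lookup (leftColumn (occupied L) c) y) (occupied L c) y (occupied L (suc c))
  length-steps L c y = begin
    length (steps L (c , y))
      ≡⟨ trans (List.length-++ ls) (cong (length ls ℕ.+_) (List.length-++ us)) ⟩
    length ls ℕ.+ (length us ℕ.+ length rs)
      ≡⟨ cong₂ ℕ._+_ (length-horizontal l (ℕ.pred c) y) (cong₂ ℕ._+_ (List.length-map (c ,_) (exits (occupied L c) y)) (length-horizontal r (suc c) y)) ⟩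
    [ not l ]ᵇ ℕ.+ (length (exits (occupied L c) y) ℕ.+ [ not r ]ᵇ)
      ≡⟨ trans (sym (ℕ.+-assoc [ not l ]ᵇ _ _)) (trans (cong (ℕ._+ [ not r ]ᵇ) (ℕ.+-comm [ not l ]ᵇ _)) (ℕ.+-assoc (length (exits (occupied L c) y)) [ not l ]ᵇ [ not r ]ᵇ)) ⟩
    length (exits (occupied L c) y) ℕ.+ ([ not l ]ᵇ ℕ.+ [ not r ]ᵇ) ∎
    where
    open ≡-Reasoning
    l = lookup (leftColumn (occupied L) c) y
    r = lookup (occupied L (suc c)) y
    ls = horizontal l (ℕ.pred c) y
    us = map (c ,_) (exits (occupied L c) y)
    rs = horizontal r (suc c) y

  reach-average : ∀ {n} W → furthest (toList W) ℕ.≤ n → reach n W ≡ average (λ w → reach n (w ▹ W)) W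
  reach-average {n} (v@(c , y) ∷ vs) near = begin
    reach n (v ∷ vs)
      ≡⟨ reach-near v vs near ⟩
    V occ c j y
      ≡⟨ V-harmonic occ next (visits L) c j y (occupied-∈ {L = L} (here refl)) ⟩
    1/ₙ (degree l (occ c) y (occ (suc c))) * (V-left occ next (visits L) c j y + (V-vertical occ next (visits L) c j y + (if r then 0ℚ else V-right occ next (visits L) c j y)))
      ≡⟨ cong₂ (λ d s → 1/ₙ d * s) (sym (trans (↭-length (steps-↭ L v)) (length-steps L c y))) (cong₂ _+_ (sym ∑-left) (cong₂ _+_ (sym ∑-vertical) (sym ∑-right))) ⟩
    1/ₙ (length (unvisitedNeighbours L v)) * (∑ f (horizontal l (ℕ.pred c) y) + (∑ f (map (c ,_) (exits (occ c) y)) + ∑ f (horizontal r (suc c) y)))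
      ≡⟨ cong (1/ₙ (length (unvisitedNeighbours L v)) *_) (trans (∑-↭ f (steps-↭ L v)) (trans (∑-++ f (horizontal l (ℕ.pred c) y) _) (+-congˡ (∑ f (horizontal l (ℕ.pred c) y)) (∑-++ f (map (c ,_) (exits (occ c) y)) _)))) ⟨
    1/ₙ (length (unvisitedNeighbours L v)) * ∑ f (unvisitedNeighbours L v) ∎
    where
    open ≡-Reasoning
    L = v ∷ vs
    occ = occupied L
    next = λ c z → occupied ((c , z) ∷ L)
    j = n ∸ c
    l = lookup (leftColumn occ c) y
    r = lookup (occ (suc c)) y
    f = λ w → reach n (w ∷ L)
    c≤n : c ℕ.≤ n
    c≤n = ℕ.≤-trans (ℕ.m≤m⊔n c (furthest vs)) near
    f-near : ∀ {x} z → x ℕ.≤ n → f (x , z) ≡ V (next x z) x (n ∸ x) z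
    f-near {x} z x≤n = reach-near (x , z) L (ℕ.⊔-lub x≤n near)
    ∸-suc′ : ∀ {c} → suc c ℕ.≤ n → n ∸ c ≡ suc (n ∸ suc c)
    ∸-suc′ = ℕ.+-∸-assoc 1

    ∑-vertical : ∑ f (map (c ,_) (exits (occ c) y)) ≡ V-vertical occ next (visits L) c j y
    ∑-vertical = trans (∑-map f (c ,_) (exits (occ c) y)) (∑-cong (λ z → f-near z c≤n) (exits (occ c) y))

    left-value : ∀ c → c ℕ.≤ n →
      (if lookup (leftColumn occ c) y then 0ℚ else f (ℕ.pred c , y)) ≡ V-left occ next (visits L) c (n ∸ c) y
    left-value zero _ = cong (λ b → if b then 0ℚ else f (0 , y)) (lookup-full y)
    left-value (suc c) c<n = cong (λ p → if lookup (occ c) y then 0ℚ else p)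
      (trans (f-near y (ℕ.<⇒≤ c<n)) (cong (λ k → V (next c y) c k y) (∸-suc′ c<n)))

    ∑-left : ∑ f (horizontal l (ℕ.pred c) y) ≡ V-left occ next (visits L) c j y
    ∑-left = trans (∑-horizontal f l (ℕ.pred c) y) (left-value c c≤n)

    right-value : f (suc c , y) ≡ V-right occ next (visits L) c j y
    right-value with c ℕ.<? n
    ... | yes c<n rewrite ∸-suc′ c<n = f-near y c<n
    -- Here c = n: the step to the right enters the target column, where `reach` is 1 by its first
    -- case, in agreement with `V-right` at j = 0.
    ... | no c≮n rewrite ℕ.m≤n⇒m∸n≡0 (ℕ.≮⇒≥ c≮n) =
      reach-far ((suc c , y) ∷ L) (ℕ.≤-trans (ℕ.s≤s (ℕ.≮⇒≥ c≮n)) (ℕ.m≤m⊔n (suc c) (furthest L)))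

    ∑-right : ∑ f (horizontal r (suc c) y) ≡ (if r then 0ℚ else V-right occ next (visits L) c j y)
    ∑-right = trans (∑-horizontal f r (suc c) y) (cong (λ p → if r then 0ℚ else p) right-value)

  -- Enumeration of GSAWs, and bounds for their expected displacement

  gsaws   : ℕ → Walk h → List (Walk h)
  prolong : ℕ → Walk h → List (Vertex h) → List (Walk h)

  gsaws n W = prolong n W (moves W)

  prolong n       W []         = W ∷ []
  -- A walk that can still move when the budget is spent is dropped; the estimates below account for
  -- this loss.
  prolong zero    W (_ ∷ _)    = []
  prolong (suc n) W (w ∷ ws)   = concatMap (λ w → gsaws n (w ▹ W)) (w ∷ ws)

  trapped-moves : ∀ W → Trapped W → moves W ≡ []
  trapped-moves (v ∷ vs) = unvisited-trapped v vs

  no-moves-trapped : ∀ W → moves W ≡ [] → Trapped W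
  no-moves-trapped (v ∷ vs) eq w adj with w ∈? v ∷ vs
  ... | yes w∈ = w∈
  ... | no w∉  with () ← subst (w ∈_) eq (∈-unvisited⁺ {L = v ∷ vs} {v} {w} adj w∉)

  trapped-∈-gsaws : ∀ n {W} → Trapped W → W ∈ gsaws n W
  trapped-∈-gsaws n {W} trap = subst (λ ws → W ∈ prolong n W ws) (sym (trapped-moves W trap)) (here refl)

  ▹-self-avoiding : ∀ {s : Vertex h} {W w} → SelfAvoiding s W → w ∈ moves W → SelfAvoiding s (w ▹ W)
  ▹-self-avoiding {W = v ∷ vs} {w} sa w∈ with adj , w∉ ← ∈-unvisited⁻ {L = v ∷ vs} {v} {w} w∈ = step sa adj w∉

  gsaws-sound : ∀ {s : Vertex h} n {W G} → SelfAvoiding s W → G ∈ gsaws n W → GSAW s G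
  prolong-sound : ∀ {s : Vertex h} n {W G} ws → moves W ≡ ws → SelfAvoiding s W → G ∈ prolong n W ws → GSAW s G

  gsaws-sound n {W} sa G∈ = prolong-sound n (moves W) refl sa G∈

  prolong-sound n       {W} []       eq sa (here refl) = sa , no-moves-trapped W eq
  prolong-sound (suc n) {W} (w ∷ ws) eq sa G∈
    with w′ , w′∈ , G∈′ ← find (∈-concatMap⁻ (λ w → gsaws n (w ▹ W)) {xs = w ∷ ws} G∈)
    = gsaws-sound n (▹-self-avoiding sa (subst (w′ ∈_) (sym eq) w′∈)) G∈′

  gsaws-step : ∀ n {W w G} → w ∈ moves W → G ∈ gsaws n (w ▹ W) → G ∈ gsaws (suc n) W
  gsaws-step n {W} {w} {G} w∈ G∈ = by-moves (moves W) w∈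
    where
    by-moves : ∀ ws → w ∈ ws → G ∈ prolong (suc n) W ws
    by-moves (w′ ∷ ws) w∈ = ∈-concatMap⁺ (λ w → gsaws n (w ▹ W)) {xs = w′ ∷ ws} (lose w∈ G∈)

  -- `gsaws` grows walks from the start, whereas `SelfAvoiding` is taken apart at the end. The
  -- induction therefore returns the last step to the budget and keeps the extension `G` fixed.
  gsaws-complete : ∀ {s v : Vertex h} {vs} → SelfAvoiding s (v ∷ vs) → ∀ n {G} →
                   G ∈ gsaws n (v ∷ vs) → G ∈ gsaws (length vs ℕ.+ n) (s ∷ [])
  gsaws-complete start n G∈ = G∈
  gsaws-complete {s} {w} (step {v} {vs} sa adj w∉) n {G} G∈ =
    subst (λ k → G ∈ gsaws k (s ∷ [])) (ℕ.+-suc (length vs) n)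
      (gsaws-complete sa (suc n) (gsaws-step n {v ∷ vs} {w} (∈-unvisited⁺ {L = v ∷ vs} {v} {w} adj w∉) G∈))

  gsaws-suffix : ∀ n {W G} → G ∈ gsaws n W → ∃[ us ] toList G ≡ us ++ toList W
  prolong-suffix : ∀ n {W G} ws → G ∈ prolong n W ws → ∃[ us ] toList G ≡ us ++ toList W

  gsaws-suffix n {W} = prolong-suffix n (moves W)

  prolong-suffix n       []       (here refl) = [] , refl
  prolong-suffix (suc n) {v ∷ vs} (w ∷ ws) G∈
    with w′ , _ , G∈′ ← find (∈-concatMap⁻ (λ w → gsaws n (w ▹ (v ∷ vs))) {xs = w ∷ ws} G∈)
    with us , eq ← gsaws-suffix n G∈′
    = us ++ [ w′ ] , trans eq (sym (List.++-assoc us [ w′ ] (v ∷ vs)))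

  -- Walks are stored most recent first, so `W` is a suffix of every extension and the entry just
  -- before it is the first vertex added. That entry tells the two families apart.
  gsaws-disjoint : ∀ n (W : Walk h) {w w′} → w ≢ w′ → Disjoint (gsaws n (w ▹ W)) (gsaws n (w′ ▹ W))
  gsaws-disjoint n W@(v ∷ vs) {w} {w′} w≢w′ (G∈ , G∈′)
    with us , eq ← gsaws-suffix n G∈ | us′ , eq′ ← gsaws-suffix n G∈′ =
    w≢w′ (List.∷ʳ-injectiveʳ us us′ (List.++-cancelʳ (v ∷ vs) (us ++ [ w ]) (us′ ++ [ w′ ]) (begin
      (us ++ [ w ]) ++ v ∷ vs      ≡⟨ List.++-assoc us [ w ] (v ∷ vs) ⟩
      us ++ w ∷ v ∷ vs             ≡⟨ eq ⟨
      _                            ≡⟨ eq′ ⟩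
      us′ ++ w′ ∷ v ∷ vs           ≡⟨ List.++-assoc us′ [ w′ ] (v ∷ vs) ⟨
      (us′ ++ [ w′ ]) ++ v ∷ vs    ∎)))
    where open ≡-Reasoning

  moves! : ∀ W → Unique (moves W)
  moves! (v ∷ vs) = unvisited! (v ∷ vs) v

  gsaws!   : ∀ n W → Unique (gsaws n W)
  prolong! : ∀ n W ws → Unique ws → Unique (prolong n W ws)

  gsaws! n W = prolong! n W (moves W) (moves! W)

  prolong! n       W []       _   = [] ∷ []
  prolong! zero    W (_ ∷ _)  _   = []
  prolong! (suc n) W (w ∷ ws) ws! = Unique.concat⁺
    (All.map⁺ (All.universal (λ w → gsaws! n (w ▹ W)) (w ∷ ws)))
    (AllPairs.map⁺ (AllPairs.map (gsaws-disjoint n W) ws!))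

  -- The expected displacement of the extensions in gsaws n W, conditioned on W.
  gain    : ℕ → Walk h → ℚ
  outcome : ℕ → Walk h → List (Vertex h) → ℚ

  gain n W = outcome n W (moves W)

  outcome n       W []       = ι (furthest (toList W))
  outcome zero    W (_ ∷ _)  = 0ℚ
  outcome (suc n) W (_ ∷ _)  = average (λ w → gain n (w ▹ W)) W

  weight : Walk h → ℚ
  weight W = uniformProbability W * ι (furthest (toList W))

  ∑-weight-gsaws   : ∀ n W → ∑ weight (gsaws n W) ≡ uniformProbability W * gain n W
  ∑-weight-prolong : ∀ n W ws → moves W ≡ ws → ∑ weight (prolong n W ws) ≡ uniformProbability W * outcome n W ws

  ∑-weight-gsaws n W = ∑-weight-prolong n W (moves W) refl

  ∑-weight-prolong n       W []       eq = ℚ.+-identityʳ (weight W)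
  ∑-weight-prolong zero    W (_ ∷ _)  eq = sym (ℚ.*-zeroʳ (uniformProbability W))
  ∑-weight-prolong (suc n) W@(v ∷ vs) (w ∷ ws) eq = begin
    ∑ weight (concatMap (λ w → gsaws n (w ▹ W)) (w ∷ ws))
      ≡⟨ ∑-concatMap weight (λ w → gsaws n (w ▹ W)) (w ∷ ws) ⟩
    ∑ (λ w → ∑ weight (gsaws n (w ▹ W))) (w ∷ ws)
      ≡⟨ ∑-cong (λ w → trans (∑-weight-gsaws n (w ▹ W)) (trans
           (cong (λ d → (1/ₙ d * p) * gain n (w ▹ W)) (unvisitedCount-length v vs)) (ℚ.*-assoc m p (gain n (w ▹ W))))) (w ∷ ws) ⟩
    ∑ (λ w → m * (p * gain n (w ▹ W))) (w ∷ ws)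
      ≡⟨ trans (∑-*ˡ m _ (w ∷ ws)) (cong (m *_) (∑-*ˡ p _ (w ∷ ws))) ⟩
    m * (p * ∑ (λ w → gain n (w ▹ W)) (w ∷ ws))
      ≡⟨ solve 3 (λ m p s → m :* (p :* s) := p :* (m :* s)) refl m p (∑ (λ w → gain n (w ▹ W)) (w ∷ ws)) ⟩
    p * (m * ∑ (λ w → gain n (w ▹ W)) (w ∷ ws))
      ≡⟨ cong (λ us → p * (m * ∑ (λ w → gain n (w ▹ W)) us)) eq ⟨
    p * average (λ w → gain n (w ▹ W)) W ∎
    where
    open ≡-Reasoning
    m = 1/ₙ (length (moves W))
    p = uniformProbability W

  0≤-average : ∀ {f} → (∀ w → 0ℚ ≤ f w) → ∀ W → 0ℚ ≤ average f W
  0≤-average 0≤f W = 0≤-* (0≤1/ₙ (length (moves W))) (0≤-∑ 0≤f (moves W))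

  average-mono : ∀ {f g} W → (∀ {w} → w ∈ moves W → f w ≤ g w) → average f W ≤ average g W
  average-mono W f≤g = *-monoˡ-0≤ (0≤1/ₙ (length (moves W))) (∑-mono-∈ (moves W) f≤g)

  average-+ : ∀ f g W → average (λ w → f w + g w) W ≡ average f W + average g W
  average-+ f g W = trans (cong (1/ₙ (length (moves W)) *_) (∑-+ f g (moves W))) (ℚ.*-distribˡ-+ (1/ₙ (length (moves W))) _ _)

  average-*ˡ : ∀ c f W → average (λ w → c * f w) W ≡ c * average f W
  average-*ˡ c f W = trans (cong (1/ₙ (length (moves W)) *_) (∑-*ˡ c f (moves W)))
    (solve 3 (λ d c s → d :* (c :* s) := c :* (d :* s)) refl (1/ₙ (length (moves W))) c (∑ f (moves W)))

  average-∑< : ∀ n (f : ℕ → Vertex h → ℚ) W → ∑< n (λ i → average (f i) W) ≡ average (λ w → ∑< n (λ i → f i w)) W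
  average-∑< n f W = ∑<-*-∑ n (1/ₙ (length (moves W))) f (moves W)

  average-1 : ∀ {f W w ws} → moves W ≡ w ∷ ws → (∀ {w} → w ∈ moves W → f w ≡ 1ℚ) → average f W ≡ 1ℚ
  average-1 {f} {W} {w} {ws} eq ones = begin
    1/ₙ (length (moves W)) * ∑ f (moves W)                     ≡⟨ cong (1/ₙ (length (moves W)) *_) (∑-cong-∈ (moves W) ones) ⟩
    1/ₙ (length (moves W)) * ∑ (λ _ → 1ℚ) (moves W)            ≡⟨ cong (λ us → 1/ₙ (length us) * ∑ (λ _ → 1ℚ) us) eq ⟩
    1/ₙ (suc (length ws)) * ∑ (λ _ → 1ℚ) (w ∷ ws)              ≡⟨ cong (1/ₙ (suc (length ws)) *_) (trans (∑-const 1ℚ (w ∷ ws)) (ℚ.*-identityʳ _)) ⟩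
    1/ₙ (suc (length ws)) * ι (suc (length ws))                ≡⟨ ℚ.*-comm (1/ₙ suc (length ws)) _ ⟩
    ι (suc (length ws)) * 1/ₙ (suc (length ws))                ≡⟨ 1/ₙ-inverse (length ws) ⟩
    1ℚ ∎
    where open ≡-Reasoning

  furthest-▹ : ∀ w W → furthest (toList (w ▹ W)) ≡ proj₁ w ⊔ furthest (toList W)
  furthest-▹ w (v ∷ vs) = refl

  length-▹ : ∀ w W → length (toList (w ▹ W)) ≡ suc (length (toList W))
  length-▹ w (v ∷ vs) = refl

  -- Beyond column n both sides are 1, which needs at least one move since the empty average is 0.
  reach-average-moving : ∀ n W {w ws} → moves W ≡ w ∷ ws → reach n W ≡ average (λ w → reach n (w ▹ W)) W
  reach-average-moving n W eq = by-distance (ℕ.≤-<-connex (furthest (toList W)) n)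
    where
    by-distance : furthest (toList W) ℕ.≤ n ⊎ n ℕ.< furthest (toList W) → reach n W ≡ average (λ w → reach n (w ▹ W)) W
    by-distance (inj₁ near) = reach-average W near
    by-distance (inj₂ far)  = trans (reach-far W far) (sym (average-1 {W = W} eq (λ {w} _ → reach-far (w ▹ W)
      (ℕ.<-≤-trans far (ℕ.≤-trans (ℕ.m≤n⊔m (proj₁ w) _) (ℕ.≤-reflexive (sym (furthest-▹ w W))))))))

  reach-trapped : ∀ {n} W → moves W ≡ [] → furthest (toList W) ℕ.≤ n → reach n W ≡ 0ℚ
  reach-trapped {n} W eq near = trans (reach-average W near)
    (trans (cong (λ us → 1/ₙ (length us) * ∑ (λ w → reach n (w ▹ W)) us) eq) (ℚ.*-zeroˡ 0ℚ))

  0≤-gain    : ∀ n W → 0ℚ ≤ gain n W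
  0≤-outcome : ∀ n W ws → 0ℚ ≤ outcome n W ws
  0≤-gain n W = 0≤-outcome n W (moves W)
  0≤-outcome n       W []      = 0≤ι (furthest (toList W))
  0≤-outcome zero    W (_ ∷ _) = ℚ.≤-refl
  0≤-outcome (suc n) W (_ ∷ _) = 0≤-average (λ w → 0≤-gain n (w ▹ W)) W

  adjacent-column-≤ : ∀ {v w : Vertex h} → Adjacent v w → proj₁ w ℕ.≤ suc (proj₁ v)
  adjacent-column-≤ {c , y} {x , z} adj with squares≡1 ∣ c - x ∣ ∣ toℕ y - toℕ z ∣ adj
  ... | inj₁ (c≡x , _) = ℕ.≤-trans (ℕ.≤-reflexive (sym (ℕ.∣m-n∣≡0⇒m≡n {c} {x} c≡x))) (ℕ.n≤1+n c)
  ... | inj₂ (c~x , _) with ∣-∣≡1 c x c~x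
  ...   | inj₁ refl = ℕ.m≤n⇒m≤1+n (ℕ.n≤1+n x)
  ...   | inj₂ refl = ℕ.≤-refl

  furthest-move : ∀ W {w} → w ∈ moves W → furthest (toList (w ▹ W)) ℕ.≤ suc (furthest (toList W))
  furthest-move W@(v ∷ vs) {w} w∈ = ℕ.⊔-lub
    (ℕ.≤-trans (adjacent-column-≤ {v} {w} (proj₁ (∈-unvisited⁻ {L = v ∷ vs} {v} {w} w∈))) (ℕ.s≤s (ℕ.m≤m⊔n (proj₁ v) (furthest vs))))
    (ℕ.n≤1+n _)

  -- Layer-cake summation: for a trapped walk, `furthest` counts the i for which `reach i` is 1.
  -- Harmonicity carries the inequality back to `W`, and dropped walks count 0 on the left. A step
  -- raises `furthest` by at most 1, so `K` exceeds no layer too early for any extension within the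
  -- budget.
  gain-≤    : ∀ n K W → furthest (toList W) ℕ.+ n ℕ.≤ K → gain n W ≤ ∑< K (λ i → reach i W)
  outcome-≤ : ∀ n K W ws → moves W ≡ ws → furthest (toList W) ℕ.+ n ℕ.≤ K → outcome n W ws ≤ ∑< K (λ i → reach i W)

  gain-≤ n K W = outcome-≤ n K W (moves W) refl

  outcome-≤ n       K W []      eq le = ones-≤-∑< {furthest (toList W)} {K} (ℕ.≤-trans (ℕ.m≤m+n _ n) le) (reach-far W) (λ i → 0≤-reach i W)
  outcome-≤ zero    K W (_ ∷ _) eq le = 0≤-∑< K (λ i → 0≤-reach i W)
  outcome-≤ (suc n) K W (_ ∷ _) eq le = begin
    average (λ w → gain n (w ▹ W)) W                       ≤⟨ average-mono W (λ {w} w∈ → gain-≤ n K (w ▹ W) (bound w∈)) ⟩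
    average (λ w → ∑< K (λ i → reach i (w ▹ W))) W         ≡⟨ average-∑< K (λ i w → reach i (w ▹ W)) W ⟨
    ∑< K (λ i → average (λ w → reach i (w ▹ W)) W)         ≡⟨ ∑<-cong K (λ i → reach-average-moving i W eq) ⟨
    ∑< K (λ i → reach i W)                                 ∎
    where
    open ℚ.≤-Reasoning
    bound : ∀ {w} → w ∈ moves W → furthest (toList (w ▹ W)) ℕ.+ n ℕ.≤ K
    bound w∈ = ℕ.≤-trans (ℕ.+-monoˡ-≤ n (furthest-move W w∈)) (ℕ.≤-trans (ℕ.≤-reflexive (sym (ℕ.+-suc _ n))) le)

  furthest-∈ : ∀ {L : List (Vertex h)} {v} → v ∈ L → proj₁ v ℕ.≤ furthest L
  furthest-∈ {u ∷ L} (here refl) = ℕ.m≤m⊔n (proj₁ u) (furthest L)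
  furthest-∈ {u ∷ L} (there v∈)  = ℕ.≤-trans (furthest-∈ v∈) (ℕ.m≤n⊔m (proj₁ u) (furthest L))

  length-≤-area : ∀ {D} {L : List (Vertex h)} → Unique L → furthest L ℕ.≤ D → length L ℕ.≤ suc D ℕ.* h
  length-≤-area {D} {L} L! near = ℕ.≤-trans
    (unique-⊆-length L! (λ {(x , y)} v∈ → ∈-cartesianProduct⁺ (∈-upTo⁺ (ℕ.s≤s (ℕ.≤-trans (furthest-∈ v∈) near))) (∈-allFin y)))
    (ℕ.≤-reflexive (trans (length-cartesianProduct (upTo (suc D)) (allFin h)) (cong₂ ℕ._*_ (List.length-upTo (suc D)) (List.length-tabulate {n = h} (λ i → i)))))

  move-unique : ∀ W {w} → Unique (toList W) → w ∈ moves W → Unique (toList (w ▹ W))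
  move-unique (v ∷ vs) {w} W! w∈ =
    All.tabulate (λ u∈ w≡u → proj₂ (∈-unvisited⁻ {L = v ∷ vs} {v} {w} w∈) (subst (_∈ v ∷ vs) (sym w≡u) u∈)) ∷ W!

  -- The columns 0 to D hold (D + 1) h vertices. With this budget an extension is either trapped
  -- there, and then fully counted, or passes column D. The latter has probability `reach D W` and
  -- costs at most D in the sum over i < D.
  gain-≥    : ∀ n D W → Unique (toList W) → suc D ℕ.* h ℕ.< length (toList W) ℕ.+ n →
              ∑< D (λ i → reach i W) ≤ gain n W + ι D * reach D W
  outcome-≥ : ∀ n D W ws → moves W ≡ ws → furthest (toList W) ℕ.≤ D → Unique (toList W) →
              suc D ℕ.* h ℕ.< length (toList W) ℕ.+ n →
              ∑< D (λ i → reach i W) ≤ outcome n W ws + ι D * reach D W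

  gain-≥ n D W W! long = by-distance (ℕ.≤-<-connex (furthest (toList W)) D)
    where
    open ℚ.≤-Reasoning
    by-distance : furthest (toList W) ℕ.≤ D ⊎ D ℕ.< furthest (toList W) → ∑< D (λ i → reach i W) ≤ gain n W + ι D * reach D W
    by-distance (inj₁ near) = outcome-≥ n D W (moves W) refl near W! long
    by-distance (inj₂ far)  = begin
      ∑< D (λ i → reach i W)        ≡⟨ ∑<-ones D (λ i<D → reach-far W (ℕ.<-trans i<D far)) ⟩
      ι D                           ≡⟨ ℚ.*-identityʳ (ι D) ⟨
      ι D * 1ℚ                      ≡⟨ cong (ι D *_) (reach-far W far) ⟨
      ι D * reach D W               ≡⟨ ℚ.+-identityˡ _ ⟨
      0ℚ + ι D * reach D W          ≤⟨ ℚ.+-monoˡ-≤ (ι D * reach D W) (0≤-gain n W) ⟩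
      gain n W + ι D * reach D W    ∎

  outcome-≥ n D W [] eq near W! long = begin
    ∑< D (λ i → reach i W)                            ≤⟨ ∑<-≤-ones D (reach-far W) (reach-trapped W eq) ⟩
    ι (furthest (toList W))                           ≡⟨ ℚ.+-identityʳ _ ⟨
    ι (furthest (toList W)) + 0ℚ                      ≤⟨ ℚ.+-monoʳ-≤ (ι (furthest (toList W))) (0≤-* (0≤ι D) (0≤-reach D W)) ⟩
    ι (furthest (toList W)) + ι D * reach D W         ∎
    where open ℚ.≤-Reasoning
  outcome-≥ zero D W (_ ∷ _) eq near W! long = contradiction (length-≤-area W! near)
    (ℕ.<⇒≱ (ℕ.<-≤-trans long (ℕ.≤-reflexive (ℕ.+-identityʳ _))))
  outcome-≥ (suc n) D W (_ ∷ _) eq near W! long = begin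
    ∑< D (λ i → reach i W)
      ≡⟨ ∑<-cong D (λ i → reach-average-moving i W eq) ⟩
    ∑< D (λ i → average (λ w → reach i (w ▹ W)) W)
      ≡⟨ average-∑< D (λ i w → reach i (w ▹ W)) W ⟩
    average (λ w → ∑< D (λ i → reach i (w ▹ W))) W
      ≤⟨ average-mono W (λ {w} w∈ → gain-≥ n D (w ▹ W) (move-unique W W! w∈) (long′ w)) ⟩
    average (λ w → gain n (w ▹ W) + ι D * reach D (w ▹ W)) W
      ≡⟨ trans (average-+ _ _ W) (+-congˡ (average (λ w → gain n (w ▹ W)) W) (average-*ˡ (ι D) (λ w → reach D (w ▹ W)) W)) ⟩
    average (λ w → gain n (w ▹ W)) W + ι D * average (λ w → reach D (w ▹ W)) W
      ≡⟨ cong (λ r → average (λ w → gain n (w ▹ W)) W + ι D * r) (reach-average-moving D W eq) ⟨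
    average (λ w → gain n (w ▹ W)) W + ι D * reach D W ∎
    where
    open ℚ.≤-Reasoning
    long′ : ∀ w → suc D ℕ.* h ℕ.< length (toList (w ▹ W)) ℕ.+ n
    long′ w = ℕ.<-≤-trans long (ℕ.≤-reflexive (trans (ℕ.+-suc _ n) (cong (ℕ._+ n) (sym (length-▹ w W)))))

  self-avoiding-unique : ∀ {s : Vertex h} {W} → SelfAvoiding s W → Unique (toList W)
  self-avoiding-unique start            = [] ∷ []
  self-avoiding-unique (step {v} {vs} {w} sa _ w∉) =
    All.tabulate (λ u∈ w≡u → w∉ (subst (_∈ v ∷ vs) (sym w≡u) u∈)) ∷ self-avoiding-unique sa

  start-∈ : ∀ {s : Vertex h} {W} → SelfAvoiding s W → s ∈ toList W
  start-∈ start         = here refl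
  start-∈ (step sa _ _) = there (start-∈ sa)

  -- The start lies in column 0, so the smallest column is 0 and only the largest one remains.
  displacement≡furthest : ∀ {y : Fin h} {W} → SelfAvoiding (0 , y) W → displacement W ≡ furthest (toList W)
  displacement≡furthest {y} {v@(x , _) ∷ vs} sa = cong₂ _∸_ max≡ min≡
    where
    xs = map proj₁ vs
    x⊔ : ∀ (L : List (Vertex h)) {m} → All (ℕ._≤ m) (map proj₁ L) → furthest L ℕ.≤ m
    x⊔ []      []         = ℕ.z≤n
    x⊔ (v ∷ L) (le ∷ les) = ℕ.⊔-lub le (x⊔ L les)
    max≡ : max x xs ≡ furthest (v ∷ vs)
    max≡ = ℕ.≤-antisym
      (max≤v⁺ {furthest (v ∷ vs)} {x} {xs} (ℕ.m≤m⊔n x (furthest vs))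
        (All.map⁺ (All.tabulate (λ u∈ → ℕ.≤-trans (furthest-∈ u∈) (ℕ.m≤n⊔m x (furthest vs))))))
      (ℕ.⊔-lub (v≤max⁺ {x} x xs (inj₁ ℕ.≤-refl)) (x⊔ vs (xs≤max x xs)))
    min≡ : min x xs ≡ 0
    min≡ with start-∈ sa
    ... | here refl = ℕ.n≤0⇒n≡0 (min≤⊤ x xs)
    ... | there s∈  = ℕ.n≤0⇒n≡0 (All.lookup (min≤xs x xs) (∈-map⁺ proj₁ s∈))

-- Convergence of the series from a certificate

archimedean : ∀ p → ∃[ n ] p < ι n
archimedean p@(mkℚ num d _) = suc ℤ.∣ num ∣ , ℚ.toℚᵘ-cancel-<
  (ℚᵘ.<-respʳ-≃ (ℚᵘ.≃-sym (ℚᵘ.≃-trans (ℚᵘ.≃-reflexive (cong toℚᵘ (ι≡ (suc ℤ.∣ num ∣)))) (ℚ.toℚᵘ-fromℚᵘ (ℚᵘ.mkℚᵘ (+ suc ℤ.∣ num ∣) 0)))) below)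
  where
  num≤ : ∀ i → i ℤ.≤ + ℤ.∣ i ∣
  num≤ (+ n)    = ℤ.≤-refl
  num≤ -[1+ n ] = ℤ.-≤+
  below : toℚᵘ p ℚᵘ.< ℚᵘ.mkℚᵘ (+ suc ℤ.∣ num ∣) 0
  below = ℚᵘ.*<* (begin-strict
    num ℤ.* + 1                         ≡⟨ ℤ.*-identityʳ num ⟩
    num                                 ≤⟨ num≤ num ⟩
    + ℤ.∣ num ∣                         <⟨ ℤ.+<+ (ℕ.n<1+n ℤ.∣ num ∣) ⟩
    + suc ℤ.∣ num ∣                     ≤⟨ ℤ.+≤+ (ℕ.m≤m*n (suc ℤ.∣ num ∣) (suc d)) ⟩
    + (suc ℤ.∣ num ∣ ℕ.* suc d)         ≡⟨ ℤ.pos-* (suc ℤ.∣ num ∣) (suc d) ⟩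
    + suc ℤ.∣ num ∣ ℤ.* + suc d         ∎)
    where open ℤ.≤-Reasoning

archimedean-* : ∀ p {ε} → 0ℚ < ε → ∃[ n ] p < ι n * ε
archimedean-* p {ε} 0<ε with n , lt ← archimedean (p * (1/ ε) {{ℚ.pos⇒nonZero ε {{ℚ.positive 0<ε}}}}) = n , (begin-strict
  p                    ≡⟨ trans (ℚ.*-assoc p _ ε) (trans (cong (p *_) (ℚ.*-inverseˡ ε {{ℚ.pos⇒nonZero ε {{ℚ.positive 0<ε}}}})) (ℚ.*-identityʳ p)) ⟨
  p * _ * ε            <⟨ ℚ.*-monoˡ-<-pos ε {{ℚ.positive 0<ε}} lt ⟩
  ι n * ε              ∎)
  where open ℚ.≤-Reasoning

0<ι-suc : ∀ n → 0ℚ < ι (suc n)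
0<ι-suc n = ℚ.≤-<-trans (0≤ι n) (begin-strict
  ι n            ≡⟨ ℚ.+-identityʳ (ι n) ⟨
  ι n + 0ℚ       <⟨ ℚ.+-monoʳ-< (ι n) (ℚ.positive⁻¹ 1ℚ) ⟩
  ι n + 1ℚ       ≡⟨ ι-suc n ⟨
  ι (suc n)      ∎)
  where open ℚ.≤-Reasoning

ι-cancel-≤ : ∀ n {p q} → ι (suc n) * p ≤ ι (suc n) * q → p ≤ q
ι-cancel-≤ n = ℚ.*-cancelˡ-≤-pos (ι (suc n)) {{ℚ.positive (0<ι-suc n)}}

ι-cancel-< : ∀ n {p q} → ι n * p < ι n * q → p < q
ι-cancel-< n = ℚ.*-cancelˡ-<-nonNeg (ι n) {{ℚ.nonNegative (0≤ι n)}}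

ι-mono-* : ∀ {m n p} → m ℕ.≤ n → 0ℚ ≤ p → ι m * p ≤ ι n * p
ι-mono-* {p = p} m≤n 0≤p = ℚ.*-monoʳ-≤-nonNeg p {{ℚ.nonNegative 0≤p}} (ι-mono-≤ m≤n)

E-cong-∈ : ∀ {A : Set} {f g : A → ℚ} ts → (∀ {d a} → (d , a) ∈ ts → f a ≡ g a) → E f ts ≡ E g ts
E-cong-∈ ts eq = ∑-cong-∈ ts (λ {(d , a)} t∈ → cong (1/ₙ d *_) (eq t∈))

E-mono-∈ : ∀ {A : Set} {f g : A → ℚ} ts → (∀ {d a} → (d , a) ∈ ts → f a ≤ g a) → E f ts ≤ E g ts
E-mono-∈ ts le = ∑-mono-∈ ts (λ {(d , a)} t∈ → *-monoˡ-0≤ (0≤1/ₙ d) (le t∈))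

∑<-∑ : ∀ {A : Set} n (g : ℕ → A → ℚ) xs → ∑< n (λ i → ∑ (g i) xs) ≡ ∑ (λ x → ∑< n (λ i → g i x)) xs
∑<-∑ zero    g xs = sym (∑-0 xs)
∑<-∑ (suc n) g xs = trans (cong (λ s → s + ∑ (g n) xs) (∑<-∑ n g xs)) (sym (∑-+ _ (g n) xs))

0≤q-p : ∀ {p q} → p ≤ q → 0ℚ ≤ q - p
0≤q-p {p} {q} p≤q = ℚ.≤-trans (ℚ.≤-reflexive (sym (ℚ.+-inverseʳ p))) (ℚ.+-monoˡ-≤ (- p) p≤q)

∣-∣-within : ∀ {a s δ ε} → a ≤ s → s ≤ a + δ → δ < ε → ℚ.∣ a - s ∣ < ε
∣-∣-within {a} {s} {δ} {ε} a≤s s≤a+δ δ<ε = begin-strict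
  ℚ.∣ a - s ∣          ≡⟨ ℚ.∣-p∣≡∣p∣ (a - s) ⟨
  ℚ.∣ - (a - s) ∣      ≡⟨ cong ℚ.∣_∣ (solve 2 (λ a s → :- (a :- s) := s :- a) refl a s) ⟩
  ℚ.∣ s - a ∣          ≡⟨ ℚ.0≤p⇒∣p∣≡p (0≤q-p a≤s) ⟩
  s - a              ≤⟨ ℚ.+-monoˡ-≤ (- a) s≤a+δ ⟩
  (a + δ) - a        ≡⟨ solve 2 (λ a d → (a :+ d) :- a := d) refl a δ ⟩
  δ                  <⟨ δ<ε ⟩
  ε                  ∎
  where open ℚ.≤-Reasoning

module _ {h : ℕ} where

  0≤-probability : ∀ (W : Walk h) → 0ℚ ≤ uniformProbability W
  0≤-probability (_ ∷ vs) = go vs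
    where
    go : ∀ (vs : List (Vertex h)) → 0ℚ ≤ stepProbabilities vs
    go []       = ℚ.≤-trans (0≤ι 1) (ℚ.≤-reflexive ι-1)
    go (v ∷ vs) = 0≤-* (0≤1/ₙ (unvisitedCount (v ∷ vs))) (go vs)

  image : Test h → Formal (Test h)
  image = compile ∅ ∅

  module _ (y : Fin h) where

    -- The coordinate of Tⁿ w at the test t. Applying `E` over `image t` is applying the row t of T,
    -- the transfer across an empty column with an empty column to its right; w contracts column 0,
    -- which holds only the start.
    arrival : ℕ → Test h → ℚ
    arrival zero    (r , P) = E (ι ∘ base) (walk (size (∅ [ y ]≔ true)) both (∅ [ y ]≔ true) y ∅ r P)
    arrival (suc n) t       = E (arrival n) (image t)

    0≤-arrival : ∀ n t → 0ℚ ≤ arrival n t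
    0≤-arrival zero    (r , P) = 0≤-E (0≤ι ∘ base) (walk (size (∅ [ y ]≔ true)) both (∅ [ y ]≔ true) y ∅ r P)
    0≤-arrival (suc n) t       = 0≤-E (0≤-arrival n) (image t)

    origin : Walk h
    origin = (0 , y) ∷ []

    exit : Fin h → Test h
    exit r = r , done anything

    occupied-0 : occupied ((0 , y) ∷ []) 0 ≡ ∅ [ y ]≔ true
    occupied-0 = trans (Visits.here-visited (visits [] 0 y)) (cong (_[ y ]≔ true) (occupied-[] 0))
      where
      occupied-[] : ∀ x → occupied {h} [] x ≡ ∅
      occupied-[] x = lookup-ext (λ y → trans (occupied-∉ {L = []} {x} {y} (λ ())) (sym (Vec.lookup-replicate y false)))

    occupied-suc : ∀ x → occupied ((0 , y) ∷ []) (suc x) ≡ ∅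
    occupied-suc x = lookup-ext (λ z → trans (occupied-∉ {L = (0 , y) ∷ []} {suc x} {z} λ { (here ()) ; (there ()) }) (sym (Vec.lookup-replicate z false)))

    -- To the right of column 0 everything is empty, so each `compile` inside `tests` is the same
    -- matrix T, and j of them raise the exponent by j.
    E-tests : ∀ occ c j i → (∀ x → occ (suc x) ≡ ∅) → E (arrival i) (tests occ c j) ≡ E (arrival (i ℕ.+ j)) initial
    E-tests occ c zero    i empty = cong (λ k → E (arrival k) initial) (sym (ℕ.+-identityʳ i))
    E-tests occ c (suc j) i empty = begin
      E (arrival i) (tests occ (suc c) j >>=ᶠ compile (occ (suc c)) (occ (suc (suc c))))
        ≡⟨ E->>= (arrival i) (compile (occ (suc c)) (occ (suc (suc c)))) (tests occ (suc c) j) ⟩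
      E (λ t → E (arrival i) (compile (occ (suc c)) (occ (suc (suc c))) t)) (tests occ (suc c) j)
        ≡⟨ E-cong (λ t → cong₂ (λ C m → E (arrival i) (compile C m t)) (empty c) (empty (suc c))) (tests occ (suc c) j) ⟩
      E (arrival (suc i)) (tests occ (suc c) j)
        ≡⟨ E-tests occ (suc c) j (suc i) empty ⟩
      E (arrival (suc i ℕ.+ j)) initial
        ≡⟨ cong (λ k → E (arrival k) initial) (sym (ℕ.+-suc i j)) ⟩
      E (arrival (i ℕ.+ suc j)) initial ∎
      where open ≡-Reasoning

    reach-origin : ∀ n → reach n origin ≡ ∑ (λ r → arrival n (exit r)) (allFin h)
    reach-origin n = begin
      reach n origin
        ≡⟨ reach-near (0 , y) [] ℕ.z≤n ⟩
      E (answer occ 0 y) (tests occ 0 n)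
        ≡⟨ E-cong (λ (r , P) → cong₂ (λ C m → E (ι ∘ base) (walk (size C) both C y m r P)) occupied-0 (occupied-suc 0)) (tests occ 0 n) ⟩
      E (arrival 0) (tests occ 0 n)
        ≡⟨ E-tests occ 0 n 0 occupied-suc ⟩
      E (arrival n) initial
        ≡⟨ ∑-map _ (λ r → 1 , exit r) (allFin h) ⟩
      ∑ (λ r → 1ℚ * arrival n (exit r)) (allFin h)
        ≡⟨ ∑-cong (λ r → ℚ.*-identityˡ _) (allFin h) ⟩
      ∑ (λ r → arrival n (exit r)) (allFin h) ∎
      where
      open ≡-Reasoning
      occ = occupied ((0 , y) ∷ [])

    -- `total` and `bound` are the vectors z and u. All conditions are restricted to a set of tests
    -- that contains the exits and is closed under T, which makes them finitely checkable. The
    -- constants 400 and 361 are the squares of 20 and 19.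
    record Certificate : Set₁ where
      field
        Reachable : Test h → Set
        exits-reachable : ∀ r → Reachable (exit r)
        image-reachable : ∀ {t d t′} → Reachable t → (d , t′) ∈ image t → Reachable t′
        total bound : Test h → ℚ
        0≤total       : ∀ t → 0ℚ ≤ total t
        total-fixed   : ∀ {t} → Reachable t → total t ≡ arrival 0 t + E total (image t)
        total≤bound   : ∀ {t} → Reachable t → total t ≤ bound t
        bound-shrinks : ∀ {t} → Reachable t → ι 400 * E bound (image t) ≤ ι 361 * bound t

    module _ (certificate : Certificate) where
      open Certificate certificate

      -- The vector Tⁿ z. By the fixed-point equation it is what remains of z after subtracting the
      -- first n terms Tⁱ w.
      rest : ℕ → Test h → ℚ
      rest zero    t = total t
      rest (suc n) t = E (rest n) (image t)

      0≤-rest : ∀ n t → 0ℚ ≤ rest n t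
      0≤-rest zero    t = 0≤total t
      0≤-rest (suc n) t = 0≤-E (0≤-rest n) (image t)

      rest-split : ∀ n {t} → Reachable t → rest n t ≡ arrival n t + rest (suc n) t
      rest-split zero    t∈ = total-fixed t∈
      rest-split (suc n) {t} t∈ = trans (E-cong-∈ (image t) (λ t′∈ → rest-split n (image-reachable t∈ t′∈)))
        (E-+ (arrival n) (rest (suc n)) (image t))

      total-split : ∀ n {t} → Reachable t → total t ≡ ∑< n (λ i → arrival i t) + rest n t
      total-split zero    t∈ = sym (ℚ.+-identityˡ _)
      total-split (suc n) {t} t∈ = trans (total-split n t∈) (trans (+-congˡ (∑< n (λ i → arrival i t)) (rest-split n t∈))
        (sym (ℚ.+-assoc (∑< n (λ i → arrival i t)) (arrival n t) (rest (suc n) t))))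

      -- 19 (n + 20) ≤ 20 (n + 19), so the factor 361 / 400 absorbs the growth of (n + 19)².
      decay : (g : ℕ → Test h → ℚ) → (∀ n t → 0ℚ ≤ g n t) → (∀ {t} → Reachable t → g 0 t ≤ bound t) →
              (∀ n t → g (suc n) t ≡ E (g n) (image t)) →
              ∀ n {t} → Reachable t → ι ((19 ℕ.+ n) ℕ.* (19 ℕ.+ n)) * g n t ≤ ι 361 * bound t
      decay g 0≤g g0 gs zero    t∈ = *-monoˡ-0≤ (0≤ι 361) (g0 t∈)
      decay g 0≤g g0 gs (suc n) {t} t∈ = ι-cancel-≤ 360 (begin
        ι 361 * (ι (b ℕ.* b) * g (suc n) t)
          ≡⟨ trans (sym (ℚ.*-assoc (ι 361) _ _)) (cong (_* g (suc n) t) (sym (ι-* 361 (b ℕ.* b)))) ⟩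
        ι (361 ℕ.* (b ℕ.* b)) * g (suc n) t
          ≤⟨ ι-mono-* (squares n) (0≤g (suc n) t) ⟩
        ι (400 ℕ.* (a ℕ.* a)) * g (suc n) t
          ≡⟨ trans (cong (_* g (suc n) t) (ι-* 400 (a ℕ.* a))) (ℚ.*-assoc (ι 400) _ _) ⟩
        ι 400 * (ι (a ℕ.* a) * g (suc n) t)
          ≡⟨ cong (ι 400 *_) (trans (cong (ι (a ℕ.* a) *_) (gs n t)) (sym (E-*ˡ (ι (a ℕ.* a)) (g n) (image t)))) ⟩
        ι 400 * E (λ t → ι (a ℕ.* a) * g n t) (image t)
          ≤⟨ *-monoˡ-0≤ (0≤ι 400) (E-mono-∈ (image t) (λ t′∈ → decay g 0≤g g0 gs n (image-reachable t∈ t′∈))) ⟩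
        ι 400 * E (λ t → ι 361 * bound t) (image t)
          ≡⟨ cong (ι 400 *_) (E-*ˡ (ι 361) bound (image t)) ⟩
        ι 400 * (ι 361 * E bound (image t))
          ≡⟨ solve 3 (λ a b x → a :* (b :* x) := b :* (a :* x)) refl (ι 400) (ι 361) (E bound (image t)) ⟩
        ι 361 * (ι 400 * E bound (image t))
          ≤⟨ *-monoˡ-0≤ (0≤ι 361) (bound-shrinks t∈) ⟩
        ι 361 * (ι 361 * bound t) ∎)
        where
        open ℚ.≤-Reasoning
        a = 19 ℕ.+ n
        b = 19 ℕ.+ suc n
        scaled : ∀ n → 19 ℕ.* (19 ℕ.+ suc n) ℕ.≤ 20 ℕ.* (19 ℕ.+ n)
        scaled n = ℕ.≤-trans (ℕ.≤-reflexive (trans (cong (19 ℕ.*_) (ℕ.+-suc 19 n)) (ℕ.*-distribˡ-+ 19 20 n)))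
          (ℕ.≤-trans (ℕ.+-monoʳ-≤ 380 (ℕ.*-monoˡ-≤ n {19} {20} (ℕ.n≤1+n 19))) (ℕ.≤-reflexive (sym (ℕ.*-distribˡ-+ 20 19 n))))
        squares : ∀ n → 361 ℕ.* ((19 ℕ.+ suc n) ℕ.* (19 ℕ.+ suc n)) ℕ.≤ 400 ℕ.* ((19 ℕ.+ n) ℕ.* (19 ℕ.+ n))
        squares n = ℕ.≤-trans (ℕ.≤-reflexive (ℕ.[m*n]*[o*p]≡[m*o]*[n*p] 19 19 (19 ℕ.+ suc n) (19 ℕ.+ suc n)))
          (ℕ.≤-trans (ℕ.*-mono-≤ (scaled n) (scaled n)) (ℕ.≤-reflexive (sym (ℕ.[m*n]*[o*p]≡[m*o]*[n*p] 20 20 (19 ℕ.+ n) (19 ℕ.+ n)))))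

      expected-displacement : ℚ
      expected-displacement = ∑ (λ r → total (exit r)) (allFin h)

      reach-sum : ℕ → ℚ
      reach-sum n = ∑< n (λ i → reach i origin)

      gap : ℕ → ℚ
      gap n = ∑ (λ r → rest n (exit r)) (allFin h)

      expected-split : ∀ n → expected-displacement ≡ reach-sum n + gap n
      expected-split n = begin
        ∑ (λ r → total (exit r)) (allFin h)
          ≡⟨ ∑-cong (λ r → total-split n (exits-reachable r)) (allFin h) ⟩
        ∑ (λ r → ∑< n (λ i → arrival i (exit r)) + rest n (exit r)) (allFin h)
          ≡⟨ ∑-+ (λ r → ∑< n (λ i → arrival i (exit r))) (λ r → rest n (exit r)) (allFin h) ⟩
        ∑ (λ r → ∑< n (λ i → arrival i (exit r))) (allFin h) + gap n
          ≡⟨ cong (λ s → s + gap n) (trans (∑<-cong n reach-origin) (∑<-∑ n (λ i r → arrival i (exit r)) (allFin h))) ⟨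
        reach-sum n + gap n ∎
        where open ≡-Reasoning

      exit-bound : ℚ
      exit-bound = ∑ (λ r → bound (exit r)) (allFin h)

      arrival≤bound : ∀ {t} → Reachable t → arrival 0 t ≤ bound t
      arrival≤bound {t} t∈ = begin
        arrival 0 t                        ≡⟨ ℚ.+-identityʳ _ ⟨
        arrival 0 t + 0ℚ                   ≤⟨ ℚ.+-monoʳ-≤ (arrival 0 t) (0≤-E 0≤total (image t)) ⟩
        arrival 0 t + E total (image t)    ≡⟨ total-fixed t∈ ⟨
        total t                            ≤⟨ total≤bound t∈ ⟩
        bound t                            ∎
        where open ℚ.≤-Reasoning

      exits-decay : (g : ℕ → Test h → ℚ) → (∀ n t → 0ℚ ≤ g n t) → (∀ {t} → Reachable t → g 0 t ≤ bound t) →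
                    (∀ n t → g (suc n) t ≡ E (g n) (image t)) →
                    ∀ n → ι ((19 ℕ.+ n) ℕ.* (19 ℕ.+ n)) * ∑ (λ r → g n (exit r)) (allFin h) ≤ ι 361 * exit-bound
      exits-decay g 0≤g g0 gs n = begin
        ι ((19 ℕ.+ n) ℕ.* (19 ℕ.+ n)) * ∑ (λ r → g n (exit r)) (allFin h)
          ≡⟨ ∑-*ˡ (ι ((19 ℕ.+ n) ℕ.* (19 ℕ.+ n))) (λ r → g n (exit r)) (allFin h) ⟨
        ∑ (λ r → ι ((19 ℕ.+ n) ℕ.* (19 ℕ.+ n)) * g n (exit r)) (allFin h)
          ≤⟨ ∑-mono-∈ (allFin h) (λ {r} _ → decay g 0≤g g0 gs n (exits-reachable r)) ⟩
        ∑ (λ r → ι 361 * bound (exit r)) (allFin h)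
          ≡⟨ ∑-*ˡ (ι 361) (λ r → bound (exit r)) (allFin h) ⟩
        ι 361 * exit-bound ∎
        where open ℚ.≤-Reasoning

      -- The two errors of the lower estimate: the layers from n on, and the loss of at most n on
      -- walks that pass column n.
      shortfall : ℕ → ℚ
      shortfall n = gap n + ι n * reach n origin

      -- Quadratic decay matters here: n times `reach n origin` still decays like 1 / n. One of the
      -- two factors n + 19 is cancelled against 1 + n, which counts one share for `gap n` and n
      -- shares for the second summand.
      shortfall-small : ∀ n → ι (19 ℕ.+ n) * shortfall n ≤ ι 361 * exit-bound
      shortfall-small n = ι-cancel-≤ (18 ℕ.+ n) (begin
        ι a * (ι a * (gap n + ι n * reach n origin))
          ≡⟨ solve 4 (λ a g n r → a :* (a :* (g :+ n :* r)) := (a :* a) :* g :+ n :* ((a :* a) :* r)) refl (ι a) (gap n) (ι n) (reach n origin) ⟩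
        (ι a * ι a) * gap n + ι n * ((ι a * ι a) * reach n origin)
          ≡⟨ cong (λ q → q * gap n + ι n * (q * reach n origin)) (ι-* a a) ⟨
        ι (a ℕ.* a) * gap n + ι n * (ι (a ℕ.* a) * reach n origin)
          ≤⟨ ℚ.+-mono-≤ (exits-decay rest 0≤-rest total≤bound (λ _ _ → refl) n)
               (*-monoˡ-0≤ (0≤ι n) (ℚ.≤-trans (ℚ.≤-reflexive (cong (ι (a ℕ.* a) *_) (reach-origin n)))
                 (exits-decay arrival 0≤-arrival arrival≤bound (λ _ _ → refl) n))) ⟩
        β + ι n * β
          ≡⟨ trans (cong (λ q → q + ι n * β) (sym (trans (cong (_* β) ι-1) (ℚ.*-identityˡ β)))) (trans (sym (ℚ.*-distribʳ-+ β (ι 1) (ι n))) (cong (_* β) (sym (ι-+ 1 n)))) ⟩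
        ι (suc n) * β
          ≤⟨ ι-mono-* (ℕ.s≤s (ℕ.m≤n+m n 18)) 0≤β ⟩
        ι a * β ∎)
        where
        open ℚ.≤-Reasoning
        a = 19 ℕ.+ n
        β = ι 361 * exit-bound
        0≤β : 0ℚ ≤ β
        0≤β = 0≤-* (0≤ι 361) (ℚ.≤-trans (0≤-∑ (λ r → 0≤total (exit r)) (allFin h)) (∑-mono-∈ (allFin h) (λ {r} _ → total≤bound (exits-reachable r))))

      shortfall-vanishes : ∀ {ε} → 0ℚ < ε → ∃[ n ] shortfall n < ε
      shortfall-vanishes {ε} 0<ε with n , lt ← archimedean-* (ι 361 * exit-bound) 0<ε =
        n , ι-cancel-< (19 ℕ.+ n) (ℚ.≤-<-trans (shortfall-small n) (ℚ.<-≤-trans lt (ι-mono-* (ℕ.m≤n+m n 19) (ℚ.<⇒≤ 0<ε))))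

      ∑-weight-origin : ∀ n → ∑ weight (gsaws n origin) ≡ gain n origin
      ∑-weight-origin n = trans (∑-weight-gsaws n origin) (ℚ.*-identityˡ (gain n origin))

      0≤-weight : ∀ W → 0ℚ ≤ weight W
      0≤-weight W = 0≤-* (0≤-probability W) (0≤ι (furthest (toList W)))

      longest : List (Walk h) → ℕ
      longest []             = 0
      longest ((_ ∷ vs) ∷ F) = length vs ⊔ longest F

      ∈-longest : ∀ {v : Vertex h} {vs F} → (v ∷ vs) ∈ F → length vs ℕ.≤ longest F
      ∈-longest {vs = vs} {_ ∷ F} (here refl) = ℕ.m≤m⊔n (length vs) (longest F)
      ∈-longest {F = (_ ∷ us) ∷ F} (there W∈)  = ℕ.≤-trans (∈-longest W∈) (ℕ.m≤n⊔m (length us) (longest F))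

      GSAWs-⊆ : ∀ {F} → All (GSAW (0 , y)) F → F ⊆ gsaws (longest F) origin
      GSAWs-⊆ {F} all {W@(v ∷ vs)} W∈ with sa , trap ← All.lookup all W∈ =
        subst (λ n → W ∈ gsaws n origin) (ℕ.m+[n∸m]≡n (∈-longest W∈))
          (gsaws-complete sa (longest F ∸ length vs) (trapped-∈-gsaws (longest F ∸ length vs) {W} trap))

      weighted : ∀ {F} → All (GSAW (0 , y)) F →
                 sumℚ (map (λ W → uniformProbability W * (+ displacement W ℚ./ 1)) F) ≡ ∑ weight F
      weighted {F} all = trans (∑-sumℚ _ F) (∑-cong-∈ F (λ {W} W∈ → cong (uniformProbability W *_)
        (trans (sym (ι≡ (displacement W))) (cong ι (displacement≡furthest (proj₁ (All.lookup all W∈)))))))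

      ∑-weight-≤ : ∀ {F} → Unique F → All (GSAW (0 , y)) F → ∑ weight F ≤ expected-displacement
      ∑-weight-≤ {F} F! all = begin
        ∑ weight F                        ≤⟨ ∑-⊆ 0≤-weight F! (GSAWs-⊆ all) ⟩
        ∑ weight (gsaws n origin)         ≡⟨ ∑-weight-origin n ⟩
        gain n origin                     ≤⟨ gain-≤ n n origin ℕ.≤-refl ⟩
        reach-sum n                       ≡⟨ ℚ.+-identityʳ _ ⟨
        reach-sum n + 0ℚ                  ≤⟨ ℚ.+-monoʳ-≤ (reach-sum n) (0≤-∑ (λ r → 0≤-rest n (exit r)) (allFin h)) ⟩
        reach-sum n + gap n               ≡⟨ expected-split n ⟨
        expected-displacement             ∎
        where
        open ℚ.≤-Reasoning
        n = longest F

      expected-≤ : ∀ n {F} → gsaws (suc n ℕ.* h) origin ⊆ F → expected-displacement ≤ ∑ weight F + shortfall n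
      expected-≤ n {F} ⊆F = begin
        expected-displacement
          ≡⟨ expected-split n ⟩
        reach-sum n + gap n
          -- The budget is exactly the area of the columns 0 to n; the one vertex of `origin`
          -- supplies the strict inequality that `gain-≥` asks for.
          ≤⟨ ℚ.+-monoˡ-≤ (gap n) (gain-≥ N n origin ([] ∷ []) ℕ.≤-refl) ⟩
        (gain N origin + ι n * reach n origin) + gap n
          ≡⟨ solve 3 (λ a b c → (a :+ b) :+ c := a :+ (c :+ b)) refl (gain N origin) (ι n * reach n origin) (gap n) ⟩
        gain N origin + shortfall n
          ≤⟨ ℚ.+-monoˡ-≤ (shortfall n) (ℚ.≤-trans (ℚ.≤-reflexive (sym (∑-weight-origin N))) (∑-⊆ 0≤-weight (gsaws! N origin) ⊆F)) ⟩
        ∑ weight F + shortfall n ∎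
        where
        open ℚ.≤-Reasoning
        N = suc n ℕ.* h

      close : ∀ {ε} n → shortfall n < ε → ∀ F → Unique F → All (GSAW (0 , y)) F → gsaws (suc n ℕ.* h) origin ⊆ F →
              ℚ.∣ sumℚ (map (λ W → uniformProbability W * (+ displacement W ℚ./ 1)) F) - expected-displacement ∣ < ε
      close {ε} n small F F! all ⊆F = ℚ.≤-<-trans (ℚ.≤-reflexive (cong (λ s → ℚ.∣ s - expected-displacement ∣) (weighted all)))
        (∣-∣-within (∑-weight-≤ F! all) (expected-≤ n ⊆F) small)

      gsaws-are-GSAWs : ∀ n → All (GSAW (0 , y)) (gsaws n origin)
      gsaws-are-GSAWs n = All.tabulate (λ G∈ → gsaws-sound n {origin} start G∈)

      displacement-hasSum : HasSum (GSAW (0 , y)) (λ W → uniformProbability W * (+ displacement W ℚ./ 1)) expected-displacement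
      displacement-hasSum ε 0<ε =
        gsaws N origin , gsaws! N origin , gsaws-are-GSAWs N , close (proj₁ n) (proj₂ n)
        where
        n = shortfall-vanishes 0<ε
        N = suc (proj₁ n) ℕ.* h

-- Certificates as finite tables, and their Boolean check

infix 4 _≟ᶜ_ _≟ˢ_ _≟ᵗ_

_≟ᶜ_ : DecidableEquality Condition
any       ≟ᶜ any       = yes refl
any       ≟ᶜ visited   = no λ ()
any       ≟ᶜ unvisited = no λ ()
any       ≟ᶜ never     = no λ ()
visited   ≟ᶜ any       = no λ ()
visited   ≟ᶜ visited   = yes refl
visited   ≟ᶜ unvisited = no λ ()
visited   ≟ᶜ never     = no λ ()
unvisited ≟ᶜ any       = no λ ()
unvisited ≟ᶜ visited   = no λ ()
unvisited ≟ᶜ unvisited = yes refl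
unvisited ≟ᶜ never     = no λ ()
never     ≟ᶜ any       = no λ ()
never     ≟ᶜ visited   = no λ ()
never     ≟ᶜ unvisited = no λ ()
never     ≟ᶜ never     = yes refl

_≟ˢ_ : ∀ {h} → DecidableEquality (Script h)
done qs ≟ˢ done qs′ = map′ (cong done) (λ { refl → refl }) (Vec.≡-dec _≟ᶜ_ qs qs′)
done _ ≟ˢ enter _ _ _ _ _ = no λ ()
enter _ _ _ _ _ ≟ˢ done _ = no λ ()
enter qs s m r P ≟ˢ enter qs′ s′ m′ r′ P′ = map′
  (λ { (refl , refl , refl , refl , refl) → refl }) (λ { refl → refl , refl , refl , refl , refl })
  (Vec.≡-dec _≟ᶜ_ qs qs′ ×-dec s Fin.≟ s′ ×-dec Vec.≡-dec Bool._≟_ m m′ ×-dec r Fin.≟ r′ ×-dec P ≟ˢ P′)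

_≟ᵗ_ : ∀ {h} → DecidableEquality (Test h)
_≟ᵗ_ = ≡-dec Fin._≟_ _≟ˢ_

digits : ∀ {n} → Column n → ℕ
digits []      = 0
digits (b ∷ C) = [ b ]ᵇ ℕ.+ 2 ℕ.* digits C

conditionDigit : Condition → ℕ
conditionDigit any       = 0
conditionDigit visited   = 1
conditionDigit unvisited = 2
conditionDigit never     = 3

conditionDigits : ∀ {n} → Vec Condition n → ℕ
conditionDigits []       = 0
conditionDigits (q ∷ qs) = conditionDigit q ℕ.+ 4 ℕ.* conditionDigits qs

-- The radices 32 = 2⁵ and 1024 = 4⁵ leave room for columns and condition vectors of height up to 5.
scriptCode : ∀ {h} → Script h → ℕ
scriptCode (done qs)          = 1 ℕ.+ 1024 ℕ.* conditionDigits qs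
scriptCode (enter qs s m r P) =
  2 ℕ.+ toℕ s ℕ.+ 32 ℕ.* (digits m ℕ.+ 32 ℕ.* (toℕ r ℕ.+ 32 ℕ.* (conditionDigits qs ℕ.+ 1024 ℕ.* scriptCode P)))

-- Only a search key: injectivity is not needed, since contains compares tests.
code : ∀ {h} → Test h → ℕ
code (r , P) = toℕ r ℕ.+ 32 ℕ.* scriptCode P

data Dictionary (A : Set) : Set where
  leaf : Dictionary A
  node : ℕ → A → Dictionary A → Dictionary A → Dictionary A

∧-true : ∀ {a b} → a ∧ b ≡ true → a ≡ true × b ≡ true
∧-true {true} {true} refl = refl , refl

module _ {A : Set} where

  search : ℕ → Dictionary A → Maybe A
  search k leaf = nothing
  search k (node k′ a l r) = if k ℕ.≡ᵇ k′ then just a else if k ℕ.<ᵇ k′ then search k l else search k r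

  insert : ℕ → A → Dictionary A → Dictionary A
  insert k a leaf = node k a leaf leaf
  insert k a (node k′ a′ l r) =
    if k ℕ.<ᵇ k′ then node k′ a′ (insert k a l) r else node k′ a′ l (insert k a r)

  every : (A → Bool) → Dictionary A → Bool
  every p leaf           = true
  every p (node _ a l r) = p a ∧ (every p l ∧ every p r)

  -- True for every tree, ordered or not: `search` returns only entries stored at some node, and
  -- `every` visits all nodes.
  search-every : ∀ p k D {a} → search k D ≡ just a → every p D ≡ true → p a ≡ true
  search-every p k (node k′ a′ l r) eq all with all-a , all-lr ← ∧-true {p a′} all with all-l , all-r ← ∧-true {every p l} all-lr
    with k ℕ.≡ᵇ k′ | k ℕ.<ᵇ k′
  search-every p k (node k′ a′ l r) refl all | true  | _     = all-a
  search-every p k (node k′ a′ l r) eq   all | false | true  = search-every p k l eq all-l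
  search-every p k (node k′ a′ l r) eq   all | false | false = search-every p k r eq all-r

-- The value at d = 0 is never used: such a d fails the test in divides.
quotient : ℕ → ℕ → ℕ
quotient L zero    = 0
quotient L (suc d) = L ℕ./ suc d

divides : ∀ {A : Set} → ℕ → Formal A → Bool
divides L = all (λ (d , _) → quotient L d ℕ.* d ℕ.≡ᵇ L)

-- Clearing the denominators by a common multiple `L` keeps the whole check within natural numbers,
-- away from the normalisation of rationals.
scaledSum : ∀ {A : Set} → ℕ → (A → ℕ) → Formal A → ℕ
scaledSum L g ts = sum (map (λ (d , a) → quotient L d ℕ.* g a) ts)

≡ᵇ-sound : ∀ m n → (m ℕ.≡ᵇ n) ≡ true → m ≡ n
≡ᵇ-sound m n eq = ℕ.≡ᵇ⇒≡ m n (subst T (sym eq) _)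

≤ᵇ-sound : ∀ m n → (m ℕ.≤ᵇ n) ≡ true → m ℕ.≤ n
≤ᵇ-sound m n eq = ℕ.≤ᵇ⇒≤ m n (subst T (sym eq) _)

ι-scaledSum : ∀ {A : Set} L (g : A → ℕ) ts → divides (suc L) ts ≡ true →
              ι (scaledSum (suc L) g ts) ≡ ι (suc L) * E (ι ∘ g) ts
ι-scaledSum L g []               _   = trans ι-0 (sym (ℚ.*-zeroʳ (ι (suc L))))
ι-scaledSum L g ((zero , a) ∷ ts) ()
ι-scaledSum L g ((d@(suc d-1) , a) ∷ ts) eq with eq-d , eq-ts ← ∧-true {quotient (suc L) d ℕ.* d ℕ.≡ᵇ suc L} eq = begin
  ι (q ℕ.* g a ℕ.+ scaledSum (suc L) g ts)
    ≡⟨ trans (ι-+ (q ℕ.* g a) _) (cong₂ _+_ (ι-* q (g a)) (ι-scaledSum L g ts eq-ts)) ⟩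
  ι q * ι (g a) + ι (suc L) * E (ι ∘ g) ts
    ≡⟨ cong (λ s → s + ι (suc L) * E (ι ∘ g) ts) head ⟩
  ι (suc L) * (1/ₙ d * ι (g a)) + ι (suc L) * E (ι ∘ g) ts
    ≡⟨ ℚ.*-distribˡ-+ (ι (suc L)) _ _ ⟨
  ι (suc L) * E (ι ∘ g) ((d , a) ∷ ts) ∎
  where
  open ≡-Reasoning
  q = quotient (suc L) d
  head : ι q * ι (g a) ≡ ι (suc L) * (1/ₙ d * ι (g a))
  head = begin
    ι q * ι (g a)                          ≡⟨ cong (ι q *_) (trans (cong (_* ι (g a)) (1/ₙ-inverse d-1)) (ℚ.*-identityˡ _)) ⟨
    ι q * ((ι d * 1/ₙ d) * ι (g a))        ≡⟨ solve 4 (λ q d e x → q :* ((d :* e) :* x) := (q :* d) :* (e :* x)) refl (ι q) (ι d) (1/ₙ d) (ι (g a)) ⟩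
    (ι q * ι d) * (1/ₙ d * ι (g a))        ≡⟨ cong (_* (1/ₙ d * ι (g a))) (trans (sym (ι-* q d)) (cong ι (≡ᵇ-sound (q ℕ.* d) (suc L) eq-d))) ⟩
    ι (suc L) * (1/ₙ d * ι (g a))          ∎

module _ {h : ℕ} where

  Entry : Set
  Entry = Test h × ℕ × ℕ

  -- Breadth-first enumeration of the reachable tests, which receive the given values in
  -- the order in which they are met.
  label  : ℕ → List (Test h) → List (ℕ × ℕ) → Dictionary Entry → Dictionary Entry
  absorb : ℕ → Formal (Test h) → List (Test h) → List (Test h) → List (ℕ × ℕ) → Dictionary Entry → Dictionary Entry

  label zero    _       vs D = D
  label (suc n) []      vs D = D
  label (suc n) (t ∷ q) vs D = absorb n (image t) q [] vs D

  absorb n []             q new vs       D = label n (q ++ reverse new) vs D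
  absorb n (_ ∷ _)        q new []       D = D
  absorb n ((_ , t) ∷ ts) q new (v ∷ vs) D =
    if is-nothing (search (code t) D)
      then absorb n ts q (t ∷ new) vs (insert (code t) (t , v) D)
      else absorb n ts q new (v ∷ vs) D

  -- Only a proposal, whose closure under T is tested afterwards by `check`. The fuel is one unit
  -- for each test taken from the queue, hence one for each table entry.
  dictionary : List (ℕ × ℕ) → Dictionary Entry
  dictionary vs = absorb (length vs) initial [] [] vs leaf

  module _ (D : Dictionary Entry) where

    contains : Test h → Bool
    contains t = maybe′ (λ (t′ , _) → does (t′ ≟ᵗ t)) false (search (code t) D)

    totalOf boundOf : Test h → ℕ
    totalOf t = maybe′ (λ (_ , z , _) → z) 0 (search (code t) D)
    boundOf t = maybe′ (λ (_ , _ , u) → u) 0 (search (code t) D)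

    module _ (y : Fin h) (den L : ℕ) where

      opening : Test h → Formal (Script h)
      opening (r , P) = walk (size (∅ [ y ]≔ true)) both (∅ [ y ]≔ true) y ∅ r P

      -- The coordinate t of the certificate with z = `totalOf` / `den`: the equation z = w + T z is
      -- multiplied by `L` and `den`, the inequality 400 T u ≤ 361 u by `L`, and z ≤ u by `den`.
      -- Closure under T and the divisibility that makes `scaledSum` exact come first.
      checkRow : Test h → Formal (Test h) → Formal (Script h) → Bool
      checkRow t ts us =
        all (λ (_ , t′) → contains t′) ts ∧ (divides L ts ∧ (divides L us ∧
        ((L ℕ.* totalOf t ℕ.≡ᵇ den ℕ.* scaledSum L base us ℕ.+ scaledSum L totalOf ts) ∧
        ((400 ℕ.* scaledSum L boundOf ts ℕ.≤ᵇ 361 ℕ.* (L ℕ.* boundOf t)) ∧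
        (totalOf t ℕ.≤ᵇ den ℕ.* boundOf t)))))

      checkEntry : Entry → Bool
      checkEntry (t , _) = checkRow t (image t) (opening t)

      check : ℕ → Bool
      check num = every checkEntry D ∧
        (all (λ r → contains (exit y r)) (allFin h) ∧ (sum (map (λ r → totalOf (exit y r)) (allFin h)) ℕ.≡ᵇ num))

all-∈ : ∀ {A : Set} (p : A → Bool) {xs x} → all p xs ≡ true → x ∈ xs → p x ≡ true
all-∈ p eq (here refl) = proj₁ (∧-true eq)
all-∈ p {x ∷ xs} eq (there x∈) = all-∈ p (proj₂ (∧-true {p x} eq)) x∈

contained : ∀ {h} {t : Test h} (found : Maybe (Test h × ℕ × ℕ)) →
            maybe′ (λ (t′ , _) → does (t′ ≟ᵗ t)) false found ≡ true → ∃[ e ] found ≡ just (t , e)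
contained {t = t} (just (t′ , e)) eq = by-decision (t′ ≟ᵗ t) eq
  where
  by-decision : (d : Dec (t′ ≡ t)) → does d ≡ true → ∃[ e′ ] just (t′ , e) ≡ just (t , e′)
  by-decision (yes refl) _ = e , refl

module _ {h : ℕ} (D : Dictionary (Entry {h})) (y : Fin h) (den-1 L-1 num : ℕ)
         (checked : check D y (suc den-1) (suc L-1) num ≡ true) where

  den L : ℕ
  den = suc den-1
  L   = suc L-1

  contains-checked : ∀ t → contains D t ≡ true → checkRow D y den L t (image t) (opening D y den L t) ≡ true
  contains-checked t t∈ = search-every (checkEntry D y den L) (code t) D {t , proj₁ found} (proj₂ found) (proj₁ (∧-true checked))
    where
    found = contained (search (code t) D) t∈

  module Row {t : Test h} (t∈ : contains D t ≡ true) where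
    ts = image t
    us = opening D y den L t

    facts = contains-checked t t∈
    facts₁ = ∧-true {all (λ (_ , t′) → contains D t′) ts} facts
    facts₂ = ∧-true {divides L ts} (proj₂ facts₁)
    facts₃ = ∧-true {divides L us} (proj₂ facts₂)
    facts₄ = ∧-true {L ℕ.* totalOf D t ℕ.≡ᵇ den ℕ.* scaledSum L base us ℕ.+ scaledSum L (totalOf D) ts} (proj₂ facts₃)
    facts₅ = ∧-true {400 ℕ.* scaledSum L (boundOf D) ts ℕ.≤ᵇ 361 ℕ.* (L ℕ.* boundOf D t)} (proj₂ facts₄)

    successors : ∀ {d t′} → (d , t′) ∈ ts → contains D t′ ≡ true
    successors = all-∈ (λ (_ , t′) → contains D t′) (proj₁ facts₁)

    totals : ι (totalOf D t) ≡ ι den * E (ι ∘ base) us + E (ι ∘ totalOf D) ts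
    totals = ι-cancel L-1 (begin
      ι L * ι (totalOf D t)
        ≡⟨ ι-* L (totalOf D t) ⟨
      ι (L ℕ.* totalOf D t)
        ≡⟨ cong ι (≡ᵇ-sound (L ℕ.* totalOf D t) _ (proj₁ facts₄)) ⟩
      ι (den ℕ.* scaledSum L base us ℕ.+ scaledSum L (totalOf D) ts)
        ≡⟨ trans (ι-+ (den ℕ.* scaledSum L base us) _) (cong₂ _+_ (ι-* den (scaledSum L base us)) refl) ⟩
      ι den * ι (scaledSum L base us) + ι (scaledSum L (totalOf D) ts)
        ≡⟨ cong₂ (λ p q → ι den * p + q) (ι-scaledSum L-1 base us (proj₁ facts₃)) (ι-scaledSum L-1 (totalOf D) ts (proj₁ facts₂)) ⟩
      ι den * (ι L * E (ι ∘ base) us) + ι L * E (ι ∘ totalOf D) ts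
        ≡⟨ solve 4 (λ d l a b → d :* (l :* a) :+ l :* b := l :* (d :* a :+ b)) refl (ι den) (ι L) (E (ι ∘ base) us) (E (ι ∘ totalOf D) ts) ⟩
      ι L * (ι den * E (ι ∘ base) us + E (ι ∘ totalOf D) ts) ∎)
      where
      open ≡-Reasoning
      ι-cancel : ∀ n {p q} → ι (suc n) * p ≡ ι (suc n) * q → p ≡ q
      ι-cancel n eq = ℚ.≤-antisym (ι-cancel-≤ n (ℚ.≤-reflexive eq)) (ι-cancel-≤ n (ℚ.≤-reflexive (sym eq)))

    bounds : ι 400 * E (ι ∘ boundOf D) ts ≤ ι 361 * ι (boundOf D t)
    bounds = ι-cancel-≤ L-1 (begin
      ι L * (ι 400 * E (ι ∘ boundOf D) ts)
        ≡⟨ solve 3 (λ l a e → l :* (a :* e) := a :* (l :* e)) refl (ι L) (ι 400) (E (ι ∘ boundOf D) ts) ⟩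
      ι 400 * (ι L * E (ι ∘ boundOf D) ts)
        ≡⟨ trans (ι-* 400 (scaledSum L (boundOf D) ts)) (cong (ι 400 *_) (ι-scaledSum L-1 (boundOf D) ts (proj₁ facts₂))) ⟨
      ι (400 ℕ.* scaledSum L (boundOf D) ts)
        ≤⟨ ι-mono-≤ (≤ᵇ-sound (400 ℕ.* scaledSum L (boundOf D) ts) _ (proj₁ facts₅)) ⟩
      ι (361 ℕ.* (L ℕ.* boundOf D t))
        ≡⟨ trans (ι-* 361 (L ℕ.* boundOf D t)) (cong (ι 361 *_) (ι-* L (boundOf D t))) ⟩
      ι 361 * (ι L * ι (boundOf D t))
        ≡⟨ solve 3 (λ l a e → a :* (l :* e) := l :* (a :* e)) refl (ι L) (ι 361) (ι (boundOf D t)) ⟩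
      ι L * (ι 361 * ι (boundOf D t)) ∎)
      where open ℚ.≤-Reasoning

    total≤ : ι (totalOf D t) * 1/ₙ den ≤ ι (boundOf D t)
    total≤ = begin
      ι (totalOf D t) * 1/ₙ den
        ≤⟨ ℚ.*-monoʳ-≤-nonNeg (1/ₙ den) {{ℚ.nonNegative (0≤1/ₙ den)}} (ι-mono-≤ (≤ᵇ-sound (totalOf D t) _ (proj₂ facts₅))) ⟩
      ι (den ℕ.* boundOf D t) * 1/ₙ den
        ≡⟨ cong (_* 1/ₙ den) (ι-* den (boundOf D t)) ⟩
      (ι den * ι (boundOf D t)) * 1/ₙ den
        ≡⟨ solve 3 (λ d b e → (d :* b) :* e := (d :* e) :* b) refl (ι den) (ι (boundOf D t)) (1/ₙ den) ⟩
      (ι den * 1/ₙ den) * ι (boundOf D t)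
        ≡⟨ trans (cong (_* ι (boundOf D t)) (1/ₙ-inverse den-1)) (ℚ.*-identityˡ _) ⟩
      ι (boundOf D t) ∎
      where open ℚ.≤-Reasoning

    total-fixed : ι (totalOf D t) * 1/ₙ den ≡ arrival y 0 t + E (λ t → ι (totalOf D t) * 1/ₙ den) ts
    total-fixed = begin
      ι (totalOf D t) * 1/ₙ den
        ≡⟨ cong (_* 1/ₙ den) totals ⟩
      (ι den * arrival y 0 t + E (ι ∘ totalOf D) ts) * 1/ₙ den
        ≡⟨ solve 4 (λ d a b e → (d :* a :+ b) :* e := (d :* e) :* a :+ e :* b) refl (ι den) (arrival y 0 t) (E (ι ∘ totalOf D) ts) (1/ₙ den) ⟩
      (ι den * 1/ₙ den) * arrival y 0 t + 1/ₙ den * E (ι ∘ totalOf D) ts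
        ≡⟨ cong₂ _+_ (trans (cong (_* arrival y 0 t) (1/ₙ-inverse den-1)) (ℚ.*-identityˡ (arrival y 0 t)))
             (trans (sym (E-*ˡ (1/ₙ den) (ι ∘ totalOf D) ts)) (E-cong (λ t → ℚ.*-comm (1/ₙ den) (ι (totalOf D t))) ts)) ⟩
      arrival y 0 t + E (λ t → ι (totalOf D t) * 1/ₙ den) ts ∎
      where open ≡-Reasoning

  exit-facts : all (λ r → contains D (exit y r)) (allFin h) ≡ true × sum (map (λ r → totalOf D (exit y r)) (allFin h)) ≡ num
  exit-facts = map₂ (≡ᵇ-sound (sum (map (λ r → totalOf D (exit y r)) (allFin h))) num)
    (∧-true {all (λ r → contains D (exit y r)) (allFin h)} (proj₂ (∧-true {every (checkEntry D y den L) D} checked)))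

  certificate : Certificate y
  certificate = record
    { Reachable       = λ t → contains D t ≡ true
    ; exits-reachable = λ r → all-∈ (λ r → contains D (exit y r)) (proj₁ exit-facts) (∈-allFin r)
    ; image-reachable = λ t∈ → Row.successors t∈
    ; total           = λ t → ι (totalOf D t) * 1/ₙ den
    ; bound           = λ t → ι (boundOf D t)
    ; 0≤total         = λ t → 0≤-* (0≤ι (totalOf D t)) (0≤1/ₙ den)
    ; total-fixed     = λ t∈ → Row.total-fixed t∈
    ; total≤bound     = λ t∈ → Row.total≤ t∈
    ; bound-shrinks   = λ t∈ → Row.bounds t∈
    }

  ∑-ι : ∀ {A : Set} (g : A → ℕ) c xs → ∑ (λ x → ι (g x) * c) xs ≡ ι (sum (map g xs)) * c
  ∑-ι g c []       = sym (trans (cong (_* c) ι-0) (ℚ.*-zeroˡ c))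
  ∑-ι g c (x ∷ xs) = trans (+-congˡ (ι (g x) * c) (∑-ι g c xs))
    (trans (sym (ℚ.*-distribʳ-+ c (ι (g x)) _)) (cong (_* c) (sym (ι-+ (g x) _))))

  expected-value : expected-displacement y certificate ≡ ι num * 1/ₙ den
  expected-value = trans (∑-ι (λ r → totalOf D (exit y r)) (1/ₙ den) (allFin h)) (cong (λ n → ι n * 1/ₙ den) (proj₂ exit-facts))

  checked-hasSum : HasSum (GSAW (0 , y)) (λ W → uniformProbability W * (+ displacement W ℚ./ 1)) (ι num * 1/ₙ den)
  checked-hasSum = subst (HasSum (GSAW (0 , y)) (λ W → uniformProbability W * (+ displacement W ℚ./ 1))) expected-value
    (displacement-hasSum y certificate)

-- Fractions and rounding reduced to relations between natural numbers

opaque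
  unfolding ι

  ι*1/ₙ : ∀ a d → ι a * 1/ₙ (suc d) ≡ + a ℚ./ suc d
  ι*1/ₙ a d = ℚ.toℚᵘ-injective (begin
    toℚᵘ (ι a * 1/ₙ (suc d))                 ≈⟨ ℚ.toℚᵘ-homo-* (ι a) (1/ₙ (suc d)) ⟩
    toℚᵘ (ι a) ℚᵘ.* toℚᵘ (1/ₙ (suc d))       ≈⟨ ℚᵘ.*-cong (ℚ.toℚᵘ-fromℚᵘ (ιᵘ a)) (ℚ.toℚᵘ-fromℚᵘ (ℚᵘ.mkℚᵘ (+ 1) d)) ⟩
    ιᵘ a ℚᵘ.* ℚᵘ.mkℚᵘ (+ 1) d                ≈⟨ ℚᵘ.*≡* (cong₂ ℤ._*_ (ℤ.*-identityʳ (+ a)) (cong +_ (sym (ℕ.+-identityʳ (suc d))))) ⟩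
    ℚᵘ.mkℚᵘ (+ a) d                          ≈⟨ ℚ.toℚᵘ-fromℚᵘ (ℚᵘ.mkℚᵘ (+ a) d) ⟨
    toℚᵘ (+ a ℚ./ suc d)                     ∎)
    where open import Relation.Binary.Reasoning.Setoid ℚᵘ.≃-setoid

  ι≤⇒ : ∀ k x → ι k ≤ x → + (k ℕ.* ↧ₙ x) ℤ.≤ ↥ x
  ι≤⇒ k x@(mkℚ n d _) le with ℚᵘ.*≤* le′ ← ℚᵘ.≤-respˡ-≃ (ℚ.toℚᵘ-fromℚᵘ (ιᵘ k)) (ℚ.toℚᵘ-mono-≤ le) =
    ℤ.≤-trans (ℤ.≤-reflexive (ℤ.pos-* k (suc d))) (ℤ.≤-trans le′ (ℤ.≤-reflexive (ℤ.*-identityʳ n)))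

  <ι⇒ : ∀ k x → x < ι k → ↥ x ℤ.< + (k ℕ.* ↧ₙ x)
  <ι⇒ k x@(mkℚ n d _) lt with ℚᵘ.*<* lt′ ← ℚᵘ.<-respʳ-≃ (ℚ.toℚᵘ-fromℚᵘ (ιᵘ k)) (ℚ.toℚᵘ-mono-< lt) =
    ℤ.≤-<-trans (ℤ.≤-reflexive (sym (ℤ.*-identityʳ n))) (ℤ.<-≤-trans lt′ (ℤ.≤-reflexive (sym (ℤ.pos-* k (suc d)))))

-- Cross multiplication on unnormalised fractions, so that no gcd of the large numbers is computed.
fraction-≡ : ∀ a d p q → a ℕ.* suc q ≡ p ℕ.* suc d → ι a * 1/ₙ (suc d) ≡ + p ℚ./ suc q
fraction-≡ a d p q eq = trans (ι*1/ₙ a d) (ℚ.fromℚᵘ-cong {ℚᵘ.mkℚᵘ (+ a) d} {ℚᵘ.mkℚᵘ (+ p) q}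
  (ℚᵘ.*≡* (trans (sym (ℤ.pos-* a (suc q))) (trans (cong +_ eq) (ℤ.pos-* p (suc d))))))

floor-unique : ∀ x k → ι k ≤ x → x < ι (suc k) → floor x ≡ + k
floor-unique x@(mkℚ (-[1+ n ]) d _) k le lt with () ← ι≤⇒ k x le
floor-unique x@(mkℚ (+ n) d _) k le lt = trans (ℤ.*-identityˡ (+ (n ℕ./ suc d))) (cong +_ (ℕ.≤-antisym
  (ℕ.≤-pred (ℕ.m<n*o⇒m/o<n {n} {suc k} {suc d} (ℤ.drop‿+<+ (<ι⇒ (suc k) x lt))))
  (ℕ.≤-trans (ℕ.≤-reflexive (sym (ℕ.m*n/n≡m k (suc d)))) (ℕ./-monoˡ-≤ (suc d) (ℤ.drop‿+≤+ (ι≤⇒ k x le))))))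

if-false : ∀ {A : Set} {b} {p q : A} → b ≢ true → (if b then p else q) ≡ q
if-false {b = true}  b≢ = contradiction refl b≢
if-false {b = false} b≢ = refl

-- The hypotheses say k + 1/2 ≤ a / (d + 1) < k + 3/2, cleared of denominators. For a positive
-- argument `round` takes the floor after adding 1/2; writing the result as `suc k` forces
-- positivity, because then 1 ≤ x + 1/2.
round-≡ : ∀ a d k → suc (2 ℕ.* k) ℕ.* suc d ℕ.≤ 2 ℕ.* a → 2 ℕ.* a ℕ.< suc (2 ℕ.* suc k) ℕ.* suc d →
          round (ι a * 1/ₙ (suc d)) ≡ + suc k
round-≡ a d k low high = trans (if-false not-negative) (floor-unique (x + ½) (suc k) lower upper)
  where
  x = ι a * 1/ₙ (suc d)
  D = suc d

  doubled : ι (2 ℕ.* D) * (x + ½) ≡ ι (2 ℕ.* a ℕ.+ D)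
  doubled = begin
    ι (2 ℕ.* D) * (ι a * 1/ₙ D + ½)
      ≡⟨ cong (_* (x + ½)) (ι-* 2 D) ⟩
    (ι 2 * ι D) * (ι a * 1/ₙ D + ½)
      ≡⟨ solve 5 (λ t d a e h → (t :* d) :* (a :* e :+ h) := (t :* a) :* (d :* e) :+ (t :* h) :* d) refl (ι 2) (ι D) (ι a) (1/ₙ D) ½ ⟩
    (ι 2 * ι a) * (ι D * 1/ₙ D) + (ι 2 * ½) * ι D
      ≡⟨ cong₂ _+_ (trans (cong₂ _*_ (sym (ι-* 2 a)) (1/ₙ-inverse d)) (ℚ.*-identityʳ (ι (2 ℕ.* a))))
                   (trans (cong (_* ι D) twice-half) (ℚ.*-identityˡ (ι D))) ⟩
    ι (2 ℕ.* a) + ι D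
      ≡⟨ ι-+ (2 ℕ.* a) D ⟨
    ι (2 ℕ.* a ℕ.+ D) ∎
    where
    open ≡-Reasoning
    twice-half : ι 2 * ½ ≡ 1ℚ
    twice-half = trans (cong (_* ½) (trans (ι-+ 1 1) (cong₂ _+_ ι-1 ι-1))) refl

  odd : ∀ k → 2 ℕ.* D ℕ.* suc k ≡ suc (2 ℕ.* k) ℕ.* D ℕ.+ D
  odd k = begin
    2 ℕ.* D ℕ.* suc k              ≡⟨ ℕ.*-comm (2 ℕ.* D) (suc k) ⟩
    suc k ℕ.* (2 ℕ.* D)            ≡⟨ ℕ.*-assoc (suc k) 2 D ⟨
    suc k ℕ.* 2 ℕ.* D              ≡⟨ cong (λ m → suc (suc m) ℕ.* D) (ℕ.*-comm k 2) ⟩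
    D ℕ.+ suc (2 ℕ.* k) ℕ.* D      ≡⟨ ℕ.+-comm D _ ⟩
    suc (2 ℕ.* k) ℕ.* D ℕ.+ D      ∎
    where open ≡-Reasoning

  lower : ι (suc k) ≤ x + ½
  lower = ι-cancel-≤ (d ℕ.+ suc (d ℕ.+ 0)) (begin
    ι (2 ℕ.* D) * ι (suc k)      ≡⟨ ι-* (2 ℕ.* D) (suc k) ⟨
    ι (2 ℕ.* D ℕ.* suc k)        ≤⟨ ι-mono-≤ (ℕ.≤-trans (ℕ.≤-reflexive (odd k)) (ℕ.+-monoˡ-≤ D low)) ⟩
    ι (2 ℕ.* a ℕ.+ D)            ≡⟨ doubled ⟨
    ι (2 ℕ.* D) * (x + ½)        ∎)
    where open ℚ.≤-Reasoning

  upper : x + ½ < ι (suc (suc k))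
  upper = ι-cancel-< (2 ℕ.* D) (begin-strict
    ι (2 ℕ.* D) * (x + ½)              ≡⟨ doubled ⟩
    ι (2 ℕ.* a ℕ.+ D)                  <⟨ ι-mono-< (ℕ.<-≤-trans (ℕ.+-monoˡ-< D high) (ℕ.≤-reflexive (sym (odd (suc k))))) ⟩
    ι (2 ℕ.* D ℕ.* suc (suc k))        ≡⟨ ι-* (2 ℕ.* D) (suc (suc k)) ⟩
    ι (2 ℕ.* D) * ι (suc (suc k))      ∎)
    where
    open ℚ.≤-Reasoning
    ι-mono-< : ∀ {m n} → m ℕ.< n → ι m < ι n
    ι-mono-< {m} m<n = ℚ.<-≤-trans (ℚ.<-respʳ-≡ (sym (ι-suc m)) (ℚ.<-respˡ-≡ (ℚ.+-identityʳ (ι m)) (ℚ.+-monoʳ-< (ι m) (ℚ.positive⁻¹ 1ℚ)))) (ι-mono-≤ m<n)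

  not-negative : (x ≤ᵇ 0ℚ) ≢ true
  not-negative eq = ℚ.<-irrefl refl (begin-strict
    ½              <⟨ half<1 ⟩
    1ℚ             ≡⟨ ι-1 ⟨
    ι 1            ≤⟨ ι-mono-≤ (ℕ.s≤s ℕ.z≤n) ⟩
    ι (suc k)      ≤⟨ lower ⟩
    x + ½          ≤⟨ ℚ.+-monoˡ-≤ ½ (ℚ.≤ᵇ⇒≤ {x} {0ℚ} (subst T (sym eq) _)) ⟩
    0ℚ + ½         ≡⟨ ℚ.+-identityˡ ½ ⟩
    ½              ∎)
    where
    open ℚ.≤-Reasoning
    half<1 : ½ < 1ℚ
    half<1 = ℚ.*<* (ℤ.+<+ (ℕ.s≤s (ℕ.s≤s ℕ.z≤n)))

scaled-fraction : ∀ a d n → (ι a * 1/ₙ (suc d)) * (+ n ℚ./ 1) ≡ ι (a ℕ.* n) * 1/ₙ (suc d)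
scaled-fraction a d n = begin
  (ι a * 1/ₙ (suc d)) * (+ n ℚ./ 1)    ≡⟨ cong ((ι a * 1/ₙ (suc d)) *_) (ι≡ n) ⟨
  (ι a * 1/ₙ (suc d)) * ι n            ≡⟨ solve 3 (λ a e n → (a :* e) :* n := (a :* n) :* e) refl (ι a) (1/ₙ (suc d)) (ι n) ⟩
  (ι a * ι n) * 1/ₙ (suc d)            ≡⟨ cong (_* 1/ₙ (suc d)) (ι-* a n) ⟨
  ι (a ℕ.* n) * 1/ₙ (suc d)            ∎
  where open ≡-Reasoning

-- The tables for heights 3, 4 and 5

Δ-checked : ∀ k vs den-1 num →
            check (dictionary {suc k} vs) (fromℕ k) (suc den-1) (suc (ℕ.pred (6 ^ suc k))) num ≡ true →
            Δ suc k ≔ (ι num * 1/ₙ (suc den-1))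
-- Why 6 ^ h clears all denominators: a column is visited at most h times, and each visit divides by
-- 1, 2 or 3, since the start is a corner and any other vertex has its predecessor as a visited
-- neighbour.
Δ-checked k vs den-1 num = checked-hasSum (dictionary vs) (fromℕ k) den-1 (ℕ.pred (6 ^ suc k)) num

Δ-fraction : ∀ k {num den-1 p q-1} → num ℕ.* suc q-1 ≡ p ℕ.* suc den-1 →
             Δ suc k ≔ (ι num * 1/ₙ (suc den-1)) → Δ suc k ≔ (+ p / suc q-1)
Δ-fraction k {num} {den-1} {p} {q-1} eq =
  subst (λ s → Δ suc k ≔ s) (fraction-≡ num den-1 p q-1 eq)

-- The pairs (z , u) of a table stand for the coordinates z / den and u of the solution
-- of z = w + T z and of the vector u with T u ≤ (19/20)² u.

den₃ num₃ : ℕ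
-- A common denominator of all coordinates of z. It is 389 · 7207, and the factor 7207 cancels in
-- the sum over the exits.
den₃ = 2803523
num₃ = 21714691

table₃ : List (ℕ × ℕ)
table₃ =
  (7323696 , 55) ∷ (5837670 , 42) ∷ (8553325 , 55) ∷ (7323696 , 55) ∷
  (1525770 , 14) ∷ (4311900 , 29) ∷ (0 , 2) ∷ (1507621 , 15) ∷
  (1367280 , 12) ∷ (4276260 , 23) ∷ (0 , 1) ∷ (5678424 , 32) ∷
  (3661848 , 25) ∷ (3661848 , 32) ∷ (5837670 , 42) ∷ (2874901 , 25) ∷
  (5678424 , 32) ∷ (2434608 , 15) ∷ (1227240 , 12) ∷ (2642460 , 23) ∷
  (0 , 1) ∷ (3661848 , 32) ∷ (0 , 2) ∷ (2366010 , 14) ∷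
  (3471660 , 29) ∷ (8553325 , 55) ∷
  []

den₄ num₄ : ℕ
den₄ = 1987211176944275907029975656115794531721
num₄ = 15564964858858725392357736113535958119991

table₄ : List (ℕ × ℕ)
table₄ =
  (3767188353634360529103561886608604406784 , 182) ∷ (3078162940163046220643352748010136392832 , 139) ∷
  (3494344489972300888468014439993230363456 , 139) ∷ (5225269075089017754142807038923986956919 , 182) ∷
  (3767188353634360529103561886608604406784 , 182) ∷ (881455298301177682177161424967238142848 , 47) ∷
  (2196707641861868538466191323042898249984 , 94) ∷ (0 , 4) ∷
  (0 , 4) ∷ (0 , 5) ∷
  (418480091883061860971508205716370292544 , 27) ∷ (412946131665368971398422746335169194048 , 23) ∷
  (1775180134368958608563432990511388010400 , 63) ∷ (0 , 2) ∷
  (2662918266423870056098083487941690876864 , 95) ∷ (0 , 5) ∷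
  (0 , 3) ∷ (0 , 3) ∷
  (316592657283166062899158592627528228215 , 22) ∷ (408428033808314571346563767604384917760 , 24) ∷
  (521260586118645266795559661857108872448 , 27) ∷ (0 , 2) ∷
  (840448865094893255683680688900098413568 , 37) ∷ (1357454863057441010771159863124308328448 , 40) ∷
  (159076741764543868449745296459879882240 , 8) ∷ (1308836920218048982751998445948681657856 , 37) ∷
  (53559392885997033627012642272084653056 , 7) ∷ (0 , 2) ∷
  (1742550516228477551542798736234972215296 , 50) ∷ (0 , 2) ∷
  (3606240126016646830586391347519890744320 , 103) ∷ (1770472938229060180320850954710609842688 , 77) ∷
  (1996715415405300348782710931897994564096 , 107) ∷ (3078162940163046220643352748010136392832 , 139) ∷
  (831426223548430832369930952051539486592 , 47) ∷ (2662918266423870056098083487941690876864 , 95) ∷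
  (0 , 4) ∷ (0 , 3) ∷
  (0 , 4) ∷ (725020691091480634245722360231913145975 , 43) ∷
  (840448865094893255683680688900098413568 , 37) ∷ (1187773005175260884424764880233769787392 , 34) ∷
  (169681857882180126346394982890538541056 , 8) ∷ (1467913661982592851201743742408561540096 , 42) ∷
  (53559392885997033627012642272084653056 , 7) ∷ (3606240126016646830586391347519890744320 , 103) ∷
  (1110536565151689529850765259214380753408 , 43) ∷ (659936373077370650470085695496229089280 , 37) ∷
  (724626022024797164175855374587797114624 , 42) ∷ (562373625302968853083632743856888857088 , 34) ∷
  (80339089328995550440518963408126979584 , 8) ∷ (113121238588120084230929988593692360704 , 7) ∷
  (1883594176817180264551780943304302203392 , 103) ∷ (0 , 4) ∷
  (0 , 4) ∷ (0 , 3) ∷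
  (1276704489650549043884903938012772707200 , 47) ∷ (1801458450512497176758448809997363685632 , 95) ∷
  (3494344489972300888468014439993230363456 , 139) ∷ (1565469556186373889929403049132011559543 , 77) ∷
  (3659799518902643864213403989791975397376 , 107) ∷ (661195564690076956893148136680140110832 , 22) ∷
  (449341000461612572957617122534240642576 , 24) ∷ (440864061157264019344498623305311161552 , 27) ∷
  (0 , 2) ∷ (659936373077370650470085695496229089280 , 37) ∷
  (75317896245933328537986528195119043360 , 8) ∷ (649308125778863835637868846392678071264 , 37) ∷
  (642712714631964403524151707265015836672 , 40) ∷ (113121238588120084230929988593692360704 , 7) ∷
  (0 , 2) ∷ (837783928487259689570973008704156815072 , 50) ∷
  (0 , 2) ∷ (1883594176817180264551780943304302203392 , 103) ∷
  (0 , 3) ∷ (0 , 3) ∷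
  (0 , 5) ∷ (842253645012047232256795058455106028672 , 27) ∷
  (434450844638501811628108879557666678528 , 23) ∷ (1185904478021635346633575256089873365120 , 63) ∷
  (0 , 2) ∷ (1801458450512497176758448809997363685632 , 95) ∷
  (0 , 4) ∷ (0 , 4) ∷
  (0 , 5) ∷ (1548348700597058645634069693407360117952 , 47) ∷
  (1945995789375242242833944746585870245504 , 94) ∷ (5225269075089017754142807038923986956919 , 182) ∷
  (0 , 4) ∷ (0 , 5) ∷
  (0 , 2) ∷ (0 , 5) ∷
  (0 , 5) ∷ (50211930830622219025324352130079362240 , 6) ∷
  (0 , 2) ∷ (1049089203866894220237780675136364139072 , 29) ∷
  (0 , 2) ∷ (1498136769766436426608745341277280755712 , 43) ∷
  (368268161052439641946183853586290930304 , 23) ∷ (412946131665368971398422746335169194048 , 23) ∷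
  (726090930502064388325652315375023871328 , 37) ∷ (0 , 2) ∷
  (1164781496657433629489338146664410121152 , 54) ∷ (370152050169163096526171234899612881271 , 26) ∷
  (408428033808314571346563767604384917760 , 24) ∷ (0 , 2) ∷
  (2070558226579706635252971594557412195264 , 69) ∷ (0 , 2) ∷
  (4446688991111540086270072036419989157888 , 138) ∷ (2319034509208994197024641642416026709760 , 62) ∷
  (106051161176362578966496864306586588160 , 6) ∷ (0 , 2) ∷
  (484972505031555311441158813163801041152 , 29) ∷ (0 , 2) ∷
  (775404137124815103210664560660651554688 , 43) ∷ (736202483835684653290298194148519440512 , 23) ∷
  (434450844638501811628108879557666678528 , 23) ∷ (700931972990080035192416442926072323968 , 37) ∷
  (0 , 2) ∷ (1026054313387682073547784249336712130944 , 54) ∷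
  (0 , 2) ∷ (774316803278197041124078125273832471536 , 26) ∷
  (449341000461612572957617122534240642576 , 24) ∷ (1189756230456500619861371352827306333148 , 69) ∷
  (1066701110256277068649203350185939721712 , 62) ∷ (0 , 2) ∷
  (2543530549894550915021866638800531292672 , 138) ∷ (0 , 4) ∷
  (0 , 5) ∷ (0 , 2) ∷
  (0 , 5) ∷ (0 , 5) ∷
  []

infixl 5 _‼_
_‼_ : List ℕ → ℕ → ℕ
[]       ‼ _     = 0
(n ∷ _)  ‼ zero  = n
(_ ∷ ns) ‼ suc i = ns ‼ i

-- T commutes with the reflection of the strip. Splitting the solution into its symmetric
-- and its antisymmetric part halves the number of digits: each part has its own
-- denominator, and mirror images share their numerators up to sign. The nonzero entries
-- of antisymmetric₅ are numbered 1, …, 147, their negatives 148, …, 294; _‼_ is zero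
-- outside a list.
symmetricDen₅ antisymmetricDen₅ den₅ num₅ : ℕ
symmetricDen₅     = 170589856632750412387151710487940713825811838634333512896977609390083009932311029862371378494977341286
antisymmetricDen₅ = 5638149824838127199766388491218379250066047287563807187877784048107438188364913687098423096861315790
den₅ = symmetricDen₅ ℕ.* antisymmetricDen₅
-- The sum over all exit rows is invariant under the reflection, so the antisymmetric parts cancel
-- and only a multiple of `antisymmetricDen₅` remains.
num₅ = 1378977797719426292508120319816113939976127431301653261306591019746531914283455204345440885572396151962 ℕ.* antisymmetricDen₅

symmetric₅ : List ℕ
symmetric₅ =
  0 ∷
  1354903964321380249802768937744037843951560023881924455126191615773438158253030214715198382321250304 ∷
  1662852958115959439873901499074901340364410907562022317047174230365330400466459693456547741185157632 ∷
  1845603083954804975810548073614030215855182787631920478793935746716392712049953046627305956149749760 ∷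
  2032355946482070374704153406616056765927340035822886682689287423660157237379545322072797573481875456 ∷
  2072892960813226068854726828395621707739577289532759809856251259067768817933270874468063079515416576 ∷
  2230267739742499898153859281564681138042179981287126643944483186011898639342678020802757031926478208 ∷
  2399533857040693782415935837244662984929423063411002685726729160636995554116988356205335500322636288 ∷
  2768404625932207463715822110421045323782774181447880718190903620074589068074929569940958934224624640 ∷
  2856776908431293166678536268845710145798629788155095566514237229542399588720062536976956362974074880 ∷
  3071110381007141829093025968725768052474204008924132756791214989916754736835424859213696338734487552 ∷
  3109339441219839103282090242593432561609365934299139714784376888601653226899906311702094619273124864 ∷
  3327318090588311426608436065841813194714735763699608216457386635176017590455983184034314472742195392 ∷
  3345401609613749847230788922347021707063269971930689965916724779017847959014017031204135547889717312 ∷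
  3359516551220845074088733849970992641493751926480536403788730660837523284306644714678091860769893632 ∷
  3468597480493035172898158963130414087088690674646689696372226114016324903285906599216364710463710720 ∷
  3508456042070764415684449572688931556219593695193942795841109977081723112516412740083853697334907392 ∷
  3552846100045611238071013554139219803088278219574284853223127807302651727102919640538996425797361664 ∷
  3570840883038901879530987446276037988212355826640936131123732484067249673532492884872110205095508992 ∷
  4062386815156653222289837336319564325293833970973025002773903391002325954583448049661883241507793920 ∷
  4285165362646939750017804403268565218697944682232643349771355844313599383080093805465434544461112320 ∷
  4606665571510712743639538953088652078711306013386199135186822484875132105253137288820544508101731328 ∷
  4702379992386098142489084342459740361653812575787016045308172976258792300770015583604262319123824640 ∷
  4810989051941400688813110972450490359373513901264718964858644532719079883911084554978615645125448960 ∷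
  4925744847360282129333756384020075832163915850522860586249924099840687831785523099587308587416759296 ∷
  5144003341820367897947752797121389760213781298456892566647466248984523554768695733681759418249904128 ∷
  5356261324558352819296481169414056982318533739961404196685598726100874510298739327308165307643263488 ∷
  5584933288837200909412836688381428653526545718351232041461773276377853723003297318051102757757557760 ∷
  5589784290963344972242593131535673779535931907767663047733213846849421923649322735480848892696371840 ∷
  5643733843852127948385714274671659695951933116173695940979983743135018491465763759340173284610925568 ∷
  5726963448043234264775291035778571387369323212370214946080644350774195719170706572660979325661052864 ∷
  6093580222734979833434756004479346487940750956459537504160855086503488931875172074492824862261690880 ∷
  7053569988579147213733626513689610542480718863680524067962259464388188451155023375406393478685736960 ∷
  7125027972263907734023813028409588189678189484563643098320301916741087649327585352255582976073650944 ∷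
  7130260214668831784213828908265966975016510396855331324407279241792782784155101206984243330747468416 ∷
  7716005012730551846921629195682084640320671947685338849971199373476785332153043600522639127374856192 ∷
  8824858805051387992194640132544471069407224414608093893057824840117199413584645926524530018106974208 ∷
  9072365057656984112006079958125593094432593184300904911997369129792043678184723603865114873550770176 ∷
  10111114445751004792471838412096247875731348595826403069668793777259220445474349217503375113400566400 ∷
  10559157545297905578643719614109678112951569751931438741243937897125361865227599226132712373338829568 ∷
  10698510267803799783639880545185593118218724363828957129713891861913392215464602604361162510039472464 ∷
  11035601983737901842074350013065757711043986807499004556652025178345102032944504143726018243631968256 ∷
  11628543366387623611816558809158557934551747328210996946353615728935796234056119003210722752214814976 ∷
  12334186910545024283310824169915512674160195444862570950654288854623589648394834320181462626899362784 ∷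
  13691539785067800103500285031635893419919309317108114262993635012601588739425094160145967951350759424 ∷
  14631066772655966738492144442957871571106095272855453253213188072724198340447670426405349371540909824 ∷
  15405297291552166112403850138641280726634399453786703707445503844540344385230259179395158965633850336 ∷
  16399612330519028541238305141430391784383844795562188700414577000691827501541303303290277465378017088 ∷
  17027723780636643709009963665986949047189594571182783373149590358327106344240134955974366725669554880 ∷
  17244385885113411341571298585775113223007587536682399116216762819904240466528013800684964377148121088 ∷
  17487843681087259905170680711803581716904725061010548819727425302266597929167732963382305734514984704 ∷
  17902953881891049481415649673369924418752018619766334680356222350399453531144464497372202852385994861 ∷
  19048797570160994959777851779304323428638604288652249373320077769534979312232746703762988716086759168 ∷
  19185774148411070183186589208536992821977447470474784528175131619995400744696285987093957544437739136 ∷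
  19257857846212429731218418611113962262703578643648259135482413966172891689397494712087401234707245165 ∷
  19311764820856060709985315100728962544258453672972112616687158435318089447848752015829739649421033568 ∷
  19726930421107339967846741207272204979098580559261796916871963635867845091997286487324591938120212480 ∷
  19975846842704275550270376501765546126491595909299094490212473609467222349077735371840265931901411437 ∷
  20685001743651723390005070621697722536241361038099743631941849776864396970352086269936609467203140608 ∷
  20894400654115799935588399852918353644493787076284169852114013516251372024282699750390294672236508928 ∷
  21448331427201688742193787616548986413568027352063252059046806930171974866349735059968324216409395456 ∷
  24377566545819106252544891559295394514697512663245625851892801667989659741585157952276484080540939776 ∷
  24901591690064557679604132885785621958655511759821955076462397709307910180863258471427574519318170733 ∷
  24956787469272453157878237189237917969787621047257194854887916907253697978866147800052177913744302848 ∷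
  25291667315162436133644609574786374614952667051485942767128672261739529075605223558757153975304871936 ∷
  25760666450113833860318264144031415478029178104510248740202608717799011149478493851435152578958134336 ∷
  26648236144712891391234735033242305682204151438343011045434804783054798394520491385707526976539401216 ∷
  26878980101746277686747767619684017767973639174849307140328820668160402960532517595387285502642779136 ∷
  28511297612036318940024515790735028588715348425383981477318206004328679110911837749260643412216647616 ∷
  28662731908466046002562695962563959733395457345478269201664157512303259124665251757741918625002052096 ∷
  29227231892794556539305362646296917590699854836830540210640571331218860061811123478581285148227859968 ∷
  29523793310169886682253188805474681671287575105739246785683004715708093550262962687138576425481167872 ∷
  29941423423261031451901675367826234647283542936705976986866545892744085382715834185405660226137460992 ∷
  29988319542966116790029857862277450329583005109148446855113197556762056187432423907089380121915904000 ∷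
  30237140792436073764726473843285437092912214064628905631010511205023043179539298817553665479285357645 ∷
  30359263729104585048799761087693157196039071303667183459527177606529850263097843971487533004956138112 ∷
  31992875844933364187473055816151928023213705469260252997737677545029639431425723369867994869557258240 ∷
  31995636518726764003021184756717962914482629018278420928831474951293449129886053048522244082452484608 ∷
  32170844206355364187978123715309939837798402858008178075386612416655017637668075250491319113122189568 ∷
  32589531468847084946953620369257838334081251284954310103471660792541748902440521992290290036882616320 ∷
  33679864342816961698269996222262194999744699561507702626533265842259177652680417130168338087627668992 ∷
  34025231791415434562177209222767984789141045505083139680426964968689796668805268691940792443039133696 ∷
  35381144134256441662674226640406826853125995363085798197657977454007566734307994551235424897535261773 ∷
  35396394193349737429772182198952321676251979002180634382188514298081815393930809605042083936676001120 ∷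
  36203185566790481555288464454240407102314513154236110912573743854093899331942828619625899801159685760 ∷
  37098029203997508250052089065924587240788864184938510838920269804962431042230618337203214143545762304 ∷
  37606676137895287174074008382022505075203069423046816301619351615088066251102493093644936248049895424 ∷
  37721965777868119624338867930513953933069414310656749923847875918238214712861226636096806053200846848 ∷
  38382244335203059840759080564721935361398512137294718671841438818517969953450432713772600406751493632 ∷
  38678630025770892595125406618701650656225881380982656157770931461647563130007827500170149246252997376 ∷
  39683959895836693312326147859403803380005244895463752942514526387245232405996672718919627726138356128 ∷
  41105422433730211206830948002097629577801449860157051473953725842484609547475986837603073894298744296 ∷
  42164366770306155901578002764945529086931118025545448968599542098891328970747443501679247048184275840 ∷
  42850090596466822554371849355312455858548269919691233573484789808806996082389914618465322461146107904 ∷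
  43191609426732488083486845070403933728729615141398048343081124891465919974105790411696039005807453184 ∷
  44457832896855806263709303841908703860370432751669571801133644035156489145220780984183443729824481664 ∷
  45539021392672962649034479456721977635904942996566764850467796362655785455151972705235010137886202496 ∷
  47563981845398001076752838241381740304215000212949050772270670445024799930884603865323894969845919744 ∷
  47754151061269500873820595896481202866467049933313112016332755945740750894396766237160095940880647680 ∷
  48757567761606021466413217943579711644113401118155754480499901096583316745805730779822824296832815104 ∷
  49623099698229250302321233714971199343057002289924725767530222602063109104195862966816634718165248128 ∷
  49760967220965851253184327154516464688043669589082038608953792250118447537486615976198490158220445440 ∷
  50319618658633071338548918312908990274805633015844925753854097319366663682176836890421382685790935840 ∷
  51564179122395953886344288438227570310748652064123701421591480397762222694324326174452916150378446880 ∷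
  51837332645752643096426670421618105674517566437372165157421808612913048765481496774091436149438351168 ∷
  53604798438613662791850254205592312105397367500076166062533372999208519803396281430857769228768799744 ∷
  54568947342606811056181142254004951736101781347495974870802437812415709590695130201686818843225048064 ∷
  55279986858128552923674467437063824944535672160634389622241869818501585263037647465846534097220775936 ∷
  55405290752455002120365252046267909494676670794174859424142967101598185985024866247425296233252251648 ∷
  56760194716776382370168020984011947338628230818056783879269158717371624143277896462140494615573501952 ∷
  57849462719045899179980200239250078938823190736401748150956420309480304099835803864342830307987988272 ∷
  59760934102605960446979662648760118764199789170368152416693515920731136729802261504692241904766525517 ∷
  60478555672203441661247594579004391796980855020763580383272956263961618758563715519170293639809529088 ∷
  60658368427192810005583880719281922647878086363756690130495632463596708254551304806264162707454536704 ∷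
  61389510587353474865000885963675022622595416917293035555307407979054243771542734979409212910435260416 ∷
  65061319985225623215003980949870433967329573063064965089795938191039518342075628948157137962400783104 ∷
  68323667758464091292660755932548170008682055074000695658707984711262055336166266899178260632888954624 ∷
  68547972986849698963620080784435672057041915100230705280670312171393696315300406468703992818027460736 ∷
  71037713217501347239891314193114069909932424772695019124516894161086980623791314745303006013148358656 ∷
  72191580199894454999217809858136400942346083459920296414203217432832301126230730155141381293148251520 ∷
  72523630499410740950377763852638686282970189329212632428126719705421179233845287473166780053140413952 ∷
  74677549669844572699492058223381112832658626769541471251942756466713267901421771965683761878274592768 ∷
  74881815592561374150413871072942057758540394535218767070344675315741462461950656119796049047412683136 ∷
  76433656514763663385575990059188863741759245273740027273965568221851839515341287851308583015451838976 ∷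
  78188135750092248865863976561112384755754258479358267352814810713784720906991907146049060679962763392 ∷
  79690513227569739930955823940988109920003538065334767768796868701045874899932487431266222242720255232 ∷
  80343682530116585820774216265739041200548301218267422119804416738282499796837288229450385977763264000 ∷
  83749914727501556811498138181506705927091219953842376163940125596505311579606495569548876751825362944 ∷
  84929084062624888802618440851742591165964245899914106209825971817306279535287828934563872658733419520 ∷
  85716012851982808768321100511861311951057612018025560136042611617448479076107646495463466622466936960 ∷
  86994971881518735346961054613108485506031187085695814876111849299827368509115259913692300611043761920 ∷
  87545790427123206509319713569984069922914838822041288467013637955160549715656293471849541035527003136 ∷
  91248139018232647198670436297631373690753896959587454364106006785007455100320998893372543876516803008 ∷
  93360204832020792929324040454643127208049410569044853238467196506451491210351735190753110671352744192 ∷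
  94143274759140298583012063827623749790337407685665298889130263740025440246428782318505029815528712064 ∷
  95162121090902212951355713171693176978961945286491490617998018964718894559347835672051644856051450624 ∷
  98571390493469113839460255221041505528487784141473334778952640878684849945921684110613728046625328000 ∷
  109631936650830771382857499308814344567287081002040744755663414593789960282648321616671882468857716224 ∷
  114411732147300703565020305428922774372156314729157739407710973063669862999550595794243170517096740464 ∷
  116521128819382342817147683632772066102828019988424936295962674638102760873080157966832736520340027469 ∷
  117562961542354477611392914968758205129690126495300111122284981626227946213905158312217119105215240576 ∷
  125088698874721463849138755057876905405877193939916518391807212839274615438468487633324823441788921960 ∷
  145711334850688426863543431368321202551961203626959450067923409596686133489445727103045556056808021504 ∷
  148957287014174404335953753911827550024729434602952659702092287927273018749186575324475363068592252928 ∷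
  166685485109088475277916878554096595426034725151030582644908718000873243409047747344958522853764017152 ∷
  170747871924245128500206715890416159751328559122003607647682621391875569363631195394620406095271811072 ∷
  196626908532349506729818553921922830073318268087736559631775263893617328791763581530364183079901478144 ∷
  210530901360616818788202279120139850764160076430689521442222678066196039067536861516572295391174111232 ∷
  214101742243655720667733266566415888752372432257330457573346410550263288741069354401444405596269620224 ∷
  219245745585476088565681019363537278512586213555787350139993876799247812295838050135126165014519524352 ∷
  229300969544290990156727970177566591225277735821220081821896704665555518546023863553925749046355516928 ∷
  239071539682709219792867471822964329760010614196004303306390606103137624699797462293798666728160765696 ∷
  265936192113071820908567531166407760258836747224864380866365645167794225052561727763997591624426362880 ∷
  295459985423241707590820719971882441930124322330603627652048649883502318602824690451136168049907530752 ∷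
  335766874404858431382828702996309344615414233544212286435956551437350573168918208101958901534859551821 ∷
  []

antisymmetric₅ : List ℕ
antisymmetric₅ =
  0 ∷
  9781114366401299836414508197605794560103705502380114581523185955497548558664559587960975797882240 ∷
  10533666666261055156695858823180811926434867118908037705926798704627193219021327196847416267849920 ∷
  19116367477343018224938461793568582003276898034421618129035171324364017589048316058181356015882240 ∷
  21315914421671649737170896733619340186568816286288229994391287090718837981264210082243240870451200 ∷
  21924105597078140438878680460511596893688321029708373288171194695588533081385959119658925569041120 ∷
  23373027613324994950190883969223819073933863105015613405428253736596964084328961822335127788317120 ∷
  24336629807033312156080303990719898023181121731509357469526539190829684339787279564196745937090560 ∷
  24957861655425926108871096400532956474482957600336637353528226316606531590832348003571317649047040 ∷
  27506512325732059311452453438009036705923036052042247926805103883281205422206711615522586950620160 ∷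
  28674551216014527337407692690352873004915347051632427193552756986546026383572474087272034023823360 ∷
  28890016111686513998787340951853933124741045709568311521663426902393468325356114743022298555432960 ∷
  31204218108152593396825064645009317087694183424397775390845599341229257571666697104205735272499200 ∷
  31808988114520814441364508907669008565480207018380153649697598211143936898268575155151571411607680 ∷
  31973871632507474605756345100429010279853224429432344991586930636078256971896315123364861305676800 ∷
  34277112017561977073983448268895180958522083740933057606359590581915696397794702249009088327288320 ∷
  36504944710549968234120455986079847034771682597264036204289808786244526509680919346295118905635840 ∷
  37179815505520166505350904538322700921785443408662192768619598612088712128381535535879940849561600 ∷
  38431516624513728686750113421463016413505246525807710644880120933562036369415142440331539566368000 ∷
  38739808487393425093663498696120978549924427512588667881823974269749456535554669779798009008714240 ∷
  40158071149828828248847959290156102861880785576125063664700911940764818933698305929243389520134720 ∷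
  42654242328648178802253761559732637647320048916356828987510245619605088504049595186512115368468480 ∷
  43335024167529770998181011427780899687111568564352467282495140353590202488034172114533447833149440 ∷
  44401038211194203309901980696509158237557335203149870499015334222844026311901674986162841787321440 ∷
  46273776077097575846041993134152296661051773886624867347919513407325369572096558085814558519498240 ∷
  46806327162228890095237596967513975631541275136596663086268399011843886357500045656308602908748800 ∷
  47713482171781221662046763361503512848220310527570230474546397316715905347402862732727357117411520 ∷
  50205930533358163735958237685473273311309861995856541516054713993112306306620324825265539425884160 ∷
  52843708843708180936374452819238135989768154149159355283927282401887262125310765618807098057978880 ∷
  53208865150088698693692244624188227382976735499618161082198732436678832784796629740200953035944960 ∷
  55540847915185905552905368635729215110875305155907132860372138532058941911453976668402481209589760 ∷
  57161080366008827369071562410225144232821965448717972146787635690593095496878213797401819058351360 ∷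
  57796303653845673789281159803110101827804786950248440561046871804897110253667430568524992336565760 ∷
  59234973672987903182854544669428137433005041341269694959887816898522227988627050252580405976335360 ∷
  64619218959837750455812288522241675080011707019225491534129697588631552737890425621626609579294720 ∷
  66772258223039513498195147763503806238179847815362601447212009349805221298964111040017967767419545 ∷
  70996509584829746418292586150555948170128545917416209343158649866775828232683806735743582224821760 ∷
  71201212868233068766082555728355694864570821902383215730793537202622098045434737612365226680570880 ∷
  72325232627431716918630706417756809386253633534039779211233903761042850373844945798382309051827200 ∷
  72658563820734749610449008612641339601660281503498260564163046616097942010013303532153379033284352 ∷
  75308895800037245603937356528209909966964792993784812274082070989668459459930487237898309138826240 ∷
  75605256319346796706727045341518475325251518627547645889860933564073283883568372090368577059820640 ∷
  76889106264523263217359135299214280933785806609854666021193886738851845118548866648338590348124160 ∷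
  77545494957122010849772548614908125406157857231127518551725271627508517124583909304397698973035520 ∷
  79813297725133048040538366936282341074465103249427241623298098655018249177194944610301429553917440 ∷
  82330090764885080581490051577673491178771770444809834526036356161162982269178048037800502590201280 ∷
  83311271872778858329358052953593822666312957733860699290558207798088412867180965002603721814384640 ∷
  86051096477695341367858903362079077357563011158286283668451062592986563822234328540424117613784320 ∷
  88083423060780158567470511292133824940994014653322345581044136066478248375027845415869351784071040 ∷
  88852460509481854774281817004142206149507562011904542439831725347783341982940575378870608964503040 ∷
  95703330664346879363247219651740817973568015258030993439978091944479369140826578306767081844310400 ∷
  99650036005937071031612049786752111621309429285756018370195681413731148482810811275115700966727680 ∷
  107273461288485929258066050081974312727331755935582320521639943208236641241940020808138724947763200 ∷
  108698094379044077658723644206883289499266013628234819670891484949995782016817441803490161759731840 ∷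
  109345518618743875390569844708614064258124055207836423195215515191583120268585779217834439303543520 ∷
  114331533752359517416473597578336847857240114481768676625653790220366030720717978850277030057971200 ∷
  114854776686084530066372088214180550289969341600646665988262986469770952846868393058856517644581120 ∷
  118553106212526473134201865632403319624389530762015909505122072924767705712749614390099438562631680 ∷
  122488161914713908830338010867829594040652556020934898190737268101927801202876353967043892110336000 ∷
  131798536243068109992549477820855815698168399619926323136870914903356061050033005580398639026532280 ∷
  134458328960851648073335331234285399717863773356936786334892709558217682794746387293996775218222080 ∷
  137923010456223185681033614980463808899351744518310243446034060059642433980526949279998443066988800 ∷
  138459668248858451104915416287377277111828262406942573800164135328136595052120142146650132773824480 ∷
  139139744587278494702988716848735063925879516765041270287193983637369327280995160384730032386533360 ∷
  141480338593452220976832625079466610159659511582279334047998362439822168240603461189927790278463360 ∷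
  150792325374541733869303707231726533631362025860248172885352028070384849627068620262955192137839360 ∷
  153510144253067425958096680171641207765105918681385934728472782778573305057586609920884191745331200 ∷
  201059886666727315368009818416094711525641422120632919913894004654514802272651937191560604673234560 ∷
  203504370374426484986147778748350883993951617771838360646270584214503499452492150734289437383113920 ∷
  270523773875463160792813848284715913557962404496647110576307106493363137038255799997183796744676615 ∷
  272136663324046032600357788006706029696710657708488599815625018997400849412649224719506513931603200 ∷
  287418299760925304791263375543216035089596703647754733148517336832925957927950763367824051581377895 ∷
  289640141352806179017752310078284495561239302531068728705342277817727154627304116055365152760558855 ∷
  293452577745717682337528684740325369883279473994776829810016306088119687393913434801749754802054400 ∷
  294860403682496472948894152275435811581143526228156468045833645684192821378043079561380542681767175 ∷
  306413775341608009674341236275601210655232741449421657421984609579316545810443926968515602258891520 ∷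
  314924812086657364102715828981225071795519739699796981075322440716207163350157474983346638531998055 ∷
  329297743690054859969429350416931173929532623157206571962412654687993944909527438516908332989954560 ∷
  341072157598899295018637474680941430827337238627255402833587247747544214846732620901842332849470720 ∷
  352687551418705585520383229409753507316284515336046524769904122986641915382540485054330160778389760 ∷
  354190557983964818289458523306719841327776551463117334595729346182731179226914874407842019348797440 ∷
  367185636309928189867524858693192620967397159762196247257067549445235671751888025359762851733594375 ∷
  370465660001843269655621197616954286906395044855704113935694579248266105261611451651749119741587815 ∷
  373306925461307836514396985100288423331053449497538952724764517507095196815963190466023375364679680 ∷
  379503674223413023705387588102404447240842485153063113478467368681106251216147763342173872415838720 ∷
  382939642736948782145943845067473440302354247322580359484938996141244715191574428894110874087440640 ∷
  386541858611266135145410609169842254389447758038767560750700826800446922010700509400010486877949440 ∷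
  400813437787039895825849438538297460036976485549581200651569621390376402238169902081545962315299840 ∷
  421371159361462510832693958488936456715859493848388070129819117074806751560989571334442413653808640 ∷
  425520945230259641877118657837335748922414189756139902460735297942150961297508817254292415032622080 ∷
  439902303265063247582361624404998603822862213753268347392117435180983940754571801980596952661649920 ∷
  458872161662288019558466944852359253289081910191782940785250665008329327067198125884442440933942720 ∷
  462025889940809610111239113823415595957185872353403938665025106728395487807189736600587533938257920 ∷
  471876174897570722188117969505427614102715438182700692383704365817062197726468117103961813967326720 ∷
  478364654073967822813493110656573884912182343905299257744662580344038223422819582873099513090600960 ∷
  482245189275613014508657828821583072363015773296798554190678918744926291151527087706777568722259840 ∷
  491278724372523383852697377167502535966415948181769596287709959328832261321237468405039963844884480 ∷
  510898812849892994000654210555554551992990759670684556735276085047759768987255608716340534886471680 ∷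
  519953275588537911190105069857855408971331295233402023481262716315378287704809942492311997868707840 ∷
  520126300257977475170367046346528725454318258016917094304770000309666253038874478200574258508460320 ∷
  528135555806633732557420251835971051103889945324890494474640905126699193177364065103292980926686720 ∷
  545786803447882518565619513111757562388826685434411821183679093271860437114869902869798363210618880 ∷
  558843940012644340085406991586801517303685247565028727000794370253288416493509276964833076773967360 ∷
  561675925946746681142851163610167707578495301639159957035220788142126636290000547875703234904985600 ∷
  561698336867402917773695188371313651978416829749577453392022713278940369311845423177990574568284160 ∷
  583069204862203038702778397379451005943828423836303971936950691854120872632655122122477550434892160 ∷
  586207708649930239604591567083764461959955552664469369009358156037428228447186095954238844025297920 ∷
  602399936690094476242734826836432476804374396616512863921177357405449756634348662521068349383087360 ∷
  614878192976723853144142906287120014509308630854684125586648290065264809530923697277629121846499840 ∷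
  616988016316115587331702068840113257253397507336795036914472630474482535160304640482163589891189760 ∷
  633239252931260226322651690322704205497385276185386288608437695995525690375360694376363851317650560 ∷
  638506381801064384324306935490258728595720825995417932986384789240145993417559556882411436431339520 ∷
  658585968506835926275282462633906002566146520423859668104934135637802848090994620347224391282284800 ∷
  671404248049385429537574379756637572207256850269504392190400784235214268829390530082727907369871760 ∷
  691767299241247116361502041586334295443094437464538791607842176804116654649472563925967712194624000 ∷
  715208481120470343731791868542954859743522748430963388120495496057513674369432033098874766313615360 ∷
  753192262064636210112038534068159010435736422476761036806529385475834606261417282784023541520926720 ∷
  759903826679371655453416810002896228829326669685661646914688374907803218766161214156393681447201920 ∷
  774719591524712447299484315402170815657044787767665622656436058435347858615964155566291641596113920 ∷
  810543992636663924240563096605372636133136367034545662477594767872583596110385690467457939756405120 ∷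
  841398354307672284289668246051395453108646120595747744384504785484268735645024459007256490523957600 ∷
  853281590041621325440305185779117103077595408141784377242514774336144053081874351890412223010706880 ∷
  950743872926416159680238090760009517366770175803584167579720300675851855913610238225090929827501120 ∷
  951006458515949715704088013011071673846182857181559936489109947807402620449095086986588316356058880 ∷
  971878872461456898230146180157629162312610698003279197076714294048907443188529250538605365127450880 ∷
  1047590285500436735592807380586079851675864175823803483979646511823428012432677432962046461678284800 ∷
  1059962295522237056797616691449762987253604712656601542657758430115385691563557095954474716911521920 ∷
  1084770101005956902098158285124402552597649619232465676748266110435516724561058968497926402527846400 ∷
  1088929468972172901385121627991535482745534601699870179935144007867045054429622036266586759423047680 ∷
  1091022624557000672648550375399310219079257955017492637893770116618837035321055856113807629925756160 ∷
  1148818928210846346437831535202420320907062741967741078454816988423734145574723286682332622262321920 ∷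
  1166186416745784762493379709485316448865050774613685816763353056928555873218508528942644487000687360 ∷
  1192147537726729664831435031798392407000415963696613597554538253633071360174733174572322294730920320 ∷
  1233398567206115058040178328418784794429107515011475631048849855939251168204137604464780285444199040 ∷
  1276943616671606386268953628966367429556206801079707239948298605890486333337473755114637109787555840 ∷
  1351314764571632231228317062680132970109390529899310230091038027558956917964072564165607489991797560 ∷
  1373417692021183147222687908094014805252970958752598507109964664004369243024086845923317175885153920 ∷
  1488388172033419473616007202177268181731737875707271729390282529481757632990451277008071380917236560 ∷
  1489891085809745641456469009883361751734399980594996481288404236171278360421455907584174955111792640 ∷
  1549126059482733544639323554552789889167405021936266176248292053069800588410082957836755361088128000 ∷
  1587557576107247273326073667974252905580910268462073886893172174003362624779498100277086900654496000 ∷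
  1895103815320394746095139455533979079784494136410669988806339276751220721973328485471132541135588480 ∷
  2668347744511553904888194166852858546283499410286215607500962291466048766088919741772022647707008000 ∷
  2723888592426739810441099535488587761394374715442122740361334429998107708000373718440425128916597760 ∷
  2735120002734593418386389314616362352521679258101578208948174300815853987387883852812040615474427545 ∷
  2777097457576828509134791780112775988777351450941740901443533162434786540785170348180626081952542720 ∷
  3150404383038136345649188765213064412108404900439279854168297679941881737601133538646649457317222400 ∷
  3177910895363868404960641218651073448814327936491322102095102783825162943023340250262172044267842560 ∷
  []

indices₅ : List (ℕ × ℕ × ℕ)
indices₅ =
  (154 , 291 , 343) ∷ (151 , 277 , 260) ∷ (150 , 0 , 257) ∷ (151 , 130 , 260) ∷ (154 , 144 , 343) ∷ (154 , 291 , 343) ∷ (133 , 276 , 88) ∷ (142 , 179 , 174) ∷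
  (0 , 0 , 4) ∷ (0 , 0 , 4) ∷ (0 , 0 , 5) ∷ (0 , 0 , 6) ∷ (0 , 0 , 5) ∷ (0 , 0 , 3) ∷ (0 , 0 , 2) ∷ (0 , 0 , 5) ∷
  (0 , 0 , 8) ∷ (98 , 255 , 48) ∷ (79 , 189 , 42) ∷ (135 , 86 , 111) ∷ (0 , 0 , 3) ∷ (0 , 0 , 3) ∷ (0 , 0 , 2) ∷ (143 , 114 , 171) ∷
  (0 , 0 , 4) ∷ (0 , 0 , 3) ∷ (0 , 0 , 3) ∷ (0 , 0 , 6) ∷ (0 , 0 , 4) ∷ (0 , 0 , 3) ∷ (0 , 0 , 8) ∷ (0 , 0 , 4) ∷
  (0 , 0 , 4) ∷ (59 , 220 , 23) ∷ (50 , 194 , 25) ∷ (53 , 148 , 27) ∷ (0 , 0 , 2) ∷ (72 , 18 , 40) ∷ (107 , 103 , 61) ∷ (32 , 40 , 11) ∷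
  (105 , 97 , 56) ∷ (19 , 180 , 8) ∷ (0 , 0 , 2) ∷ (122 , 117 , 82) ∷ (0 , 0 , 2) ∷ (144 , 139 , 175) ∷ (0 , 0 , 9) ∷ (0 , 0 , 4) ∷
  (0 , 0 , 4) ∷ (0 , 0 , 3) ∷ (0 , 0 , 4) ∷ (0 , 0 , 3) ∷ (0 , 0 , 4) ∷ (0 , 0 , 2) ∷ (0 , 0 , 3) ∷ (51 , 216 , 20) ∷
  (43 , 170 , 19) ∷ (55 , 152 , 30) ∷ (0 , 0 , 2) ∷ (71 , 9 , 40) ∷ (49 , 52 , 26) ∷ (12 , 20 , 7) ∷ (47 , 45 , 23) ∷ (1 , 150 , 4) ∷
  (0 , 0 , 2) ∷ (65 , 68 , 34) ∷ (0 , 0 , 2) ∷ (108 , 83 , 67) ∷ (93 , 111 , 44) ∷ (27 , 37 , 10) ∷ (86 , 101 , 35) ∷ (0 , 0 , 3) ∷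
  (30 , 149 , 11) ∷ (13 , 26 , 6) ∷ (104 , 121 , 43) ∷ (0 , 0 , 2) ∷ (121 , 125 , 66) ∷ (5 , 154 , 6) ∷ (10 , 159 , 7) ∷ (0 , 0 , 2) ∷
  (0 , 0 , 2) ∷ (0 , 0 , 2) ∷ (99 , 115 , 48) ∷ (38 , 64 , 14) ∷ (95 , 110 , 42) ∷ (18 , 176 , 7) ∷ (0 , 0 , 2) ∷ (134 , 136 , 88) ∷
  (0 , 0 , 2) ∷ (147 , 145 , 192) ∷ (139 , 182 , 141) ∷ (149 , 289 , 204) ∷ (151 , 277 , 260) ∷ (126 , 261 , 88) ∷ (143 , 114 , 171) ∷ (0 , 0 , 3) ∷
  (0 , 0 , 3) ∷ (0 , 0 , 4) ∷ (0 , 0 , 5) ∷ (0 , 0 , 4) ∷ (0 , 0 , 5) ∷ (0 , 0 , 6) ∷ (0 , 0 , 4) ∷ (0 , 0 , 6) ∷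
  (88 , 231 , 45) ∷ (72 , 18 , 40) ∷ (97 , 94 , 52) ∷ (35 , 46 , 12) ∷ (113 , 106 , 65) ∷ (19 , 180 , 8) ∷ (144 , 139 , 175) ∷ (0 , 0 , 6) ∷
  (0 , 0 , 5) ∷ (0 , 0 , 6) ∷ (0 , 0 , 5) ∷ (0 , 0 , 3) ∷ (74 , 223 , 37) ∷ (71 , 9 , 40) ∷ (44 , 34 , 22) ∷ (17 , 21 , 7) ∷
  (56 , 58 , 27) ∷ (1 , 150 , 4) ∷ (108 , 83 , 67) ∷ (81 , 98 , 33) ∷ (36 , 57 , 13) ∷ (94 , 109 , 42) ∷ (37 , 17 , 14) ∷ (121 , 125 , 66) ∷
  (25 , 177 , 10) ∷ (0 , 0 , 2) ∷ (87 , 104 , 36) ∷ (41 , 66 , 15) ∷ (106 , 118 , 53) ∷ (18 , 176 , 7) ∷ (147 , 145 , 192) ∷ (111 , 71 , 75) ∷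
  (109 , 227 , 69) ∷ (127 , 274 , 77) ∷ (85 , 247 , 36) ∷ (31 , 196 , 9) ∷ (0 , 0 , 3) ∷ (76 , 243 , 31) ∷ (4 , 157 , 5) ∷ (23 , 186 , 8) ∷
  (15 , 166 , 7) ∷ (26 , 191 , 8) ∷ (25 , 30 , 10) ∷ (148 , 290 , 197) ∷ (0 , 0 , 6) ∷ (0 , 0 , 5) ∷ (0 , 0 , 4) ∷ (0 , 0 , 3) ∷
  (0 , 0 , 6) ∷ (0 , 0 , 3) ∷ (0 , 0 , 4) ∷ (0 , 0 , 3) ∷ (0 , 0 , 4) ∷ (116 , 78 , 82) ∷ (145 , 285 , 180) ∷ (150 , 0 , 257) ∷
  (116 , 225 , 82) ∷ (145 , 138 , 180) ∷ (0 , 0 , 6) ∷ (0 , 0 , 3) ∷ (0 , 0 , 4) ∷ (0 , 0 , 3) ∷ (0 , 0 , 4) ∷ (0 , 0 , 3) ∷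
  (0 , 0 , 5) ∷ (0 , 0 , 4) ∷ (0 , 0 , 6) ∷ (111 , 218 , 75) ∷ (109 , 80 , 69) ∷ (76 , 96 , 31) ∷ (4 , 10 , 5) ∷ (23 , 39 , 8) ∷
  (15 , 19 , 7) ∷ (26 , 44 , 8) ∷ (0 , 0 , 3) ∷ (85 , 100 , 36) ∷ (31 , 49 , 9) ∷ (127 , 127 , 77) ∷ (25 , 177 , 10) ∷ (148 , 143 , 197) ∷
  (74 , 76 , 37) ∷ (71 , 156 , 40) ∷ (56 , 205 , 27) ∷ (44 , 181 , 22) ∷ (17 , 168 , 7) ∷ (1 , 3 , 4) ∷ (108 , 230 , 67) ∷ (37 , 164 , 14) ∷
  (121 , 272 , 66) ∷ (94 , 256 , 42) ∷ (81 , 245 , 33) ∷ (36 , 204 , 13) ∷ (25 , 30 , 10) ∷ (0 , 0 , 2) ∷ (106 , 265 , 53) ∷ (87 , 251 , 36) ∷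
  (41 , 213 , 15) ∷ (18 , 29 , 7) ∷ (147 , 292 , 192) ∷ (0 , 0 , 5) ∷ (0 , 0 , 3) ∷ (0 , 0 , 6) ∷ (0 , 0 , 6) ∷ (0 , 0 , 5) ∷
  (88 , 84 , 45) ∷ (72 , 165 , 40) ∷ (113 , 253 , 65) ∷ (97 , 241 , 52) ∷ (35 , 193 , 12) ∷ (19 , 33 , 8) ∷ (144 , 286 , 175) ∷ (0 , 0 , 4) ∷
  (0 , 0 , 3) ∷ (0 , 0 , 3) ∷ (0 , 0 , 5) ∷ (0 , 0 , 5) ∷ (0 , 0 , 4) ∷ (0 , 0 , 6) ∷ (0 , 0 , 6) ∷ (0 , 0 , 4) ∷
  (126 , 114 , 88) ∷ (143 , 261 , 171) ∷ (151 , 130 , 260) ∷ (139 , 35 , 141) ∷ (149 , 142 , 204) ∷ (51 , 69 , 20) ∷ (43 , 23 , 19) ∷ (55 , 5 , 30) ∷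
  (0 , 0 , 2) ∷ (71 , 156 , 40) ∷ (12 , 167 , 7) ∷ (47 , 192 , 23) ∷ (49 , 199 , 26) ∷ (1 , 3 , 4) ∷ (0 , 0 , 2) ∷ (65 , 215 , 34) ∷
  (0 , 0 , 2) ∷ (108 , 230 , 67) ∷ (30 , 2 , 11) ∷ (13 , 173 , 6) ∷ (104 , 268 , 43) ∷ (0 , 0 , 2) ∷ (121 , 272 , 66) ∷ (0 , 0 , 3) ∷
  (27 , 184 , 10) ∷ (86 , 248 , 35) ∷ (93 , 258 , 44) ∷ (5 , 7 , 6) ∷ (10 , 12 , 7) ∷ (0 , 0 , 2) ∷ (0 , 0 , 2) ∷ (0 , 0 , 2) ∷
  (38 , 211 , 14) ∷ (95 , 257 , 42) ∷ (99 , 262 , 48) ∷ (18 , 29 , 7) ∷ (0 , 0 , 2) ∷ (134 , 283 , 88) ∷ (0 , 0 , 2) ∷ (147 , 292 , 192) ∷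
  (0 , 0 , 4) ∷ (0 , 0 , 3) ∷ (0 , 0 , 4) ∷ (0 , 0 , 2) ∷ (0 , 0 , 3) ∷ (0 , 0 , 3) ∷ (0 , 0 , 4) ∷ (0 , 0 , 4) ∷
  (0 , 0 , 9) ∷ (59 , 73 , 23) ∷ (50 , 47 , 25) ∷ (53 , 1 , 27) ∷ (0 , 0 , 2) ∷ (72 , 165 , 40) ∷ (32 , 187 , 11) ∷ (105 , 244 , 56) ∷
  (107 , 250 , 61) ∷ (19 , 33 , 8) ∷ (0 , 0 , 2) ∷ (122 , 264 , 82) ∷ (0 , 0 , 2) ∷ (144 , 286 , 175) ∷ (0 , 0 , 3) ∷ (0 , 0 , 3) ∷
  (0 , 0 , 4) ∷ (0 , 0 , 4) ∷ (0 , 0 , 3) ∷ (0 , 0 , 6) ∷ (0 , 0 , 4) ∷ (0 , 0 , 4) ∷ (0 , 0 , 8) ∷ (98 , 108 , 48) ∷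
  (79 , 42 , 42) ∷ (0 , 0 , 3) ∷ (0 , 0 , 3) ∷ (135 , 233 , 111) ∷ (0 , 0 , 2) ∷ (143 , 261 , 171) ∷ (0 , 0 , 4) ∷ (0 , 0 , 4) ∷
  (0 , 0 , 5) ∷ (0 , 0 , 3) ∷ (0 , 0 , 5) ∷ (0 , 0 , 6) ∷ (0 , 0 , 2) ∷ (0 , 0 , 5) ∷ (0 , 0 , 8) ∷ (133 , 129 , 88) ∷
  (142 , 32 , 174) ∷ (154 , 144 , 343) ∷ (0 , 0 , 3) ∷ (0 , 0 , 4) ∷ (0 , 0 , 5) ∷ (0 , 0 , 5) ∷ (0 , 0 , 2) ∷ (0 , 0 , 9) ∷
  (0 , 0 , 2) ∷ (0 , 0 , 4) ∷ (0 , 0 , 5) ∷ (0 , 0 , 5) ∷ (0 , 0 , 6) ∷ (0 , 0 , 8) ∷ (0 , 0 , 2) ∷ (0 , 0 , 4) ∷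
  (0 , 0 , 5) ∷ (0 , 0 , 2) ∷ (0 , 0 , 8) ∷ (0 , 0 , 8) ∷ (0 , 0 , 3) ∷ (0 , 0 , 4) ∷ (0 , 0 , 6) ∷ (0 , 0 , 7) ∷
  (0 , 0 , 9) ∷ (0 , 0 , 3) ∷ (0 , 0 , 2) ∷ (0 , 0 , 2) ∷ (0 , 0 , 9) ∷ (0 , 0 , 3) ∷ (0 , 0 , 4) ∷ (0 , 0 , 2) ∷
  (0 , 0 , 8) ∷ (0 , 0 , 9) ∷ (0 , 0 , 5) ∷ (0 , 0 , 3) ∷ (0 , 0 , 3) ∷ (0 , 0 , 7) ∷ (0 , 0 , 3) ∷ (0 , 0 , 4) ∷
  (0 , 0 , 5) ∷ (0 , 0 , 3) ∷ (0 , 0 , 5) ∷ (0 , 0 , 4) ∷ (0 , 0 , 4) ∷ (0 , 0 , 5) ∷ (0 , 0 , 2) ∷ (0 , 0 , 5) ∷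
  (0 , 0 , 5) ∷ (0 , 0 , 2) ∷ (0 , 0 , 7) ∷ (0 , 0 , 6) ∷ (0 , 0 , 2) ∷ (0 , 0 , 2) ∷ (0 , 0 , 2) ∷ (0 , 0 , 8) ∷
  (0 , 0 , 5) ∷ (0 , 0 , 4) ∷ (0 , 0 , 9) ∷ (0 , 0 , 5) ∷ (0 , 0 , 4) ∷ (0 , 0 , 2) ∷ (0 , 0 , 2) ∷ (0 , 0 , 6) ∷
  (0 , 0 , 5) ∷ (0 , 0 , 7) ∷ (0 , 0 , 4) ∷ (0 , 0 , 2) ∷ (0 , 0 , 6) ∷ (0 , 0 , 6) ∷ (28 , 160 , 11) ∷ (6 , 13 , 5) ∷
  (96 , 95 , 49) ∷ (0 , 0 , 2) ∷ (120 , 114 , 77) ∷ (92 , 252 , 40) ∷ (75 , 200 , 40) ∷ (100 , 197 , 65) ∷ (0 , 0 , 2) ∷ (123 , 0 , 97) ∷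
  (63 , 226 , 28) ∷ (50 , 194 , 25) ∷ (0 , 0 , 2) ∷ (129 , 112 , 97) ∷ (0 , 0 , 2) ∷ (146 , 140 , 212) ∷ (132 , 122 , 96) ∷ (54 , 219 , 22) ∷
  (43 , 170 , 19) ∷ (0 , 0 , 2) ∷ (91 , 59 , 57) ∷ (0 , 0 , 2) ∷ (128 , 87 , 104) ∷ (66 , 60 , 39) ∷ (29 , 190 , 10) ∷ (10 , 159 , 7) ∷
  (0 , 0 , 2) ∷ (131 , 134 , 80) ∷ (0 , 0 , 2) ∷ (147 , 145 , 192) ∷ (124 , 132 , 72) ∷ (14 , 0 , 8) ∷ (6 , 13 , 5) ∷ (68 , 91 , 26) ∷
  (0 , 0 , 2) ∷ (92 , 105 , 40) ∷ (6 , 160 , 5) ∷ (0 , 0 , 2) ∷ (48 , 6 , 25) ∷ (0 , 0 , 2) ∷ (75 , 53 , 40) ∷ (68 , 238 , 27) ∷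
  (48 , 153 , 25) ∷ (78 , 0 , 46) ∷ (0 , 0 , 2) ∷ (100 , 50 , 64) ∷ (0 , 0 , 2) ∷ (0 , 0 , 2) ∷ (0 , 0 , 2) ∷ (0 , 0 , 2) ∷
  (0 , 0 , 2) ∷ (92 , 252 , 40) ∷ (75 , 200 , 40) ∷ (100 , 197 , 65) ∷ (0 , 0 , 2) ∷ (123 , 0 , 97) ∷ (0 , 0 , 4) ∷ (0 , 0 , 3) ∷
  (0 , 0 , 4) ∷ (0 , 0 , 2) ∷ (0 , 0 , 3) ∷ (3 , 151 , 5) ∷ (9 , 158 , 6) ∷ (0 , 0 , 2) ∷ (0 , 0 , 2) ∷ (0 , 0 , 2) ∷
  (73 , 92 , 29) ∷ (8 , 14 , 6) ∷ (70 , 90 , 26) ∷ (2 , 155 , 5) ∷ (0 , 0 , 2) ∷ (89 , 102 , 38) ∷ (0 , 0 , 2) ∷ (130 , 131 , 79) ∷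
  (52 , 217 , 20) ∷ (45 , 178 , 21) ∷ (53 , 148 , 27) ∷ (0 , 0 , 2) ∷ (72 , 18 , 40) ∷ (64 , 51 , 35) ∷ (20 , 22 , 8) ∷ (61 , 36 , 33) ∷
  (7 , 162 , 5) ∷ (0 , 0 , 2) ∷ (84 , 67 , 47) ∷ (0 , 0 , 2) ∷ (125 , 85 , 98) ∷ (67 , 89 , 25) ∷ (11 , 16 , 6) ∷ (58 , 28 , 30) ∷
  (21 , 25 , 8) ∷ (22 , 174 , 9) ∷ (0 , 0 , 2) ∷ (77 , 93 , 30) ∷ (2 , 155 , 5) ∷ (130 , 131 , 79) ∷ (80 , 224 , 38) ∷ (72 , 18 , 40) ∷
  (69 , 55 , 38) ∷ (7 , 162 , 5) ∷ (125 , 85 , 98) ∷ (16 , 171 , 8) ∷ (9 , 158 , 6) ∷ (0 , 0 , 2) ∷ (83 , 99 , 33) ∷ (0 , 0 , 2) ∷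
  (130 , 131 , 79) ∷ (103 , 120 , 44) ∷ (60 , 222 , 23) ∷ (45 , 178 , 21) ∷ (0 , 0 , 2) ∷ (102 , 62 , 66) ∷ (0 , 0 , 2) ∷ (137 , 88 , 135) ∷
  (90 , 54 , 54) ∷ (57 , 221 , 23) ∷ (46 , 188 , 23) ∷ (55 , 152 , 30) ∷ (0 , 0 , 2) ∷ (71 , 9 , 40) ∷ (0 , 0 , 3) ∷ (0 , 0 , 2) ∷
  (0 , 0 , 2) ∷ (114 , 116 , 67) ∷ (40 , 63 , 15) ∷ (110 , 113 , 59) ∷ (24 , 185 , 9) ∷ (0 , 0 , 2) ∷ (138 , 137 , 113) ∷ (0 , 0 , 2) ∷
  (152 , 146 , 256) ∷ (118 , 128 , 67) ∷ (34 , 48 , 12) ∷ (115 , 124 , 57) ∷ (0 , 0 , 3) ∷ (0 , 0 , 2) ∷ (101 , 107 , 53) ∷ (42 , 65 , 16) ∷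
  (112 , 123 , 54) ∷ (39 , 61 , 15) ∷ (82 , 229 , 44) ∷ (71 , 9 , 40) ∷ (0 , 0 , 2) ∷ (117 , 119 , 72) ∷ (24 , 185 , 9) ∷ (152 , 146 , 256) ∷
  (119 , 126 , 66) ∷ (62 , 228 , 30) ∷ (46 , 188 , 23) ∷ (0 , 0 , 3) ∷ (0 , 0 , 2) ∷ (0 , 0 , 2) ∷ (141 , 135 , 130) ∷ (33 , 56 , 10) ∷
  (0 , 0 , 3) ∷ (0 , 0 , 2) ∷ (153 , 147 , 294) ∷ (0 , 0 , 2) ∷ (136 , 133 , 101) ∷ (140 , 141 , 101) ∷ (22 , 27 , 9) ∷ (0 , 0 , 2) ∷
  (77 , 240 , 30) ∷ (67 , 236 , 25) ∷ (11 , 163 , 6) ∷ (2 , 8 , 5) ∷ (130 , 278 , 79) ∷ (80 , 77 , 38) ∷ (72 , 165 , 40) ∷ (69 , 202 , 38) ∷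
  (58 , 175 , 30) ∷ (21 , 172 , 8) ∷ (7 , 15 , 5) ∷ (125 , 232 , 98) ∷ (3 , 4 , 5) ∷ (9 , 11 , 6) ∷ (0 , 0 , 2) ∷ (0 , 0 , 2) ∷
  (0 , 0 , 2) ∷ (8 , 161 , 6) ∷ (70 , 237 , 26) ∷ (2 , 8 , 5) ∷ (0 , 0 , 2) ∷ (89 , 249 , 38) ∷ (0 , 0 , 2) ∷ (130 , 278 , 79) ∷
  (52 , 70 , 20) ∷ (45 , 31 , 21) ∷ (53 , 1 , 27) ∷ (0 , 0 , 2) ∷ (72 , 165 , 40) ∷ (20 , 169 , 8) ∷ (61 , 183 , 33) ∷ (7 , 15 , 5) ∷
  (0 , 0 , 2) ∷ (84 , 214 , 47) ∷ (0 , 0 , 2) ∷ (125 , 232 , 98) ∷ (73 , 239 , 29) ∷ (64 , 198 , 35) ∷ (0 , 0 , 2) ∷ (0 , 0 , 3) ∷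
  (0 , 0 , 2) ∷ (82 , 82 , 44) ∷ (71 , 156 , 40) ∷ (117 , 266 , 72) ∷ (101 , 254 , 53) ∷ (42 , 212 , 16) ∷ (119 , 273 , 66) ∷ (112 , 270 , 54) ∷
  (39 , 208 , 15) ∷ (24 , 38 , 9) ∷ (152 , 293 , 256) ∷ (0 , 0 , 2) ∷ (0 , 0 , 2) ∷ (57 , 74 , 23) ∷ (46 , 41 , 23) ∷ (55 , 5 , 30) ∷
  (0 , 0 , 2) ∷ (71 , 156 , 40) ∷ (40 , 210 , 15) ∷ (110 , 260 , 59) ∷ (34 , 195 , 12) ∷ (115 , 271 , 57) ∷ (24 , 38 , 9) ∷ (0 , 0 , 2) ∷
  (138 , 284 , 113) ∷ (0 , 0 , 2) ∷ (152 , 293 , 256) ∷ (0 , 0 , 3) ∷ (114 , 263 , 67) ∷ (118 , 275 , 67) ∷ (0 , 0 , 4) ∷ (0 , 0 , 5) ∷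
  (0 , 0 , 3) ∷ (0 , 0 , 5) ∷ (0 , 0 , 5) ∷ (0 , 0 , 4) ∷ (0 , 0 , 3) ∷ (0 , 0 , 3) ∷ (0 , 0 , 3) ∷ (0 , 0 , 4) ∷
  (0 , 0 , 5) ∷ (0 , 0 , 7) ∷ (0 , 0 , 2) ∷ (0 , 0 , 2) ∷ (0 , 0 , 2) ∷ (0 , 0 , 6) ∷ (0 , 0 , 6) ∷ (0 , 0 , 5) ∷
  (0 , 0 , 6) ∷ (0 , 0 , 7) ∷ (0 , 0 , 4) ∷ (0 , 0 , 2) ∷ (0 , 0 , 2) ∷ (0 , 0 , 5) ∷ (0 , 0 , 4) ∷ (0 , 0 , 5) ∷
  (0 , 0 , 4) ∷ (0 , 0 , 2) ∷ (0 , 0 , 5) ∷ (0 , 0 , 5) ∷ (0 , 0 , 2) ∷ (0 , 0 , 7) ∷ (0 , 0 , 6) ∷ (0 , 0 , 2) ∷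
  (0 , 0 , 8) ∷ (0 , 0 , 9) ∷ (0 , 0 , 4) ∷ (0 , 0 , 3) ∷ (0 , 0 , 4) ∷ (0 , 0 , 2) ∷ (0 , 0 , 3) ∷ (68 , 238 , 26) ∷
  (48 , 153 , 25) ∷ (68 , 91 , 27) ∷ (48 , 6 , 25) ∷ (78 , 0 , 46) ∷ (0 , 0 , 2) ∷ (100 , 197 , 64) ∷ (0 , 0 , 2) ∷ (100 , 50 , 65) ∷
  (0 , 0 , 2) ∷ (16 , 24 , 8) ∷ (9 , 11 , 6) ∷ (83 , 246 , 33) ∷ (103 , 267 , 44) ∷ (0 , 0 , 2) ∷ (130 , 278 , 79) ∷ (0 , 0 , 2) ∷
  (60 , 75 , 23) ∷ (45 , 31 , 21) ∷ (102 , 209 , 66) ∷ (90 , 201 , 54) ∷ (0 , 0 , 2) ∷ (137 , 235 , 135) ∷ (0 , 0 , 3) ∷ (0 , 0 , 2) ∷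
  (0 , 0 , 2) ∷ (62 , 81 , 30) ∷ (46 , 41 , 23) ∷ (0 , 0 , 3) ∷ (33 , 203 , 10) ∷ (141 , 282 , 130) ∷ (0 , 0 , 2) ∷ (136 , 280 , 101) ∷
  (140 , 288 , 101) ∷ (0 , 0 , 2) ∷ (153 , 294 , 294) ∷ (28 , 13 , 11) ∷ (6 , 160 , 5) ∷ (96 , 242 , 49) ∷ (0 , 0 , 2) ∷ (120 , 261 , 77) ∷
  (92 , 105 , 40) ∷ (75 , 53 , 40) ∷ (100 , 50 , 65) ∷ (0 , 0 , 2) ∷ (123 , 0 , 97) ∷ (0 , 0 , 2) ∷ (54 , 72 , 22) ∷ (43 , 23 , 19) ∷
  (91 , 206 , 57) ∷ (66 , 207 , 39) ∷ (0 , 0 , 2) ∷ (128 , 234 , 104) ∷ (0 , 0 , 2) ∷ (29 , 43 , 10) ∷ (10 , 12 , 7) ∷ (131 , 281 , 80) ∷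
  (124 , 279 , 72) ∷ (0 , 0 , 2) ∷ (147 , 292 , 192) ∷ (0 , 0 , 2) ∷ (63 , 79 , 28) ∷ (50 , 47 , 25) ∷ (129 , 259 , 97) ∷ (132 , 269 , 96) ∷
  (0 , 0 , 2) ∷ (146 , 287 , 212) ∷ (0 , 0 , 4) ∷ (0 , 0 , 5) ∷ (0 , 0 , 5) ∷ (0 , 0 , 2) ∷ (0 , 0 , 9) ∷ (0 , 0 , 3) ∷
  (0 , 0 , 2) ∷ (0 , 0 , 4) ∷ (0 , 0 , 5) ∷ (0 , 0 , 5) ∷ (0 , 0 , 6) ∷ (0 , 0 , 8) ∷ (0 , 0 , 2) ∷ (0 , 0 , 4) ∷
  (0 , 0 , 5) ∷ (0 , 0 , 2) ∷ (0 , 0 , 8) ∷ (0 , 0 , 8) ∷ (0 , 0 , 4) ∷ (0 , 0 , 3) ∷ (0 , 0 , 6) ∷ (0 , 0 , 9) ∷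
  (0 , 0 , 7) ∷ (0 , 0 , 3) ∷ (0 , 0 , 2) ∷ (0 , 0 , 2) ∷ (0 , 0 , 4) ∷ (0 , 0 , 3) ∷ (0 , 0 , 9) ∷ (0 , 0 , 2) ∷
  (0 , 0 , 8) ∷ (0 , 0 , 9) ∷
  []

table₅ : List (ℕ × ℕ)
table₅ = map (λ (i , j , u) →
  -- For j ≤ 147 the last lookup hits the entry 0 at position 0, and for j > 147 the middle one
  -- falls outside the list. So at most one antisymmetric term is nonzero, and the truncated
  -- subtraction realises the sign.
  (symmetric₅ ‼ i) ℕ.* antisymmetricDen₅ ℕ.+ (antisymmetric₅ ‼ j) ℕ.* symmetricDen₅ ∸ (antisymmetric₅ ‼ (j ∸ 147)) ℕ.* symmetricDen₅ , u) indices₅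

Δ₃ : Δ 3 ≔ (+ 3013 / 389)
Δ₃ = Δ-fraction 2 {num₃} {ℕ.pred den₃} {3013} {388} refl (Δ-checked 2 table₃ (ℕ.pred den₃) num₃ refl)

Δ₄ : Δ 4 ≔ (+ 163501511557499670817 / 20874575314535639327)
Δ₄ = Δ-fraction 3 {num₄} {ℕ.pred den₄} {163501511557499670817} {20874575314535639326} refl
  (Δ-checked 3 table₄ (ℕ.pred den₄) num₄ refl)

Δ₅ : Δ 5 ≔ (ι num₅ * 1/ₙ (suc (ℕ.pred den₅)))
Δ₅ = Δ-checked 4 table₅ (ℕ.pred den₅) num₅ refl

Δ₅-rounded : round ((ι num₅ * 1/ₙ (suc (ℕ.pred den₅))) * (+ (10 ^ 10) / 1)) ≡ + 80835861225
Δ₅-rounded = trans (cong round (scaled-fraction num₅ (ℕ.pred den₅) (10 ^ 10)))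
  (round-≡ (num₅ ℕ.* 10 ^ 10) (ℕ.pred den₅) 80835861224 (≤ᵇ-sound _ _ refl) (≤ᵇ-sound _ _ refl))

mainTheorem7 : (Δ 3 ≔ (+ 3013 / 389)) ×
    (Δ 4 ≔ (+ 163501511557499670817 / 20874575314535639327)) ×
    (∃[ q ] ((Δ 5 ≔ q) × (round (q * (+ (10 ^ 10) / 1)) ≡ + 80835861225)))
mainTheorem7 = Δ₃ , Δ₄ , (ι num₅ * 1/ₙ (suc (ℕ.pred den₅)) , Δ₅ , Δ₅-rounded)
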